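{- Let $m,n,s,k,c$ be positive integers such that $2\leq s\leq n$, $2\leq k\leq m$ and $ms=nk$. A magic rectangle set with empty cells $\mathrm{MRS}(m,n;s,k;c)$ exists if and only if either $nkc$ is odd, or $s$ and $k$ are both even and $sk>4$.
   Context: A partially filled array of size $m\times n$ is an $m\times n$ array in which some cells may be empty. Given a subset $\Omega$ of an abelian group $(\Gamma,+)$, a magic partially filled array set $\mathrm{MS}_\Omega(m,n;s,k;c)$ is a set of $c$ partially filled arrays of size $m\times n$ with entries in $\Omega$ such that: (a) every $\omega\in\Omega$ appears exactly once, in exactly one of the arrays; (b) in every array, each row contains exactly $s$ filled cells and each column contains exactly $k$ filled cells; (c) there exist (not necessarily distinct) $x,y\in\Gamma$ such that, in every array, the entries of each row sum to $x$ and the entries of each column sum to $y$. A magic rectangle set with empty cells $\mathrm{MRS}(m,n;s,k;c)$ is an $\mathrm{MS}_\Omega(m,n;s,k;c)$ with $\Omega=\{1,2,\ldots,nkc\}\subset(\mathbb{Z},+)$. -}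

module Defs where

open import Data.Nat using (ℕ; zero; suc; _+_; _*_; _≤_)
open import Data.Fin using (Fin)
open import Data.Maybe using (Maybe; just; nothing)
open import Data.Product using (Σ; ∃; _×_; _,_)
open import Relation.Binary.PropositionalEquality using (_≡_)

∑ : (n : ℕ) → (Fin n → ℕ) → ℕ
∑ zero    f = 0
∑ (suc n) f = f Fin.zero + ∑ n (λ i → f (Fin.suc i))

val : Maybe ℕ → ℕ
val (just v) = v
val nothing  = 0

filled : Maybe ℕ → ℕ
filled (just _) = 1
filled nothing  = 0

-- A partially filled m×n array over ℕ: nothing = empty cell
PFA : ℕ → ℕ → Set
PFA m n = Fin m → Fin n → Maybe ℕ

PFASet : ℕ → ℕ → ℕ → Set
PFASet m n c = Fin c → PFA m n

-- MRS(m,n;s,k;c): an MS_Ω(m,n;s,k;c) with Ω = {1,…,nkc} ⊂ (ℤ,+)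
record IsMRS (m n s k c : ℕ) (A : PFASet m n c) : Set where
  field
    entries-in-Ω : ∀ t i j v → A t i j ≡ just v → (1 ≤ v × v ≤ n * k * c)
    every-appears : ∀ ω → 1 ≤ ω → ω ≤ n * k * c →
                    Σ (Fin c) λ t → Σ (Fin m) λ i → Σ (Fin n) λ j → A t i j ≡ just ω
    appears-once : ∀ t i j t' i' j' v → A t i j ≡ just v → A t' i' j' ≡ just v →
                   (t ≡ t' × i ≡ i' × j ≡ j')
    row-count : ∀ t i → ∑ n (λ j → filled (A t i j)) ≡ s
    col-count : ∀ t j → ∑ m (λ i → filled (A t i j)) ≡ k
    x : ℕ
    y : ℕ
    row-sum : ∀ t i → ∑ n (λ j → val (A t i j)) ≡ x
    col-sum : ∀ t j → ∑ m (λ i → val (A t i j)) ≡ y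

MRSExists : (m n s k c : ℕ) → Set
MRSExists m n s k c = Σ (PFASet m n c) (IsMRS m n s k c)

{-# OPTIONS --safe #-}
module Submission where

-- Counting all entries gives row sum s(N+1)/2 and column sum k(N+1)/2 with N = nkc, so s and k are
-- even when N is; and for s = k = 2 the entry 1 would share both its row and its column with N.
--
-- For s = 2a, k = 2b, a ≥ 2, put cell P < ms in row P mod m and column P div k and let cells 2l and
-- 2l+1 carry complementary labels, so that columns balance automatically; if m is even, rows come in
-- complementary pairs of zero-sum rows, and if m is odd, the rows form a cycle in which neighbours
-- share a complementary pairs, the sums of these bundles being equal.
--
-- For N odd, let g = gcd(s,k), s = s₁g, k = k₁g, m = k₁d, n = s₁d.  If g ≥ 3, the array is a k₁×s₁
-- grid of d×d squares with g filled broken diagonals, labelled digit by digit in mixed radix.  If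
-- g = 1, it is block diagonal with d full k×s rectangles.  A single one is a zero-sum array with entries
-- -M, …, M, cut into blocks built on triples x, u, x+u, coming from nested pairs (u, x+u).  Extra
-- copies add a digit on which cell (i,j) acts by uᵢvⱼ, with units uᵢ, vⱼ of ℤ[ω] of sum 0, where
-- ω acts on residues by a permutation.

open import Defs
open import Data.Nat using (ℕ; zero; suc; pred; _+_; _*_; _∸_; _≤_; _<_; _>_; s≤s; z≤n; NonZero; >-nonZero)
open import Data.Nat.Properties
open import Data.Nat.DivMod using (_%_; m%n<n; m<n⇒m%n≡m; m%n%n≡m%n; %-distribˡ-+; %-distribˡ-*; [m+kn]%n≡m%n; n%n≡0)
open import Data.Nat.Divisibility using (_∣_; _∣?_; divides; ∣m⇒∣m*n; ∣n⇒∣m*n; m∣m*n; ∣m+n∣m⇒∣n; *-cancelʳ-∣; *-monoˡ-∣; ∣1⇒≡1; ∣-refl)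
open import Data.Nat.GCD using (gcd; gcd[m,n]∣m; gcd[m,n]∣n; gcd-greatest)
open import Data.Nat.Coprimality using (Coprime; coprime-divisor)
open import Data.Nat.Tactic.RingSolver using (solve-∀)
open import Data.Bool using (Bool; true; false; not; if_then_else_)
open import Data.Fin as Fin using (Fin; toℕ; fromℕ<; opposite; combine; remQuot; cast; punchOut; _↑ˡ_; _↑ʳ_)
open import Data.Fin.Patterns
open import Data.Fin.Properties as Fin using (any?; toℕ<n; toℕ-injective; toℕ-fromℕ<; toℕ-cast; toℕ-↑ˡ; toℕ-↑ʳ; ↑ˡ-injective; ↑ʳ-injective; opposite-prop; opposite-involutive; remQuot-combine; combine-remQuot; toℕ-combine; combine-injective)
open import Data.List using (List; []; _∷_; _++_; map; tabulate; concatMap; length)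
open import Data.List.Properties using (++-assoc; map-++; length-++; length-tabulate; concatMap-++)
open import Data.List.Relation.Unary.All as All using (All; []; _∷_)
open import Data.List.Relation.Unary.Any using (here; there)
open import Data.List.Membership.Propositional using (_∈_)
open import Data.List.Membership.Propositional.Properties using (∈-++⁻; ∈-++⁺ˡ; ∈-++⁺ʳ; ∈-tabulate⁺; ∈-tabulate⁻; ∈-map⁺; ∈-map⁻)
open import Data.List.Relation.Binary.Permutation.Propositional as Perm using (_↭_; ↭-refl; ↭-sym; ↭-trans; ↭-reflexive; prep; swap)
open import Data.List.Relation.Binary.Permutation.Propositional.Properties using (map⁺; ++⁺; ++⁺ˡ; ++⁺ʳ; drop-∷; ++-comm; ∈-resp-↭; ↭-length; ++-commutativeMonoid) renaming (shift to move-to-front)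
open import Data.Maybe using (Maybe; just; nothing; from-just; _>>=_)
open import Data.Maybe.Properties using (just-injective)
open import Data.Product using (Σ; ∃; ∃₂; _×_; _,_; proj₁; proj₂)
open import Data.Sum using (_⊎_; inj₁; inj₂)
open import Data.Vec as Vec using (Vec; []; _∷_)
open import Data.Empty using (⊥; ⊥-elim)
open import Relation.Nullary using (¬_; yes; no; Dec; does; _×-dec_)
open import Relation.Nullary.Decidable using (dec-true; dec-false)
open import Relation.Binary.Definitions using (tri<; tri≈; tri>)
open import Relation.Binary.PropositionalEquality
open import Function using (_∘_)
open import Function.Bundles using (_⇔_; mk⇔)
import Algebra.Solver.CommutativeMonoid as MonoidSolver

open MonoidSolver (++-commutativeMonoid {A = ℕ}) using (solve; _⊜_; _⊕_)

-- The relation 1 + ω + ω² = 0 stands for three permutations of 0, ..., 2h with constant sum 3h;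
-- together with pairs x, 2h - x they give any odd number from 3 on of permutations with constant
-- sum. For an even number m of values, a permutations would have to sum to a(m - 1)/2, impossible
-- for odd a; hence the zero-sum rows and their signs when m is even. For g = 1 broken diagonals
-- would leave one cell per row, so full rectangles are needed there; k₁ and s₁, coprime and above
-- 1, are then distinct, and no full square is ever required. Pairs nested around c numbers have
-- differences c + 1, c + 3, .... Around four numbers these are 5, 7, ..., around three 4, 6, ....
-- The centres themselves split into pairs with differences 3, 1 and 2 and one midpoint, and the
-- core of the rectangle absorbs exactly these. So differences and pairs together exhaust an initial
-- run of the positive integers; the labels beyond it are consecutive and are used four at a time,
-- by y - (y + 1) - (y + 2) + (y + 3) = 0.

-- Finite sums over `Fin` and the pigeonhole principle

∑-cong : ∀ n {f g : Fin n → ℕ} → (∀ i → f i ≡ g i) → ∑ n f ≡ ∑ n g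
∑-cong zero    e = refl
∑-cong (suc n) e = cong₂ _+_ (e Fin.zero) (∑-cong n (e ∘ Fin.suc))

∑-distrib-+ : ∀ n (f g : Fin n → ℕ) → ∑ n (λ i → f i + g i) ≡ ∑ n f + ∑ n g
∑-distrib-+ zero    f g = refl
∑-distrib-+ (suc n) f g rewrite ∑-distrib-+ n (f ∘ Fin.suc) (g ∘ Fin.suc) =
  interchange (f Fin.zero) (g Fin.zero) _ _
  where
  interchange : ∀ a b c d → (a + b) + (c + d) ≡ (a + c) + (b + d)
  interchange = solve-∀

∑-const : ∀ n c → ∑ n (λ _ → c) ≡ n * c
∑-const zero    c = refl
∑-const (suc n) c = cong (c +_) (∑-const n c)

∑-zero : ∀ n {f : Fin n → ℕ} → (∀ i → f i ≡ 0) → ∑ n f ≡ 0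
∑-zero n e = trans (∑-cong n e) (trans (∑-const n 0) (*-zeroʳ n))

∑-*ˡ : ∀ n c (f : Fin n → ℕ) → ∑ n (λ i → c * f i) ≡ c * ∑ n f
∑-*ˡ zero    c f = sym (*-zeroʳ c)
∑-*ˡ (suc n) c f = trans (cong (c * f Fin.zero +_) (∑-*ˡ n c (f ∘ Fin.suc))) (sym (*-distribˡ-+ c _ _))

∑-*ʳ : ∀ n c (f : Fin n → ℕ) → ∑ n (λ i → f i * c) ≡ ∑ n f * c
∑-*ʳ n c f = trans (∑-cong n (λ i → *-comm (f i) c)) (trans (∑-*ˡ n c f) (*-comm c _))

∑-swap : ∀ m n (f : Fin m → Fin n → ℕ) → ∑ m (λ i → ∑ n (f i)) ≡ ∑ n (λ j → ∑ m (λ i → f i j))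
∑-swap zero    n f = sym (∑-zero n (λ _ → refl))
∑-swap (suc m) n f = trans (cong (∑ n (f Fin.zero) +_) (∑-swap m n (f ∘ Fin.suc)))
                           (sym (∑-distrib-+ n (f Fin.zero) _))

∑-++ : ∀ m n (f : Fin (m + n) → ℕ) → ∑ (m + n) f ≡ ∑ m (f ∘ (_↑ˡ n)) + ∑ n (f ∘ (m ↑ʳ_))
∑-++ zero    n f = refl
∑-++ (suc m) n f = trans (cong (f Fin.zero +_) (∑-++ m n (f ∘ Fin.suc))) (sym (+-assoc (f Fin.zero) _ _))

∑-combine : ∀ m n (f : Fin (m * n) → ℕ) → ∑ (m * n) f ≡ ∑ m (λ i → ∑ n (λ j → f (combine i j)))
∑-combine zero    n f = refl
∑-combine (suc m) n f = trans (∑-++ n (m * n) f) (cong (∑ n (f ∘ (_↑ˡ (m * n))) +_) (∑-combine m n (f ∘ (n ↑ʳ_))))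

∑-single : ∀ n (f : Fin n → ℕ) i → (∀ j → j ≢ i → f j ≡ 0) → ∑ n f ≡ f i
∑-single (suc n) f Fin.zero    e =
  trans (cong (f Fin.zero +_) (∑-zero n (λ j → e (Fin.suc j) λ ()))) (+-identityʳ _)
∑-single (suc n) f (Fin.suc i) e =
  cong₂ _+_ (e Fin.zero λ ()) (∑-single n (f ∘ Fin.suc) i (λ j j≢i → e (Fin.suc j) (j≢i ∘ Fin.suc-injective)))

opaque
  δ : ∀ {n} → Fin n → Fin n → ℕ
  δ i j = if does (i Fin.≟ j) then 1 else 0

  δ-≡ : ∀ {n} {i j : Fin n} → i ≡ j → δ i j ≡ 1
  δ-≡ {i = i} {j} e = cong (if_then 1 else 0) (dec-true (i Fin.≟ j) e)

  δ-≢ : ∀ {n} {i j : Fin n} → i ≢ j → δ i j ≡ 0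
  δ-≢ {i = i} {j} i≢j = cong (if_then 1 else 0) (dec-false (i Fin.≟ j) i≢j)

δ-cong : ∀ {m n} {i j : Fin m} {k l : Fin n} → (i ≡ j → k ≡ l) → (k ≡ l → i ≡ j) → δ i j ≡ δ k l
δ-cong {i = i} {j} f g with i Fin.≟ j
... | yes e  = trans (δ-≡ e) (sym (δ-≡ (f e)))
... | no i≢j = trans (δ-≢ i≢j) (sym (δ-≢ (i≢j ∘ g)))

∑-δ : ∀ n (i : Fin n) (f : Fin n → ℕ) → ∑ n (λ j → δ i j * f j) ≡ f i
∑-δ n i f = trans (∑-single n _ i (λ j j≢i → cong (_* f j) (δ-≢ (j≢i ∘ sym))))
                  (trans (cong (_* f i) (δ-≡ {i = i} refl)) (+-identityʳ _))

-- If y were missed, `punchOut` at y would squeeze f into an injection from `Fin (suc n)` to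
-- `Fin n`.
inj⇒surj : ∀ {n} (f : Fin n → Fin n) → (∀ {x y} → f x ≡ f y → x ≡ y) → ∀ y → ∃ λ x → f x ≡ y
inj⇒surj {suc n} f inj y with any? (λ x → f x Fin.≟ y)
... | yes p = p
... | no ¬p = ⊥-elim (<-irrefl refl (Fin.injective⇒≤ {f = g} g-inj))
  where
  g : Fin (suc n) → Fin n
  g x = punchOut {i = y} {j = f x} (λ e → ¬p (x , sym e))
  g-inj : ∀ {a b} → g a ≡ g b → a ≡ b
  g-inj {a} {b} e = inj (Fin.punchOut-injective {i = y} (λ q → ¬p (a , sym q)) (λ q → ¬p (b , sym q)) e)

∑-fibre : ∀ {m n} (f : Fin n → Fin m) → (∀ {x y} → f x ≡ f y → x ≡ y) → (g : Fin n → ℕ) → ∀ x →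
          ∑ n (λ y → δ (f y) (f x) * g y) ≡ g x
∑-fibre {n = n} f inj g x =
  trans (∑-single n _ x (λ y y≢x → cong (_* g y) (δ-≢ (y≢x ∘ inj))))
        (trans (cong (_* g x) (δ-≡ {i = f x} refl)) (+-identityʳ _))

-- Partially filled arrays from labelled cells

-- Data for c arrays sharing one pattern of filled cells: ρ and κ give the row and column of a
-- cell, and label counts from 0.
record CellLabelling (m n s k c L : ℕ) : Set where
  field
    ρ         : Fin L → Fin m
    κ         : Fin L → Fin n
    cell-inj  : ∀ {P Q} → ρ P ≡ ρ Q → κ P ≡ κ Q → P ≡ Q
    label     : Fin c → Fin L → Fin (c * L)
    label-inj : ∀ {t u P Q} → label t P ≡ label u Q → t ≡ u × P ≡ Q
    ρ-count   : ∀ i → ∑ L (λ P → δ (ρ P) i) ≡ s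
    κ-count   : ∀ j → ∑ L (λ P → δ (κ P) j) ≡ k
    x y       : ℕ
    ρ-sum     : ∀ t i → ∑ L (λ P → δ (ρ P) i * toℕ (label t P)) ≡ x
    κ-sum     : ∀ t j → ∑ L (λ P → δ (κ P) j * toℕ (label t P)) ≡ y

MRS-fromCells : ∀ {m n s k c L} → L ≡ n * k → CellLabelling m n s k c L → MRSExists m n s k c
MRS-fromCells {m} {n} {s} {k} {c} {L} L≡nk cl = A , record
  { entries-in-Ω  = inΩ
  ; every-appears = appears
  ; appears-once  = once
  ; row-count     = λ t i → trans (rows t i filled (λ _ → 1) refl (λ _ → refl))
                                  (trans (∑-cong L (λ P → *-identityʳ _)) (ρ-count i))
  ; col-count     = λ t j → trans (cols t j filled (λ _ → 1) refl (λ _ → refl))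
                                  (trans (∑-cong L (λ P → *-identityʳ _)) (κ-count j))
  -- Entries exceed their labels by one, so a line sum grows by the number of filled cells in the
  -- line.
  ; x             = s + x
  ; y             = k + y
  ; row-sum       = λ t i → trans (rows t i val (λ P → suc (toℕ (label t P))) refl (λ _ → refl))
                                  (trans (∑-suc (λ P → δ (ρ P) i) (λ P → toℕ (label t P)))
                                         (cong₂ _+_ (ρ-count i) (ρ-sum t i)))
  ; col-sum       = λ t j → trans (cols t j val (λ P → suc (toℕ (label t P))) refl (λ _ → refl))
                                  (trans (∑-suc (λ P → δ (κ P) j) (λ P → toℕ (label t P)))
                                         (cong₂ _+_ (κ-count j) (κ-sum t j)))
  }
  where
  open CellLabelling cl

  cell? : ∀ i j → Dec (∃ λ P → ρ P ≡ i × κ P ≡ j)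
  cell? i j = any? (λ P → (ρ P Fin.≟ i) ×-dec (κ P Fin.≟ j))

  entry : ∀ {i j} → Fin c → Dec (∃ λ P → ρ P ≡ i × κ P ≡ j) → Maybe ℕ
  entry t (yes (P , _)) = just (suc (toℕ (label t P)))
  entry t (no _)        = nothing

  A : PFASet m n c
  A t i j = entry t (cell? i j)

  N≡ : c * L ≡ n * k * c
  N≡ = trans (*-comm c L) (cong (_* c) L≡nk)

  ∑-suc : (f g : Fin L → ℕ) → ∑ L (λ P → f P * suc (g P)) ≡ ∑ L f + ∑ L (λ P → f P * g P)
  ∑-suc f g = trans (∑-cong L (λ P → *-suc (f P) (g P))) (∑-distrib-+ L f _)

  filled-at : ∀ t P → A t (ρ P) (κ P) ≡ just (suc (toℕ (label t P)))
  filled-at t P with cell? (ρ P) (κ P)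
  ... | yes (Q , e , e') = cong (λ z → just (suc (toℕ (label t z)))) (cell-inj e e')
  ... | no ¬p            = ⊥-elim (¬p (P , refl , refl))

  cell-of : ∀ t i j v → A t i j ≡ just v → ∃ λ P → ρ P ≡ i × κ P ≡ j × v ≡ suc (toℕ (label t P))
  cell-of t i j v e with cell? i j
  ... | yes (P , p , q) = P , p , q , sym (just-injective e)
  cell-of t i j v () | no _

  inΩ : ∀ t i j v → A t i j ≡ just v → 1 ≤ v × v ≤ n * k * c
  inΩ t i j v e with cell-of t i j v e
  ... | P , _ , _ , refl = s≤s z≤n , subst (suc (toℕ (label t P)) ≤_) N≡ (toℕ<n (label t P))

  -- The labelling of all cells of all copies as a self-map of one finite set: being injective it is
  -- onto, which gives `every-appears`.
  labels : Fin (c * L) → Fin (c * L)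
  labels z = label (proj₁ (remQuot {c} L z)) (proj₂ (remQuot {c} L z))

  labels-inj : ∀ {a b} → labels a ≡ labels b → a ≡ b
  labels-inj {a} {b} e with label-inj e
  ... | p , q = trans (sym (combine-remQuot {c} L a)) (trans (cong₂ combine p q) (combine-remQuot {c} L b))

  appears : ∀ ω → 1 ≤ ω → ω ≤ n * k * c → Σ (Fin c) λ t → Σ (Fin m) λ i → Σ (Fin n) λ j → A t i j ≡ just ω
  appears (suc v) _ le with inj⇒surj labels labels-inj (fromℕ< (subst (suc v ≤_) (sym N≡) le))
  ... | z , e = let (t , P) = remQuot {c} L z in
    t , ρ P , κ P , trans (filled-at t P) (cong (just ∘ suc) (trans (cong toℕ e) (toℕ-fromℕ< _)))

  once : ∀ t i j t' i' j' v → A t i j ≡ just v → A t' i' j' ≡ just v → t ≡ t' × i ≡ i' × j ≡ j'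
  once t i j t' i' j' v e e' with cell-of t i j v e | cell-of t' i' j' v e'
  ... | P , refl , refl , q | P' , refl , refl , q' with label-inj (toℕ-injective (suc-injective (trans (sym q) q')))
  ... | refl , refl = refl , refl , refl

  module _ (t : Fin c) (f : Maybe ℕ → ℕ) (w : Fin L → ℕ) (f0 : f nothing ≡ 0)
           (fw : ∀ P → f (just (suc (toℕ (label t P)))) ≡ w P) where
    -- Spreading an entry over all cells P turns row and column sums, after an exchange of
    -- summations, into the sums over cells that `CellLabelling` controls.
    value : ∀ i j → f (A t i j) ≡ ∑ L (λ P → δ (ρ P) i * (δ (κ P) j * w P))
    value i j with cell? i j
    ... | yes (P , refl , refl) = trans (fw P) (sym (trans
            (∑-single L _ P (λ Q Q≢P → off Q Q≢P))
            (trans (cong₂ (λ a b → a * (b * w P)) (δ-≡ {i = ρ P} refl) (δ-≡ {i = κ P} refl))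
                   (trans (+-identityʳ _) (+-identityʳ _)))))
      where
      off : ∀ Q → Q ≢ P → δ (ρ Q) (ρ P) * (δ (κ Q) (κ P) * w Q) ≡ 0
      off Q Q≢P with ρ Q Fin.≟ ρ P
      ... | no ne = cong (_* (δ (κ Q) (κ P) * w Q)) (δ-≢ ne)
      ... | yes e = cong₂ (λ a b → a * (b * w Q)) (δ-≡ e) (δ-≢ (λ e' → Q≢P (cell-inj e e')))
    ... | no ¬p = trans f0 (sym (∑-zero L off))
      where
      off : ∀ Q → δ (ρ Q) i * (δ (κ Q) j * w Q) ≡ 0
      off Q with ρ Q Fin.≟ i
      ... | no ne = cong (_* (δ (κ Q) j * w Q)) (δ-≢ ne)
      ... | yes e = cong₂ (λ a b → a * (b * w Q)) (δ-≡ e) (δ-≢ (λ e' → ¬p (Q , e , e')))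

    rows' : ∀ i → ∑ n (λ j → f (A t i j)) ≡ ∑ L (λ P → δ (ρ P) i * w P)
    rows' i = trans (∑-cong n (value i)) (trans (∑-swap n L _) (∑-cong L (λ P →
      trans (∑-*ˡ n (δ (ρ P) i) _) (cong (δ (ρ P) i *_) (∑-δ n (κ P) (λ _ → w P))))))

    cols' : ∀ j → ∑ m (λ i → f (A t i j)) ≡ ∑ L (λ P → δ (κ P) j * w P)
    cols' j = trans (∑-cong m (λ i → value i j)) (trans (∑-swap m L _) (∑-cong L (λ P →
      ∑-δ m (ρ P) (λ _ → δ (κ P) j * w P))))

  rows : ∀ t i f w f0 fw → ∑ n (λ j → f (A t i j)) ≡ ∑ L (λ P → δ (ρ P) i * w P)
  rows t i f w f0 fw = rows' t f w f0 fw i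

  cols : ∀ t j f w f0 fw → ∑ m (λ i → f (A t i j)) ≡ ∑ L (λ P → δ (κ P) j * w P)
  cols t j f w f0 fw = cols' t f w f0 fw j

-- Transposing, tiling and block-diagonal placement

MRS-transpose : ∀ {m n s k c} → m * s ≡ n * k → MRSExists m n s k c → MRSExists n m k s c
MRS-transpose {m} {n} {s} {k} {c} ms≡nk (A , M) = (λ t j i → A t i j) , record
  { entries-in-Ω  = λ t j i v e → let (p , q) = entries-in-Ω t i j v e in p , subst (v ≤_) (sym N≡) q
  ; every-appears = λ ω p q → let (t , i , j , e) = every-appears ω p (subst (ω ≤_) N≡ q) in t , j , i , e
  ; appears-once  = λ t j i t' j' i' v e e' → let (p , q , r) = appears-once t i j t' i' j' v e e' in p , r , q
  ; row-count = col-count ; col-count = row-count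
  ; x = y ; y = x ; row-sum = col-sum ; col-sum = row-sum
  }
  where
  open IsMRS M
  N≡ : m * s * c ≡ n * k * c
  N≡ = cong (_* c) ms≡nk

∑-remQuot : ∀ p m (f : Fin p → Fin m → ℕ) →
            ∑ (p * m) (λ I → f (proj₁ (remQuot {p} m I)) (proj₂ (remQuot {p} m I))) ≡ ∑ p (λ a → ∑ m (f a))
∑-remQuot p m f = trans (∑-combine p m _) (∑-cong p λ a → ∑-cong m λ b →
  cong (λ z → f (proj₁ z) (proj₂ z)) (remQuot-combine a b))

remQuot-injective : ∀ p m {I J : Fin (p * m)} → proj₁ (remQuot {p} m I) ≡ proj₁ (remQuot {p} m J) →
                    proj₂ (remQuot {p} m I) ≡ proj₂ (remQuot {p} m J) → I ≡ J
remQuot-injective p m {I} {J} e e' =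
  trans (sym (combine-remQuot {p} m I)) (trans (cong₂ combine e e') (combine-remQuot {p} m J))

-- Each large array is a p by q grid of different members of the given set, so no entry is repeated;
-- a row crosses q of them and a column p.
MRS-tile : ∀ p q {m n s k c} → MRSExists m n s k (c * (p * q)) → MRSExists (p * m) (q * n) (q * s) (p * k) c
MRS-tile p q {m} {n} {s} {k} {c} (A , M) = B , record
  { entries-in-Ω  = λ t I J v e → let (a , b) = entries-in-Ω _ _ _ v e in a , subst (v ≤_) N≡ b
  ; every-appears = appears
  ; appears-once  = once
  ; row-count = λ t I → row t I filled s row-count
  ; col-count = λ t J → col t J filled k col-count
  ; x = q * x ; y = p * y
  ; row-sum = λ t I → row t I val x row-sum
  ; col-sum = λ t J → col t J val y col-sum
  }
  where
  open IsMRS M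
  N≡ : n * k * (c * (p * q)) ≡ q * n * (p * k) * c
  N≡ = e n k c p q
    where
    e : ∀ n k c p q → n * k * (c * (p * q)) ≡ q * n * (p * k) * c
    e = solve-∀

  B : PFASet (p * m) (q * n) c
  B t I J = A (combine t (combine (proj₁ (remQuot {p} m I)) (proj₁ (remQuot {q} n J))))
              (proj₂ (remQuot {p} m I)) (proj₂ (remQuot {q} n J))

  row : ∀ t I f X → (∀ u i → ∑ n (λ j → f (A u i j)) ≡ X) → ∑ (q * n) (λ J → f (B t I J)) ≡ q * X
  row t I f X h = trans
    (∑-remQuot q n (λ b j → f (A (combine t (combine (proj₁ (remQuot {p} m I)) b)) (proj₂ (remQuot {p} m I)) j)))
    (trans (∑-cong q (λ b → h (combine t (combine (proj₁ (remQuot {p} m I)) b)) _)) (∑-const q X))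

  col : ∀ t J f X → (∀ u j → ∑ m (λ i → f (A u i j)) ≡ X) → ∑ (p * m) (λ I → f (B t I J)) ≡ p * X
  col t J f X h = trans
    (∑-remQuot p m (λ a i → f (A (combine t (combine a (proj₁ (remQuot {q} n J)))) i (proj₂ (remQuot {q} n J)))))
    (trans (∑-cong p (λ a → h (combine t (combine a (proj₁ (remQuot {q} n J)))) _)) (∑-const p X))

  appears : ∀ ω → 1 ≤ ω → ω ≤ q * n * (p * k) * c → Σ (Fin c) λ t → Σ (Fin (p * m)) λ I → Σ (Fin (q * n)) λ J → B t I J ≡ just ω
  appears ω a b with every-appears ω a (subst (ω ≤_) (sym N≡) b)
  ... | u , i , j , e with Fin.combine-surjective {c} {p * q} u
  ... | t , u' , refl with Fin.combine-surjective {p} {q} u'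
  ... | z , z' , refl = t , combine z i , combine z' j , trans
        (cong₂ (λ a b → A (combine t (combine (proj₁ a) (proj₁ b))) (proj₂ a) (proj₂ b))
               (remQuot-combine z i) (remQuot-combine z' j)) e

  once : ∀ t I J t' I' J' v → B t I J ≡ just v → B t' I' J' ≡ just v → t ≡ t' × I ≡ I' × J ≡ J'
  once t I J t' I' J' v e e' with appears-once _ _ _ _ _ _ v e e'
  ... | a , b , d with combine-injective t _ t' _ a
  ... | a₁ , a₂ with combine-injective (proj₁ (remQuot {p} m I)) _ _ _ a₂
  ... | a₃ , a₄ = a₁ , remQuot-injective p m a₃ b , remQuot-injective q n a₄ d

-- A row or column of the large array meets just one of its d diagonal blocks, so counts and sums
-- are those of the small arrays.
MRS-diagonal : ∀ d {m n s k c} → MRSExists m n s k (d * c) → MRSExists (d * m) (d * n) s k c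
MRS-diagonal d {m} {n} {s} {k} {c} (A , M) = B , record
  { entries-in-Ω  = λ t I J v e → let (_ , e') = on-diag t I J v e
                                      (a , b) = entries-in-Ω _ _ _ v e' in a , subst (v ≤_) N≡ b
  ; every-appears = appears
  ; appears-once  = once
  ; row-count = λ t I → trans (row t I filled refl) (row-count _ _)
  ; col-count = λ t J → trans (col t J filled refl) (col-count _ _)
  ; x = x ; y = y
  ; row-sum = λ t I → trans (row t I val refl) (row-sum _ _)
  ; col-sum = λ t J → trans (col t J val refl) (col-sum _ _)
  }
  where
  open IsMRS M
  N≡ : n * k * (d * c) ≡ d * n * k * c
  N≡ = e n k c d
    where
    e : ∀ n k c d → n * k * (d * c) ≡ d * n * k * c
    e = solve-∀

  B' : Fin c → Fin d × Fin m → Fin d × Fin n → Maybe ℕ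
  B' t (z , i) (z' , j) = if does (z Fin.≟ z') then A (combine z t) i j else nothing

  B : PFASet (d * m) (d * n) c
  B t I J = B' t (remQuot {d} m I) (remQuot {d} n J)

  on : ∀ t {z z'} i j → z ≡ z' → B' t (z , i) (z' , j) ≡ A (combine z t) i j
  on t {z} {z'} i j e with z Fin.≟ z'
  ... | yes _ = refl
  ... | no ¬e = ⊥-elim (¬e e)

  off : ∀ t {z z'} i j → z ≢ z' → B' t (z , i) (z' , j) ≡ nothing
  off t {z} {z'} i j ne with z Fin.≟ z'
  ... | yes e = ⊥-elim (ne e)
  ... | no _ = refl

  on-diag : ∀ t I J v → B t I J ≡ just v → proj₁ (remQuot {d} m I) ≡ proj₁ (remQuot {d} n J) ×
            A (combine (proj₁ (remQuot {d} m I)) t) (proj₂ (remQuot {d} m I)) (proj₂ (remQuot {d} n J)) ≡ just v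
  on-diag t I J v e with proj₁ (remQuot {d} m I) Fin.≟ proj₁ (remQuot {d} n J)
  ... | yes p = p , e
  on-diag t I J v () | no _

  appears : ∀ ω → 1 ≤ ω → ω ≤ d * n * k * c → Σ (Fin c) λ t → Σ (Fin (d * m)) λ I → Σ (Fin (d * n)) λ J → B t I J ≡ just ω
  appears ω a b with every-appears ω a (subst (ω ≤_) (sym N≡) b)
  ... | u , i , j , e with Fin.combine-surjective {d} {c} u
  ... | z , t , refl = t , combine z i , combine z j , trans
        (trans (cong₂ (B' t) (remQuot-combine z i) (remQuot-combine z j)) (on t i j refl)) e

  once : ∀ t I J t' I' J' v → B t I J ≡ just v → B t' I' J' ≡ just v → t ≡ t' × I ≡ I' × J ≡ J'
  once t I J t' I' J' v e e' with on-diag t I J v e | on-diag t' I' J' v e'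
  ... | p , f | p' , f' with appears-once _ _ _ _ _ _ v f f'
  ... | a , b , r with combine-injective (proj₁ (remQuot {d} m I)) t _ _ a
  ... | a₁ , a₂ = a₂ , remQuot-injective d m a₁ b , remQuot-injective d n (trans (sym p) (trans a₁ p')) r

  row : ∀ t I f → f nothing ≡ 0 → ∑ (d * n) (λ J → f (B t I J)) ≡
        ∑ n (λ j → f (A (combine (proj₁ (remQuot {d} m I)) t) (proj₂ (remQuot {d} m I)) j))
  row t I f f0 = trans (∑-remQuot d n (λ z j → f (B' t (remQuot {d} m I) (z , j)))) (trans
    (∑-single d _ (proj₁ (remQuot {d} m I)) (λ z ne → ∑-zero n (λ j → trans (cong f (off t _ j (ne ∘ sym))) f0)))
    (∑-cong n (λ j → cong f (on t _ j refl))))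

  col : ∀ t J f → f nothing ≡ 0 → ∑ (d * m) (λ I → f (B t I J)) ≡
        ∑ m (λ i → f (A (combine (proj₁ (remQuot {d} n J)) t) i (proj₂ (remQuot {d} n J))))
  col t J f f0 = trans (∑-remQuot d m (λ z i → f (B' t (z , i) (remQuot {d} n J)))) (trans
    (∑-single d _ (proj₁ (remQuot {d} n J)) (λ z ne → ∑-zero m (λ i → trans (cong f (off t i _ ne)) f0)))
    (∑-cong m (λ i → cong f (on t i _ refl))))

-- Necessity

hits : Maybe ℕ → ℕ → ℕ
hits (just v) w = if does (v ≟ w) then 1 else 0
hits nothing  w = 0

hits-≡ : ∀ {a w} → a ≡ just w → hits a w ≡ 1
hits-≡ {w = w} refl = cong (if_then 1 else 0) (dec-true (w ≟ w) refl)

hits-≢ : ∀ {a w} → a ≢ just w → hits a w ≡ 0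
hits-≢ {just v} {w} ne = cong (if_then 1 else 0) (dec-false (v ≟ w) (ne ∘ cong just))
hits-≢ {nothing} ne = refl

-- Written in this form, entries can be summed over ω first, and every ω is hit exactly once.
val-hits : ∀ N a → (∀ v → a ≡ just v → 1 ≤ v × v ≤ N) →
           val a ≡ ∑ N (λ ω → hits a (suc (toℕ ω)) * suc (toℕ ω))
val-hits N nothing  h = sym (∑-zero N (λ _ → refl))
val-hits N (just zero) h with h zero refl
... | () , _
val-hits N (just (suc v)) h with h (suc v) refl
... | _ , v<N = sym (trans
  (∑-single N _ (fromℕ< v<N) (λ ω ne → cong (_* suc (toℕ ω)) (hits-≢ (λ e → ne (toℕ-injective
    (trans (sym (suc-injective (just-injective e))) (sym (toℕ-fromℕ< v<N))))))))
  (trans (cong (λ z → hits (just (suc v)) (suc z) * suc z) (toℕ-fromℕ< v<N))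
         (trans (cong (_* suc v) (hits-≡ {just (suc v)} refl)) (+-identityʳ _))))

∑-gauss : ∀ n → 2 * ∑ n (λ i → suc (toℕ i)) ≡ n * suc n
∑-gauss zero    = refl
∑-gauss (suc n) = trans (cong (λ z → 2 * suc z) (trans (∑-distrib-+ n (λ _ → 1) (λ i → suc (toℕ i)))
                          (cong (_+ ∑ n (λ i → suc (toℕ i))) (trans (∑-const n 1) (*-identityʳ n)))))
                  (trans (lem n _) (trans (cong (λ z → 2 + 2 * n + z) (∑-gauss n)) (lem' n)))
  where
  lem : ∀ n s → 2 * suc (n + s) ≡ 2 + 2 * n + 2 * s
  lem = solve-∀
  lem' : ∀ n → 2 + 2 * n + n * suc n ≡ suc n * suc (suc n)
  lem' = solve-∀

module _ {m n s k c : ℕ} {A : PFASet m n c} (M : IsMRS m n s k c A) where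
  open IsMRS M

  private
    N = n * k * c

  entries-total : ∑ c (λ t → ∑ m (λ i → ∑ n (λ j → val (A t i j)))) ≡ ∑ N (λ ω → suc (toℕ ω))
  entries-total = trans (∑-cong c λ t → trans (∑-cong m λ i → trans (∑-cong n λ j → val-hits N (A t i j) (entries-in-Ω t i j))
                   (∑-swap n N _)) (∑-swap m N _))
          (trans (∑-swap c N _) (∑-cong N λ ω → trans
            (∑-cong c λ t → trans (∑-cong m λ i → ∑-*ʳ n (suc (toℕ ω)) _) (∑-*ʳ m (suc (toℕ ω)) _))
            (trans (∑-*ʳ c (suc (toℕ ω)) _) (trans (cong (_* suc (toℕ ω)) (unique ω)) (+-identityʳ _)))))
    where
    unique : ∀ ω → ∑ c (λ t → ∑ m (λ i → ∑ n (λ j → hits (A t i j) (suc (toℕ ω))))) ≡ 1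
    unique ω with every-appears (suc (toℕ ω)) (s≤s z≤n) (toℕ<n ω)
    ... | t₀ , i₀ , j₀ , e = trans
      (∑-single c _ t₀ λ t ne → ∑-zero m λ i → ∑-zero n λ j → hits-≢ λ e' →
        ne (proj₁ (appears-once t i j t₀ i₀ j₀ _ e' e)))
      (trans (∑-single m _ i₀ λ i ne → ∑-zero n λ j → hits-≢ λ e' →
        ne (proj₁ (proj₂ (appears-once t₀ i j t₀ i₀ j₀ _ e' e))))
      (trans (∑-single n _ j₀ λ j ne → hits-≢ λ e' →
        ne (proj₂ (proj₂ (appears-once t₀ i₀ j t₀ i₀ j₀ _ e' e))))
      (hits-≡ e)))

  total-rows : 2 * (c * (m * x)) ≡ N * suc N
  total-rows = trans (cong (2 *_) (sym (trans (∑-cong c λ t → trans (∑-cong m λ i → row-sum t i) (∑-const m x)) (∑-const c (m * x)))))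
                     (trans (cong (2 *_) entries-total) (∑-gauss N))

  total-cols : 2 * (c * (n * y)) ≡ N * suc N
  total-cols = trans (cong (2 *_) (sym (trans (∑-cong c λ t → trans (∑-swap m n _) (trans (∑-cong n λ j → col-sum t j) (∑-const n y))) (∑-const c (n * y)))))
                     (trans (cong (2 *_) entries-total) (∑-gauss N))

  row-total : 1 ≤ m → 1 ≤ c → m * s ≡ n * k → 2 * x ≡ s * suc N
  row-total m≥1 c≥1 ms≡nk = *-cancelˡ-≡ _ _ (c * m) {{>-nonZero (*-mono-≤ c≥1 m≥1)}}
    (trans (e₁ c m x) (trans total-rows (trans (cong (λ z → z * c * suc N) (sym ms≡nk)) (e₂ m s c (suc N)))))
    where
    e₁ : ∀ c m x → c * m * (2 * x) ≡ 2 * (c * (m * x))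
    e₁ = solve-∀
    e₂ : ∀ m s c r → m * s * c * r ≡ c * m * (s * r)
    e₂ = solve-∀

  col-total : 1 ≤ n → 1 ≤ c → 2 * y ≡ k * suc N
  col-total n≥1 c≥1 = *-cancelˡ-≡ _ _ (c * n) {{>-nonZero (*-mono-≤ c≥1 n≥1)}}
    (trans (e₁ c n y) (trans total-cols (e₂ n k c (suc N))))
    where
    e₁ : ∀ c m x → c * m * (2 * x) ≡ 2 * (c * (m * x))
    e₁ = solve-∀
    e₂ : ∀ m s c r → m * s * c * r ≡ c * m * (s * r)
    e₂ = solve-∀

-- The right-hand side is s + sN, and sN is even with N.
even-factor : ∀ {N s x} → 2 ∣ N → 2 * x ≡ s * suc N → 2 ∣ s
even-factor {N} {s} {x} 2∣N e =
  ∣m+n∣m⇒∣n {m = s * N} (subst (2 ∣_) (trans e (trans (*-suc s N) (+-comm s _))) (m∣m*n x)) (∣n⇒∣m*n s 2∣N)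

filled-0 : ∀ n (f : Fin n → Maybe ℕ) → ∑ n (filled ∘ f) ≡ 0 → ∑ n (val ∘ f) ≡ 0
filled-0 zero    f e = refl
filled-0 (suc n) f e with f Fin.zero
... | nothing = filled-0 n (f ∘ Fin.suc) e
filled-0 (suc n) f () | just _

filled-1 : ∀ n (f : Fin n → Maybe ℕ) → ∑ n (filled ∘ f) ≡ 1 → ∃ λ j → f j ≡ just (∑ n (val ∘ f))
filled-1 (suc n) f e with f Fin.zero in f0
... | nothing = let (j , p) = filled-1 n (f ∘ Fin.suc) e in Fin.suc j , p
... | just v  = Fin.zero , trans f0 (cong just (sym (trans
      (cong (v +_) (filled-0 n (f ∘ Fin.suc) (suc-injective e))) (+-identityʳ v))))

filled-1-val : ∀ n (f : Fin n → Maybe ℕ) j {v} → ∑ n (filled ∘ f) ≡ 1 → f j ≡ just v → ∑ n (val ∘ f) ≡ v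
filled-1-val (suc n) f Fin.zero {v} e p with f Fin.zero
filled-1-val (suc n) f Fin.zero {v} e refl | just .v =
  trans (cong (v +_) (filled-0 n (f ∘ Fin.suc) (suc-injective e))) (+-identityʳ v)
filled-1-val (suc n) f (Fin.suc j) e p with f Fin.zero
... | nothing = filled-1-val n (f ∘ Fin.suc) j e p
... | just _ = ⊥-elim (impossible n (f ∘ Fin.suc) j (suc-injective e) p)
  where
  impossible : ∀ n (f : Fin n → Maybe ℕ) j {v} → ∑ n (filled ∘ f) ≡ 0 → f j ≡ just v → ⊥
  impossible (suc n) f Fin.zero e p with f Fin.zero
  impossible (suc n) f Fin.zero () refl | just _
  impossible (suc n) f (Fin.suc j) e p with f Fin.zero
  ... | nothing = impossible n (f ∘ Fin.suc) j e p
  impossible (suc n) f (Fin.suc j) () p | just _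

filled-2 : ∀ n (f : Fin n → Maybe ℕ) j {v} → ∑ n (filled ∘ f) ≡ 2 → f j ≡ just v →
           ∃ λ j' → j' ≢ j × ∃ λ w → f j' ≡ just w × ∑ n (val ∘ f) ≡ v + w
filled-2 (suc n) f Fin.zero {v} e p with f Fin.zero
filled-2 (suc n) f Fin.zero {v} e refl | just .v =
  let (j , q) = filled-1 n (f ∘ Fin.suc) (suc-injective e) in Fin.suc j , (λ ()) , _ , q , refl
filled-2 (suc n) f (Fin.suc j) e p with f Fin.zero in f0
... | nothing = let (j' , ne , w , q , r) = filled-2 n (f ∘ Fin.suc) j e p in
                Fin.suc j' , (λ z → ne (Fin.suc-injective z)) , w , q , r
... | just w  = Fin.zero , (λ ()) , w , f0 ,
                trans (cong (w +_) (filled-1-val n (f ∘ Fin.suc) j (suc-injective e) p)) (+-comm w _)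

necessity : ∀ {m n s k c} → 1 ≤ m → 1 ≤ n → 1 ≤ c → 2 ≤ s → 2 ≤ k → m * s ≡ n * k → MRSExists m n s k c →
            (¬ (2 ∣ n * k * c)) ⊎ (2 ∣ s × 2 ∣ k × s * k > 4)
necessity {m} {n} {s} {k} {c} m≥1 n≥1 c≥1 s≥2 k≥2 ms≡nk (A , M) with 2 ∣? (n * k * c)
... | no ¬e = inj₁ ¬e
... | yes e = inj₂ (even-factor {x = x} e rt , even-factor {x = y} e ct , ≤∧≢⇒< (*-mono-≤ s≥2 k≥2) (not-4 s≥2 k≥2 rt ct row-count col-count row-sum col-sum ∘ sym))
  where
  open IsMRS M
  N = n * k * c
  rt : 2 * x ≡ s * suc N
  rt = row-total M m≥1 c≥1 ms≡nk
  ct : 2 * y ≡ k * suc N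
  ct = col-total M n≥1 c≥1

  N≥1 : 1 ≤ N
  N≥1 = *-mono-≤ (*-mono-≤ n≥1 (≤-trans (s≤s z≤n) k≥2)) c≥1

  not-4 : ∀ {s k} → 2 ≤ s → 2 ≤ k → 2 * x ≡ s * suc N → 2 * y ≡ k * suc N →
    (∀ t i → ∑ n (λ j → filled (A t i j)) ≡ s) → (∀ t j → ∑ m (λ i → filled (A t i j)) ≡ k) →
    (∀ t i → ∑ n (λ j → val (A t i j)) ≡ x) → (∀ t j → ∑ m (λ i → val (A t i j)) ≡ y) → s * k ≢ 4
  not-4 {suc (suc (suc s))} {suc (suc k)} (s≤s (s≤s _)) (s≤s (s≤s _)) _ _ _ _ _ _ e =
    <-irrefl (sym e) (≤-trans (s≤s (s≤s (s≤s (s≤s (s≤s z≤n))))) (*-mono-≤ {3} {3 + s} {2} {2 + k} (s≤s (s≤s (s≤s z≤n))) (s≤s (s≤s z≤n))))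
  not-4 {suc (suc zero)} {suc (suc (suc k))} _ _ _ _ _ _ _ _ e =
    <-irrefl (sym e) (≤-trans (s≤s (s≤s (s≤s (s≤s (s≤s z≤n))))) (*-monoʳ-≤ 2 {3} {3 + k} (s≤s (s≤s (s≤s z≤n)))))
  -- Here x = y. The partners w and w' of the entry 1 in its row and its column both complete it to
  -- that sum, so one value would stand in two cells.
  not-4 {suc (suc zero)} {suc (suc zero)} _ _ rt ct rc cc rs cs e with every-appears 1 (s≤s z≤n) N≥1
  ... | t , i , j , p with filled-2 n (A t i) j (rc t i) p | filled-2 m (λ i → A t i j) i (cc t j) p
  ... | j' , j'≢j , w , q , r | i' , i'≢i , w' , q' , r' =
    i'≢i (proj₁ (proj₂ (appears-once t i' j t i j' w' q' (trans q (cong just w≡w')))))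
    where
    w≡w' : w ≡ w'
    w≡w' = suc-injective (trans (sym r) (trans (rs t i) (trans (*-cancelˡ-≡ x y 2 (trans rt (sym ct))) (trans (sym (cs t j)) r'))))
  not-4 {suc zero} (s≤s ())
  not-4 {suc (suc _)} {suc zero} _ (s≤s ())

-- Permutations with constant sums

opposite-injective : ∀ {n} {i j : Fin n} → opposite i ≡ opposite j → i ≡ j
opposite-injective {i = i} {j} e =
  trans (sym (opposite-involutive i)) (trans (cong opposite e) (opposite-involutive j))

+-opposite : ∀ {n} (i : Fin (suc n)) → toℕ i + toℕ (opposite i) ≡ n
+-opposite {n} i = trans (cong (toℕ i +_) (opposite-prop i)) (m+[n∸m]≡n (≤-pred (toℕ<n i)))

data Parity : ℕ → Set where
  even : ∀ p → Parity (p + p)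
  odd  : ∀ p → Parity (suc (p + p))

parity : ∀ n → Parity n
parity zero = even 0
parity (suc n) with parity n
... | even p = odd p
... | odd p  = subst Parity (cong suc (+-suc p p)) (even (suc p))

mod-+ : ∀ n a c → (a % suc n + c) % suc n ≡ (a + c) % suc n
mod-+ n a c = trans (%-distribˡ-+ (a % suc n) c (suc n))
              (trans (cong (λ z → (z + c % suc n) % suc n) (m%n%n≡m%n a (suc n))) (sym (%-distribˡ-+ a c (suc n))))

-- Modulo n + 1 the number n is -1, so adding c n undoes the addition of c without subtraction.
mod-cancel : ∀ n c {a b} → (a + c) % suc n ≡ (b + c) % suc n → a % suc n ≡ b % suc n
mod-cancel n c {a} {b} e = trans (sym (undo a)) (trans (cong (λ z → (z + c * n) % suc n) e) (undo b))
  where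
  undo : ∀ a → ((a + c) % suc n + c * n) % suc n ≡ a % suc n
  undo a = trans (mod-+ n (a + c) (c * n))
    (trans (cong (_% suc n) (trans (+-assoc a c (c * n)) (cong (a +_) (sym (*-suc c n))))) ([m+kn]%n≡m%n a c (suc n)))

rot : ∀ {n} → ℕ → Fin (suc n) → Fin (suc n)
rot {n} a x = fromℕ< (m%n<n (toℕ x + a) (suc n))

toℕ-rot : ∀ {n} a (x : Fin (suc n)) → toℕ (rot a x) ≡ (toℕ x + a) % suc n
toℕ-rot a x = toℕ-fromℕ< _

rot-injective : ∀ {n} a {x y : Fin (suc n)} → rot a x ≡ rot a y → x ≡ y
rot-injective {n} a {x} {y} e = toℕ-injective (trans (sym (m<n⇒m%n≡m (toℕ<n x))) (trans
  (mod-cancel n a {toℕ x} {toℕ y} (trans (sym (toℕ-rot a x)) (trans (cong toℕ e) (toℕ-rot a y)))) (m<n⇒m%n≡m (toℕ<n y))))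

rot-injectiveˡ : ∀ {n} {a b} (x : Fin (suc n)) → a < suc n → b < suc n → rot a x ≡ rot b x → a ≡ b
rot-injectiveˡ {n} {a} {b} x la lb e = trans (sym (m<n⇒m%n≡m la)) (trans
  (mod-cancel n (toℕ x) {a} {b} (trans (cong (_% suc n) (+-comm a (toℕ x))) (trans
    (trans (sym (toℕ-rot a x)) (trans (cong toℕ e) (toℕ-rot b x)))
    (cong (_% suc n) (+-comm (toℕ x) b))))) (m<n⇒m%n≡m lb))

rot-rot : ∀ {n} a b (x : Fin (suc n)) → rot a (rot b x) ≡ rot (b + a) x
rot-rot {n} a b x = toℕ-injective (trans (toℕ-rot a (rot b x)) (trans
  (cong (λ z → (z + a) % suc n) (toℕ-rot b x)) (trans (mod-+ n (toℕ x + b) a)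
  (trans (cong (_% suc n) (+-assoc (toℕ x) b a)) (sym (toℕ-rot (b + a) x))))))

rot-surjective : ∀ {n} a (y : Fin (suc n)) → ∃ λ x → rot a x ≡ y
rot-surjective a = inj⇒surj (rot a) (rot-injective a)

+-double-injective : ∀ {p q} → p + p ≡ q + q → p ≡ q
+-double-injective {p} {q} e with <-cmp p q
... | tri< lt _ _ = ⊥-elim (<⇒≢ (+-mono-< lt lt) e)
... | tri≈ _ eq _ = eq
... | tri> _ _ gt = ⊥-elim (<⇒≢ (+-mono-< gt gt) (sym e))

p+p≢1+q+q : ∀ p q → p + p ≢ suc (q + q)
p+p≢1+q+q p q e = even≢odd p q (trans (cong (p +_) (+-identityʳ p)) (trans e (cong (λ z → suc (q + z)) (sym (+-identityʳ q)))))

module Odd (h : ℕ) where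
  d : ℕ
  d = suc (h + h)

  -- The zigzag h, 2h, h-1, 2h-1, …, h+1, 0.
  zigℕ : ∀ {x} → Parity x → ℕ
  zigℕ (even p) = h ∸ p
  zigℕ (odd p)  = h + h ∸ p

  half-≤ : ∀ {p} → p + p < d → p ≤ h
  half-≤ {p} (s≤s le) with ≤-total p h
  ... | inj₁ q = q
  ... | inj₂ q with m≤n⇒m<n∨m≡n q
  ... | inj₁ h<p = ⊥-elim (<-irrefl refl (<-≤-trans (+-mono-< h<p h<p) le))
  ... | inj₂ refl = ≤-refl

  half-< : ∀ {p} → suc (p + p) < d → p < h
  half-< {p} (s≤s le) = ≤∧≢⇒< (half-≤ (s≤s (<⇒≤ le))) λ { refl → <-irrefl refl le }

  zig<d : ∀ {x} (v : Parity x) → x < d → zigℕ v < d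
  zig<d (even p) lt = s≤s (≤-trans (m∸n≤m h p) (m≤m+n h h))
  zig<d (odd p)  lt = s≤s (m∸n≤m (h + h) p)

  -- Even positions descend from h, odd ones descend from 2h and stay above h; so the two halves of
  -- the zigzag do not meet.
  zig-inj : ∀ {x y} (v : Parity x) (w : Parity y) → x < d → y < d → zigℕ v ≡ zigℕ w → x ≡ y
  zig-inj (even p) (even q) a b e =
    cong (λ z → z + z) (∸-cancelˡ-≡ {p} {h} {q} (half-≤ {p} a) (half-≤ {q} b) e)
  zig-inj (odd p)  (odd q)  a b e = cong (λ z → suc (z + z))
    (∸-cancelˡ-≡ {p} {h + h} {q} (≤-trans (<⇒≤ (half-< {p} a)) (m≤m+n h h)) (≤-trans (<⇒≤ (half-< {q} b)) (m≤m+n h h)) e)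
  zig-inj (even p) (odd q)  a b e = ⊥-elim (<⇒≢ (≤-<-trans (m∸n≤m h p)
    (subst (h <_) (sym (+-∸-assoc h (<⇒≤ (half-< {q} b)))) (m<m+n h (m<n⇒0<n∸m (half-< {q} b))))) e)
  zig-inj (odd p)  (even q) a b e = sym (zig-inj (even q) (odd p) b a (sym e))

  zig : Fin d → Fin d
  zig x = fromℕ< (zig<d (parity (toℕ x)) (toℕ<n x))

  zig-injective : ∀ {x y} → zig x ≡ zig y → x ≡ y
  zig-injective {x} {y} e = toℕ-injective (zig-inj (parity (toℕ x)) (parity (toℕ y)) (toℕ<n x) (toℕ<n y)
    (trans (sym (toℕ-fromℕ< _)) (trans (cong toℕ e) (toℕ-fromℕ< _))))

  zigℕ-irrelevant : ∀ {x y} (v : Parity x) (w : Parity y) → x ≡ y → zigℕ v ≡ zigℕ w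
  zigℕ-irrelevant (even p) (even q) e = cong (h ∸_) (+-double-injective {p} {q} e)
  zigℕ-irrelevant (odd p)  (odd q)  e = cong (h + h ∸_) (+-double-injective {p} {q} (suc-injective e))
  zigℕ-irrelevant (even p) (odd q)  e = ⊥-elim (p+p≢1+q+q p q e)
  zigℕ-irrelevant (odd p)  (even q) e = ⊥-elim (p+p≢1+q+q q p (sym e))

  toℕ-zig : ∀ x {y} (v : Parity y) → toℕ x ≡ y → toℕ (zig x) ≡ zigℕ v
  toℕ-zig x v e = trans (toℕ-fromℕ< _) (zigℕ-irrelevant (parity (toℕ x)) v e)

  toℕ-rot-suc : ∀ x → suc (toℕ x) < d → toℕ (rot 1 x) ≡ suc (toℕ x)
  toℕ-rot-suc x lt = trans (toℕ-rot 1 x) (trans (cong (_% d) (+-comm (toℕ x) 1)) (m<n⇒m%n≡m lt))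

  -- Neighbouring terms of the zigzag have sums 3h, 3h - 1, 3h - 2, ..., each step replacing a term
  -- by one smaller by 1.
  zig-sum : ∀ x → toℕ x + (toℕ (zig x) + toℕ (zig (rot 1 x))) ≡ h + h + h
  zig-sum x = lem (parity (toℕ x)) refl (toℕ<n x)
    where
    even-sum : ∀ p r → (p + p) + (r + (p + r + r)) ≡ p + r + (p + r) + (p + r)
    even-sum = solve-∀
    odd-sum : ∀ p r → suc (p + p) + (suc p + r + (suc r) + r) ≡ suc p + r + (suc p + r) + (suc p + r)
    odd-sum = solve-∀
    lem : ∀ {y} → Parity y → toℕ x ≡ y → y < d → toℕ x + (toℕ (zig x) + toℕ (zig (rot 1 x))) ≡ h + h + h
    lem (even p) e lt with m≤n⇒m<n∨m≡n (half-≤ {p} lt)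
    -- The last position x = 2h wraps around: its term is 0 and the next one is the initial h.
    ... | inj₂ refl = trans (cong₂ _+_ e (cong₂ _+_ (trans (toℕ-zig x (even p) e) (n∸n≡0 p)) (toℕ-zig (rot 1 x) (even 0)
            (trans (toℕ-rot 1 x) (trans (cong (_% d) (trans (+-comm (toℕ x) 1) (cong suc e))) (n%n≡0 d)))))) refl
    ... | inj₁ p<h with m≤n⇒∃[o]m+o≡n (<⇒≤ p<h)
    ... | r , refl = trans (cong₂ _+_ e (cong₂ _+_ (trans (toℕ-zig x (even p) e) (m+n∸m≡n p r))
            (trans (toℕ-zig (rot 1 x) (odd p) (trans (toℕ-rot-suc x (subst (λ z → suc z < d) (sym e) (s≤s (+-mono-< p<h p<h)))) (cong suc e)))
                   (trans (cong (_∸ p) (+-assoc p r (p + r))) (trans (m+n∸m≡n p (r + (p + r))) (+-comm r (p + r))))))) (even-sum p r)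
    lem (odd p) e lt with m≤n⇒∃[o]m+o≡n (half-< {p} lt)
    ... | r , refl = trans (cong₂ _+_ e (cong₂ _+_
            (trans (toℕ-zig x (odd p) e) (trans (cong (_∸ p) (shuffle p r)) (m+n∸m≡n p (suc p + r + suc r))))
            (trans (toℕ-zig (rot 1 x) (even (suc p)) (trans (toℕ-rot-suc x (subst (λ z → suc z < d) (sym e) (s≤s (s≤s lt')))) (trans (cong suc e) (cong suc (sym (+-suc p p))))))
                   (m+n∸m≡n (suc p) r)))) (odd-sum p r)
      where
      shuffle : ∀ p r → suc p + r + (suc p + r) ≡ p + (suc p + r + suc r)
      shuffle = solve-∀
      lt' : suc (p + p) ≤ p + r + (suc p + r)
      lt' = ≤-trans (≤-reflexive (sym (+-suc p p))) (+-mono-≤ (m≤m+n p r) (m≤m+n (suc p) r))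

-- The six units ±1, ±ω, ±ω² of ℤ[ω]; the sign + is true.
data Root : Set where
  1# ω# ω²# : Root

Unit : Set
Unit = Bool × Root

_·ʳ_ : Root → Root → Root
r   ·ʳ 1#  = r
1#  ·ʳ ω#  = ω#
ω#  ·ʳ ω#  = ω²#
ω²# ·ʳ ω#  = 1#
1#  ·ʳ ω²# = ω²#
ω#  ·ʳ ω²# = 1#
ω²# ·ʳ ω²# = ω#

_·_ : Unit → Unit → Unit
(s , r) · (true  , r') = s , r ·ʳ r'
(s , r) · (false , r') = not s , r ·ʳ r'

-- `∑-act` lets the right factor vary. In a column of a rectangle it is the left factor that varies.
·-comm : ∀ z w → z · w ≡ w · z
·-comm (s , r) (s' , r') = trans (split s s' r r') (trans (cong₂ _,_ (signs s s') (roots r r')) (sym (split s' s r' r)))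
  where
  sign : Bool → Bool → Bool
  sign s true  = s
  sign s false = not s
  split : ∀ s s' r r' → (s , r) · (s' , r') ≡ (sign s s' , r ·ʳ r')
  split s true  r r' = refl
  split s false r r' = refl
  signs : ∀ s s' → sign s s' ≡ sign s' s
  signs true  true  = refl
  signs true  false = refl
  signs false true  = refl
  signs false false = refl
  roots : ∀ r r' → r ·ʳ r' ≡ r' ·ʳ r
  roots 1#  1#  = refl
  roots 1#  ω#  = refl
  roots 1#  ω²# = refl
  roots ω#  1#  = refl
  roots ω#  ω#  = refl
  roots ω#  ω²# = refl
  roots ω²# 1#  = refl
  roots ω²# ω#  = refl
  roots ω²# ω²# = refl

width : ℕ → ℕ
width zero    = 3
width (suc b) = suc (suc (width b))

-- The sum of the units is 0 in ℤ[ω].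
units : ∀ b → Fin (width b) → Unit
units zero    Fin.zero                       = true , 1#
units zero    (Fin.suc Fin.zero)             = true , ω#
units zero    (Fin.suc (Fin.suc Fin.zero))   = true , ω²#
units (suc b) Fin.zero                       = true , 1#
units (suc b) (Fin.suc Fin.zero)             = false , 1#
units (suc b) (Fin.suc (Fin.suc i))          = units b i

module UnitAction (h : ℕ) where
  open Odd h

  actʳ : Root → Fin d → Fin d
  actʳ 1#  x = x
  actʳ ω#  x = zig x
  actʳ ω²# x = zig (rot 1 x)

  -- Reversal is -1, and the relation 1 + ω + ω² = 0 is zig-sum.
  act : Unit → Fin d → Fin d
  act (true  , r) x = actʳ r x
  act (false , r) x = opposite (actʳ r x)

  actʳ-injective : ∀ r {x y} → actʳ r x ≡ actʳ r y → x ≡ y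
  actʳ-injective 1#  e = e
  actʳ-injective ω#  e = zig-injective e
  actʳ-injective ω²# e = rot-injective 1 (zig-injective e)

  act-injective : ∀ z {x y} → act z x ≡ act z y → x ≡ y
  act-injective (true  , r) e = actʳ-injective r e
  act-injective (false , r) e = actʳ-injective r (opposite-injective e)

  act-pair : ∀ z x → toℕ (act (z · (true , 1#)) x) + toℕ (act (z · (false , 1#)) x) ≡ h + h
  act-pair (true  , r) x = +-opposite (actʳ r x)
  act-pair (false , r) x = trans (+-comm (toℕ (opposite (actʳ r x))) _) (+-opposite (actʳ r x))

  actʳ-triple : ∀ r x → toℕ (actʳ (r ·ʳ 1#) x) + (toℕ (actʳ (r ·ʳ ω#) x) + toℕ (actʳ (r ·ʳ ω²#) x)) ≡ h + h + h
  actʳ-triple 1#  x = zig-sum x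
  actʳ-triple ω#  x = trans (cycle (toℕ (zig x)) (toℕ (zig (rot 1 x))) (toℕ x)) (zig-sum x)
    where
    cycle : ∀ a b c → a + (b + c) ≡ c + (a + b)
    cycle = solve-∀
  actʳ-triple ω²# x = trans (cycle (toℕ (zig (rot 1 x))) (toℕ x) (toℕ (zig x))) (zig-sum x)
    where
    cycle : ∀ a b c → a + (b + c) ≡ b + (c + a)
    cycle = solve-∀

  act-triple : ∀ z x → toℕ (act (z · (true , 1#)) x) + (toℕ (act (z · (true , ω#)) x) + toℕ (act (z · (true , ω²#)) x)) ≡ h + h + h
  act-triple (true  , r) x = actʳ-triple r x
  -- The triple and its reversal consist of three complementary pairs, 6h altogether, of which the
  -- unreversed triple takes 3h.
  act-triple (false , r) x = +-cancelˡ-≡ (h + h + h) _ _ (trans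
    (cong (_+ (v' 1# + (v' ω# + v' ω²#))) (sym (actʳ-triple r x)))
    (trans (interchange (v 1#) (v ω#) (v ω²#) (v' 1#) (v' ω#) (v' ω²#))
           (trans (cong₂ _+_ (o 1#) (cong₂ _+_ (o ω#) (o ω²#))) (six h))))
    where
    v v' : Root → ℕ
    v r'  = toℕ (actʳ (r ·ʳ r') x)
    v' r' = toℕ (opposite (actʳ (r ·ʳ r') x))
    o : ∀ r' → toℕ (actʳ (r ·ʳ r') x) + toℕ (opposite (actʳ (r ·ʳ r') x)) ≡ h + h
    o r' = +-opposite (actʳ (r ·ʳ r') x)
    interchange : ∀ a b c a' b' c' → (a + (b + c)) + (a' + (b' + c')) ≡ (a + a') + ((b + b') + (c + c'))
    interchange = solve-∀
    six : ∀ h → (h + h) + ((h + h) + (h + h)) ≡ (h + h + h) + (h + h + h)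
    six = solve-∀

  -- `act` need not be a group action: products are formed only in the index. All that is used is
  -- that z - z and z + zω + zω² vanish for each unit z, and `units b` splits into b such pairs and
  -- one such triple.
  ∑-act : ∀ b z x → ∑ (width b) (λ i → toℕ (act (z · units b i) x)) ≡ width b * h
  ∑-act zero    z x = trans (cong (toℕ (act (z · (true , 1#)) x) +_)
    (cong (toℕ (act (z · (true , ω#)) x) +_) (+-identityʳ _))) (trans (act-triple z x) (three h))
    where
    three : ∀ h → h + h + h ≡ 3 * h
    three = solve-∀
  ∑-act (suc b) z x = trans (sym (+-assoc (toℕ (act (z · (true , 1#)) x)) _ _))
    (trans (cong₂ _+_ (act-pair z x) (∑-act b z x)) (+-assoc h h (width b * h)))

-- The even case

∑-cast : ∀ {m n} (e : m ≡ n) (f : Fin n → ℕ) → ∑ m (f ∘ cast e) ≡ ∑ n f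
∑-cast {m} refl f = ∑-cong m (λ i → cong f (toℕ-injective (toℕ-cast refl i)))

cast-injective : ∀ {m n} (e : m ≡ n) {i j : Fin m} → cast e i ≡ cast e j → i ≡ j
cast-injective e {i} {j} p = toℕ-injective (trans (sym (toℕ-cast e i)) (trans (cong toℕ p) (toℕ-cast e j)))

-- Measured from the centre (2M - 1)/2 of the 2M labels, the index i with its sign stands for ±(2i +
-- 1)/2, so opposite signs give complementary labels.
side : ∀ {M} → Bool → Fin M → Fin (M + M)
side {M} true  i = M ↑ʳ i
side {M} false i = opposite i ↑ˡ M

side-injective : ∀ {M} s s' {i j : Fin M} → side s i ≡ side s' j → s ≡ s' × i ≡ j
side-injective {M} true true e = refl , ↑ʳ-injective M _ _ e
side-injective {M} false false e = refl , opposite-injective (↑ˡ-injective M _ _ e)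
side-injective {M} true false {i} {j} e = ⊥-elim (<⇒≢ (<-≤-trans (toℕ<n (opposite j)) (m≤m+n M (toℕ i)))
  (trans (sym (toℕ-↑ˡ (opposite j) M)) (trans (cong toℕ (sym e)) (toℕ-↑ʳ M i))))
side-injective {M} false true {i} {j} e with side-injective true false (sym e)
... | () , _

side-sum : ∀ {M} s (i : Fin M) → toℕ (side s i) + toℕ (side (not s) i) ≡ pred (M + M)
side-sum {suc M} true  i = trans (cong₂ _+_ (toℕ-↑ʳ (suc M) i) (toℕ-↑ˡ (opposite i) (suc M)))
  (trans (cong suc (trans (+-assoc M _ _) (cong (M +_) (+-opposite i)))) (sym (+-suc M M)))
side-sum {suc M} false i = trans (+-comm (toℕ (side false i)) _) (side-sum true i)

signed : Bool → Fin 2 → Bool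
signed s Fin.zero    = s
signed s (Fin.suc _) = not s

signed-injective : ∀ s {b b'} → signed s b ≡ signed s b' → b ≡ b'
signed-injective s {Fin.zero} {Fin.zero} e = refl
signed-injective s {Fin.suc Fin.zero} {Fin.suc Fin.zero} e = refl
signed-injective true  {Fin.zero} {Fin.suc Fin.zero} ()
signed-injective false {Fin.zero} {Fin.suc Fin.zero} ()
signed-injective true  {Fin.suc Fin.zero} {Fin.zero} ()
signed-injective false {Fin.suc Fin.zero} {Fin.zero} ()

-- Cell number P is in row P mod m and column P div 2b; cells 2l and 2l + 1 carry complementary
-- labels, where l = E u + e.
module Domino (m' n b U E c : ℕ) (UE≡nb : U * E ≡ n * b) (w : ℕ) (E2≡wm : E * 2 ≡ w * suc m') (b2≤m : b * 2 ≤ suc m')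
  (idx : Fin c → Fin U → Fin E → Fin (c * (U * E)))
  (idx-inj : ∀ {t t' u u' e e'} → idx t u e ≡ idx t' u' e' → t ≡ t' × u ≡ u' × e ≡ e')
  (σ : Fin U → Bool) where

  private
    m = suc m'
    T = U * E
    M = c * T
    L = T * 2

  V : Fin c → Fin U → Fin E → Fin 2 → Fin (M + M)
  V t u e β = side (signed (σ u) β) (idx t u e)

  V-sum : ∀ t u e → toℕ (V t u e Fin.zero) + toℕ (V t u e (Fin.suc Fin.zero)) ≡ pred (M + M)
  V-sum t u e = side-sum (σ u) (idx t u e)

  rowE : Fin E → Fin 2 → Fin m
  rowE e β = fromℕ< (m%n<n (2 * toℕ e + toℕ β) m)

  multiplicity : Fin m → Fin 2 → ℕ
  multiplicity i β = ∑ E (λ e → δ (rowE e β) i)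

  -- The U cells with given e and β form a bundle, which lies in a single row. Rows are unions of
  -- bundles, so it is enough that the sum of a bundle does not depend on e.
  module _ (S : Fin c → Fin 2 → ℕ) (S-sum : ∀ t e β → ∑ U (λ u → toℕ (V t u e β)) ≡ S t β)
           {s x : ℕ} (count : ∀ i → U * (multiplicity i Fin.zero + multiplicity i (Fin.suc Fin.zero)) ≡ s)
           (total : ∀ t i → multiplicity i Fin.zero * S t Fin.zero + multiplicity i (Fin.suc Fin.zero) * S t (Fin.suc Fin.zero) ≡ x) where

    private
      l-of : Fin L → Fin T
      l-of P = proj₁ (remQuot {T} 2 P)
      β-of : Fin L → Fin 2
      β-of P = proj₂ (remQuot {T} 2 P)
      u-of : Fin T → Fin U
      u-of l = proj₁ (remQuot {U} E l)
      e-of : Fin T → Fin E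
      e-of l = proj₂ (remQuot {U} E l)
      col-of : Fin T → Fin n
      col-of l = proj₁ (remQuot {n} b (cast UE≡nb l))
      r-of : Fin T → Fin b
      r-of l = proj₂ (remQuot {n} b (cast UE≡nb l))

      ρ : Fin L → Fin m
      ρ P = fromℕ< (m%n<n (toℕ P) m)

      toℕ-ρ : ∀ P → toℕ (ρ P) ≡ toℕ P % m
      toℕ-ρ P = toℕ-fromℕ< (m%n<n (toℕ P) m)

      cell : Fin U → Fin E → Fin 2 → Fin L
      cell u e β = combine {T} (combine {U} u e) β

      κ : Fin L → Fin n
      κ P = col-of (l-of P)

      toℕ-P : ∀ P → toℕ P ≡ (2 * toℕ (r-of (l-of P)) + toℕ (β-of P)) + 2 * (b * toℕ (κ P))
      toℕ-P P = trans (cong toℕ (sym (combine-remQuot {T} 2 P))) (trans (toℕ-combine (l-of P) (β-of P))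
        (trans (cong (λ z → 2 * z + toℕ (β-of P)) (trans (sym (toℕ-cast UE≡nb (l-of P)))
          (trans (cong toℕ (sym (combine-remQuot {n} b (cast UE≡nb (l-of P))))) (toℕ-combine (κ P) (r-of (l-of P))))))
          (rearrange (b * toℕ (κ P)) (toℕ (r-of (l-of P))) (toℕ (β-of P)))))
        where
        rearrange : ∀ q r β → 2 * (q + r) + β ≡ (2 * r + β) + 2 * q
        rearrange = solve-∀

      offset<m : ∀ P → 2 * toℕ (r-of (l-of P)) + toℕ (β-of P) < m
      offset<m P = <-≤-trans (bound (toℕ<n (r-of (l-of P))) (toℕ<n (β-of P))) b2≤m
        where
        bound : ∀ {r β} → r < b → β < 2 → 2 * r + β < b * 2
        bound {r} {β} r<b β<2 = ≤-trans (≤-reflexive (sym (+-suc (2 * r) β))) (≤-trans (+-monoʳ-≤ (2 * r) β<2)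
          (≤-trans (≤-reflexive (e₁ r)) (*-monoˡ-≤ 2 r<b)))
          where
          e₁ : ∀ r → 2 * r + 2 ≡ suc r * 2
          e₁ = solve-∀

      -- A column consists of 2b consecutive cells, and 2b ≤ m, so their residues modulo m are
      -- distinct.
      cell-inj : ∀ {P Q} → ρ P ≡ ρ Q → κ P ≡ κ Q → P ≡ Q
      cell-inj {P} {Q} e e' = toℕ-injective (trans (toℕ-P P) (trans (cong₂ (λ z z' → z + 2 * (b * toℕ z')) same e') (sym (toℕ-P Q))))
        where
        o = λ P → 2 * toℕ (r-of (l-of P)) + toℕ (β-of P)
        same : o P ≡ o Q
        same = trans (sym (m<n⇒m%n≡m (offset<m P))) (trans (mod-cancel m' (2 * (b * toℕ (κ P))) {o P} {o Q}
          (trans (cong (_% m) (sym (toℕ-P P))) (trans (trans (sym (toℕ-ρ P)) (trans (cong toℕ e) (toℕ-ρ Q)))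
            (trans (cong (_% m) (toℕ-P Q)) (cong (λ z → (o Q + 2 * (b * toℕ z)) % m) (sym e'))))))
          (m<n⇒m%n≡m (offset<m Q)))

      N≡ : M + M ≡ c * L
      N≡ = e c T
        where
        e : ∀ c T → c * T + c * T ≡ c * (T * 2)
        e = solve-∀

      label : Fin c → Fin L → Fin (c * L)
      label t P = cast N≡ (V t (u-of (l-of P)) (e-of (l-of P)) (β-of P))

      label-inj : ∀ {t t' P Q} → label t P ≡ label t' Q → t ≡ t' × P ≡ Q
      label-inj {t} {t'} {P} {Q} e with side-injective (signed (σ (u-of (l-of P))) (β-of P)) (signed (σ (u-of (l-of Q))) (β-of Q)) (cast-injective N≡ e)
      ... | e₁ , e₂ with idx-inj e₂
      ... | t≡ , u≡ , e≡ = t≡ , remQuot-injective T 2 (remQuot-injective U E u≡ e≡)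
            (signed-injective (σ (u-of (l-of P))) (trans e₁ (cong (λ z → signed (σ z) (β-of Q)) (sym u≡))))

      -- E dominoes make exactly w turns through the m rows, so the block number u has no influence
      -- on the row.
      ρ-combine : ∀ u e β → ρ (cell u e β) ≡ rowE e β
      ρ-combine u e β = toℕ-injective (trans (toℕ-fromℕ< _) (trans (cong (_% m) (trans (toℕ-combine {T} (combine {U} u e) β)
        (trans (cong (λ z → 2 * z + toℕ β) (toℕ-combine {U} u e)) (trans (rearrange E (toℕ u) (toℕ e) (toℕ β))
          (cong (2 * toℕ e + toℕ β +_) (trans (cong (toℕ u *_) E2≡wm) (sym (*-assoc (toℕ u) w m))))))))
        (trans ([m+kn]%n≡m%n (2 * toℕ e + toℕ β) (toℕ u * w) m) (sym (toℕ-fromℕ< (m%n<n (2 * toℕ e + toℕ β) m))))))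
        where
        rearrange : ∀ E u e β → 2 * (E * u + e) + β ≡ (2 * e + β) + u * (E * 2)
        rearrange = solve-∀

      ∑-cells : ∀ (f : Fin L → ℕ) → ∑ L f ≡ ∑ E (λ e → ∑ 2 (λ β → ∑ U (λ u → f (cell u e β))))
      ∑-cells f = trans (∑-combine T 2 f) (trans (∑-combine U E _) (trans (∑-swap U E _)
        (∑-cong E λ e → ∑-swap U 2 (λ u β → f (cell u e β)))))

      toℕ-label : ∀ t u e β → toℕ (label t (cell u e β)) ≡ toℕ (V t u e β)
      toℕ-label t u e β = trans (toℕ-cast N≡ _) (trans
        (cong (λ z → toℕ (V t (u-of (proj₁ z)) (e-of (proj₁ z)) (proj₂ z))) (remQuot-combine {T} (combine {U} u e) β))
        (cong (λ z → toℕ (V t (proj₁ z) (proj₂ z) β)) (remQuot-combine u e)))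

      over-bits : ∀ i (g : Fin 2 → ℕ) → ∑ E (λ e → ∑ 2 (λ β → δ (rowE e β) i * g β)) ≡
                  multiplicity i Fin.zero * g Fin.zero + multiplicity i (Fin.suc Fin.zero) * g (Fin.suc Fin.zero)
      over-bits i g = trans (∑-swap E 2 (λ e β → δ (rowE e β) i * g β)) (trans (cong₂ (λ a b → a + (b + 0)) (∑-*ʳ E (g Fin.zero) _) (∑-*ʳ E (g (Fin.suc Fin.zero)) _))
        (cong (multiplicity i Fin.zero * g Fin.zero +_) (+-identityʳ _)))

      ρ-count : ∀ i → ∑ L (λ P → δ (ρ P) i) ≡ s
      ρ-count i = trans (∑-cells _) (trans (∑-cong E λ e → ∑-cong 2 {λ β → ∑ U (λ u → δ (ρ (cell u e β)) i)} {λ β → δ (rowE e β) i * U} λ β →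
        trans (∑-cong U λ u → cong (λ z → δ z i) (ρ-combine u e β)) (trans (∑-const U _) (*-comm U _)))
        (trans (over-bits i (λ _ → U)) (trans (sym (*-distribʳ-+ U (multiplicity i Fin.zero) _)) (trans (*-comm _ U) (count i)))))

      ρ-sum : ∀ t i → ∑ L (λ P → δ (ρ P) i * toℕ (label t P)) ≡ x
      ρ-sum t i = trans (∑-cells _) (trans (∑-cong E λ e → ∑-cong 2 {λ β → ∑ U (λ u → δ (ρ (cell u e β)) i * toℕ (label t (cell u e β)))} {λ β → δ (rowE e β) i * S t β} λ β →
        trans (∑-cong U λ u → cong₂ (λ z z' → δ z i * z') (ρ-combine u e β) (toℕ-label t u e β))
              (trans (∑-*ˡ U (δ (rowE e β) i) _) (cong (δ (rowE e β) i *_) (S-sum t e β))))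
        (trans (over-bits i (S t)) (total t i)))

      col-count : ∀ j → ∑ T (λ l → δ (col-of l) j) ≡ b
      col-count j = trans (∑-cast UE≡nb (λ l → δ (proj₁ (remQuot {n} b l)) j)) (trans (∑-remQuot n b (λ j' r → δ j' j))
        (trans (∑-cong n λ j' → trans (∑-const b (δ j' j)) (trans (*-comm b _) (cong (_* b) (δ-cong sym sym))))
               (∑-δ n j (λ _ → b))))

      κ-count : ∀ j → ∑ L (λ P → δ (κ P) j) ≡ b * 2
      κ-count j = trans (∑-remQuot T 2 (λ l β → δ (col-of l) j)) (trans (∑-cong T λ l → trans (∑-const 2 (δ (col-of l) j)) (*-comm 2 (δ (col-of l) j)))
        (trans (∑-*ʳ T 2 _) (cong (_* 2) (col-count j))))

      κ-sum : ∀ t j → ∑ L (λ P → δ (κ P) j * toℕ (label t P)) ≡ b * pred (M + M)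
      κ-sum t j = trans (∑-cong L λ P → cong (δ (κ P) j *_) (toℕ-cast N≡ _))
        (trans (∑-remQuot T 2 (λ l β → δ (col-of l) j * toℕ (V t (u-of l) (e-of l) β)))
        (trans (∑-cong T λ l → trans (∑-*ˡ 2 (δ (col-of l) j) (λ β → toℕ (V t (u-of l) (e-of l) β))) (cong (δ (col-of l) j *_)
          (trans (cong (toℕ (V t (u-of l) (e-of l) Fin.zero) +_) (+-identityʳ _)) (V-sum t (u-of l) (e-of l)))))
        (trans (∑-*ʳ T (pred (M + M)) _) (cong (_* pred (M + M)) (col-count j)))))

    MRS-domino : MRSExists m n s (b * 2) c
    MRS-domino = MRS-fromCells (trans (cong (_* 2) UE≡nb) (*-assoc n b 2)) record
      { ρ = ρ ; κ = κ ; cell-inj = λ {P} {Q} → cell-inj {P} {Q} ; label = label ; label-inj = λ {t} {u} {P} {Q} → label-inj {t} {u} {P} {Q}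
      ; ρ-count = ρ-count ; κ-count = κ-count ; x = x ; y = b * pred (M + M) ; ρ-sum = ρ-sum ; κ-sum = κ-sum }

-- An even number of rows: bundles balanced by signs

positive negative : Bool → ℕ
positive true  = 1
positive false = 0
negative s = positive (not s)

flipIf : ∀ {n} → Bool → Fin n → Fin n
flipIf true  i = opposite i
flipIf false i = i

flipIf-injective : ∀ {n} r {i j : Fin n} → flipIf r i ≡ flipIf r j → i ≡ j
flipIf-injective true  e = opposite-injective e
flipIf-injective false e = e

pick : Bool → ℕ → ℕ → ℕ
pick false x y = x
pick true  x y = y

-- Signs for U rows of G labels such that, reading label l as ±(2l + 1), all columns have sum 0;
-- row u is read backwards when rev u holds.
record Pattern (U : ℕ) : Set where
  field
    σ   : Fin U → Bool
    rev : Fin U → Bool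
  weight : ℕ → ℕ → Fin U → ℕ
  weight γ γ' u = suc (2 * (suc (γ + γ') * toℕ u + pick (rev u) γ γ'))
  field
    balanced : ∀ γ γ' → ∑ U (λ u → negative (σ u) * weight γ γ' u) ≡ ∑ U (λ u → positive (σ u) * weight γ γ' u)

-- The signs + - - + annihilate every arithmetic progression of four terms.
quad : ∀ q → Fin (q * 4) → Bool
quad (suc q) Fin.zero                                     = true
quad (suc q) (Fin.suc Fin.zero)                           = false
quad (suc q) (Fin.suc (Fin.suc Fin.zero))                 = false
quad (suc q) (Fin.suc (Fin.suc (Fin.suc Fin.zero)))       = true
quad (suc q) (Fin.suc (Fin.suc (Fin.suc (Fin.suc u))))    = quad q u

quad-balanced : ∀ q (f : ℕ → ℕ) g → (∀ x → f (suc x) ≡ f x + g) →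
  ∑ (q * 4) (λ u → negative (quad q u) * f (toℕ u)) ≡ ∑ (q * 4) (λ u → positive (quad q u) * f (toℕ u))
quad-balanced zero    f g step = refl
quad-balanced (suc q) f g step = trans
  (cong (λ r → 1 * f 1 + (1 * f 2 + r)) (quad-balanced q (λ x → f (4 + x)) g (λ x → step (4 + x))))
  (lem (f 0) (f 1) (f 2) (f 3) _ g (step 0) (step 1) (step 2))
  where
  lem : ∀ a b c d r g → b ≡ a + g → c ≡ b + g → d ≡ c + g → 1 * b + (1 * c + r) ≡ 1 * a + (1 * d + r)
  lem a _ _ _ r g refl refl refl = ring a r g
    where
    ring : ∀ a r g → 1 * (a + g) + (1 * (a + g + g) + r) ≡ 1 * a + (1 * (a + g + g + g) + r)
    ring = solve-∀

quadPattern : ∀ q → Pattern (q * 4)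
quadPattern q = record
  { σ = quad q ; rev = λ _ → false
  ; balanced = λ γ γ' → quad-balanced q (λ x → suc (2 * (suc (γ + γ') * x + γ))) (2 * suc (γ + γ')) (step γ (γ + γ')) }
  where
  step : ∀ γ G x → suc (2 * (suc G * suc x + γ)) ≡ suc (2 * (suc G * x + γ)) + 2 * suc G
  step = solve-∀

-- The signs come from 7 + 11 = 1 + 3 + 5 + 9, the case G = 1; three signs of each kind are
-- impossible there, half of 1 + 3 + … + 11 being even.
hexPattern : ∀ q → Pattern (6 + q * 4)
hexPattern q = record { σ = sgn ; rev = back ; balanced = λ γ γ' → trans
    (cong (λ r → 1 * w γ γ' 0 γ + (1 * w γ γ' 1 γ + (1 * w γ γ' 2 γ + (0 + (1 * w γ γ' 4 γ' + (0 + r))))))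
          (quad-balanced q (λ x → w γ γ' (6 + x) γ) (2 * suc (γ + γ')) (step γ (γ + γ'))))
    (ring γ γ' _) }
  where
  sgn : Fin (6 + q * 4) → Bool
  sgn Fin.zero = false
  sgn (Fin.suc Fin.zero) = false
  sgn (Fin.suc (Fin.suc Fin.zero)) = false
  sgn (Fin.suc (Fin.suc (Fin.suc Fin.zero))) = true
  sgn (Fin.suc (Fin.suc (Fin.suc (Fin.suc Fin.zero)))) = false
  sgn (Fin.suc (Fin.suc (Fin.suc (Fin.suc (Fin.suc Fin.zero))))) = true
  sgn (Fin.suc (Fin.suc (Fin.suc (Fin.suc (Fin.suc (Fin.suc u)))))) = quad q u
  back : Fin (6 + q * 4) → Bool
  back Fin.zero = false
  back (Fin.suc Fin.zero) = false
  back (Fin.suc (Fin.suc Fin.zero)) = false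
  back (Fin.suc (Fin.suc (Fin.suc Fin.zero))) = false
  -- Four minus signs against two plus signs leave an excess 2γ; reversing one of the minus rows
  -- turns it into γ + γ', which is the same for all labels.
  back (Fin.suc (Fin.suc (Fin.suc (Fin.suc Fin.zero)))) = true
  back (Fin.suc (Fin.suc (Fin.suc (Fin.suc (Fin.suc u))))) = false
  w : ℕ → ℕ → ℕ → ℕ → ℕ
  w γ γ' x y = suc (2 * (suc (γ + γ') * x + y))
  step : ∀ γ G x → suc (2 * (suc G * (6 + suc x) + γ)) ≡ suc (2 * (suc G * (6 + x) + γ)) + 2 * suc G
  step = solve-∀
  ring : ∀ γ γ' r → 1 * w γ γ' 0 γ + (1 * w γ γ' 1 γ + (1 * w γ γ' 2 γ + (0 + (1 * w γ γ' 4 γ' + (0 + r))))) ≡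
                    0 + (0 + (0 + (1 * w γ γ' 3 γ + (0 + (1 * w γ γ' 5 γ + r)))))
  ring γ γ' r = ring' γ γ' r
    where
    ring' : ∀ γ γ' r → 1 * suc (2 * (suc (γ + γ') * 0 + γ)) + (1 * suc (2 * (suc (γ + γ') * 1 + γ)) + (1 * suc (2 * (suc (γ + γ') * 2 + γ)) + (0 + (1 * suc (2 * (suc (γ + γ') * 4 + γ')) + (0 + r))))) ≡
                    0 + (0 + (0 + (1 * suc (2 * (suc (γ + γ') * 3 + γ)) + (0 + (1 * suc (2 * (suc (γ + γ') * 5 + γ)) + r)))))
    ring' = solve-∀

-- For each label v with index i, 2v + 1 is 2M + (2i + 1) or 2M - (2i + 1) according to the sign;
-- balanced signs therefore leave only the 2M. Negative weights are moved to the other side to stay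
-- in ℕ, and β = 1 reverses all signs, which keeps the balance.
∑-side : ∀ {M} U (σ : Fin U → Bool) (idx : Fin U → Fin M) β →
  ∑ U (λ u → negative (σ u) * suc (2 * toℕ (idx u))) ≡ ∑ U (λ u → positive (σ u) * suc (2 * toℕ (idx u))) →
  2 * ∑ U (λ u → toℕ (side (signed (σ u) β) (idx u))) + U ≡ U * (M + M)
∑-side {M} U σ idx β bal = +-cancelʳ-≡ (∑ U (λ u → negative (signed (σ u) β) * w u)) _ _ (trans summed
    (cong (U * (M + M) +_) (sym (bal' β))))
  where
  w : Fin U → ℕ
  w u = suc (2 * toℕ (idx u))
  bal' : ∀ β → ∑ U (λ u → negative (signed (σ u) β) * w u) ≡ ∑ U (λ u → positive (signed (σ u) β) * w u)
  bal' Fin.zero    = bal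
  bal' (Fin.suc _) = trans (∑-cong U λ u → cong (_* w u) (double (σ u))) (sym bal)
    where
    double : ∀ s → negative (not s) ≡ positive s
    double true = refl
    double false = refl
  pointwise : ∀ s (i : Fin M) → 2 * toℕ (side s i) + 1 + negative s * suc (2 * toℕ i) ≡ (M + M) + positive s * suc (2 * toℕ i)
  pointwise true i = trans (cong (λ z → 2 * z + 1 + 0) (toℕ-↑ʳ M i)) (ring M (toℕ i))
    where
    ring : ∀ M i → 2 * (M + i) + 1 + 0 ≡ (M + M) + 1 * suc (2 * i)
    ring = solve-∀
  pointwise false i = trans (cong (λ z → 2 * z + 1 + 1 * suc (2 * toℕ i)) (toℕ-↑ˡ (opposite i) M)) (lem i)
    where
    lem : ∀ {M} (i : Fin M) → 2 * toℕ (opposite i) + 1 + 1 * suc (2 * toℕ i) ≡ (M + M) + 0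
    lem {suc M} i = trans (ring (toℕ (opposite i)) (toℕ i)) (cong (λ z → suc z + suc z + 0) (+-opposite i))
      where
      ring : ∀ o i → 2 * o + 1 + 1 * suc (2 * i) ≡ suc (i + o) + suc (i + o) + 0
      ring = solve-∀
  summed : (2 * ∑ U (λ u → toℕ (side (signed (σ u) β) (idx u))) + U) + ∑ U (λ u → negative (signed (σ u) β) * w u) ≡
           U * (M + M) + ∑ U (λ u → positive (signed (σ u) β) * w u)
  summed = trans (cong (_+ ∑ U (λ u → negative (signed (σ u) β) * w u)) (cong₂ _+_ (sym (∑-*ˡ U 2 _)) (sym (trans (∑-const U 1) (*-identityʳ U)))))
    (trans (cong (_+ ∑ U (λ u → negative (signed (σ u) β) * w u)) (sym (∑-distrib-+ U _ _)))
    (trans (sym (∑-distrib-+ U _ _)) (trans (∑-cong U λ u → pointwise (signed (σ u) β) (idx u))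
    (trans (∑-distrib-+ U _ _) (cong (_+ ∑ U (λ u → positive (signed (σ u) β) * w u)) (∑-const U (M + M)))))))

suc-pred-double : ∀ {M} → Fin M → suc (pred (M + M)) ≡ M + M
suc-pred-double {suc M} _ = refl

∑-δ-injective : ∀ {n} (f : Fin n → Fin n) → (∀ {x y} → f x ≡ f y → x ≡ y) → ∀ i → ∑ n (λ x → δ (f x) i) ≡ 1
∑-δ-injective {n} f inj i with inj⇒surj f inj i
... | x , refl = trans (∑-cong n (λ y → sym (*-identityʳ _))) (∑-fibre f inj (λ _ → 1) x)

even-rows : ∀ {m' n a' b c} μ → suc m' ≡ μ * 2 → Pattern (suc a' * 2) → b * 2 ≤ suc m' → suc m' * suc a' ≡ n * b →
            MRSExists (suc m') n (suc a' * 2) (b * 2) c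
even-rows {m'} {n} {a'} {b} {c} μ m≡μ2 pat b2≤m ma≡nb =
  MRS-domino (λ _ _ → a * pred (M + M)) S-sum count total
  where
  open Pattern pat
  a = suc a'
  m = suc m'
  U = a * 2
  G = c * μ
  M = c * (U * μ)

  UE≡nb : U * μ ≡ n * b
  UE≡nb = trans (ring a μ) (trans (cong (_* a) (sym m≡μ2)) ma≡nb)
    where
    ring : ∀ a μ → a * 2 * μ ≡ μ * 2 * a
    ring = solve-∀

  M≡ : U * G ≡ M
  M≡ = ring U c μ
    where
    ring : ∀ U c μ → U * (c * μ) ≡ c * (U * μ)
    ring = solve-∀

  -- Row u of the pattern holds G labels, one for every copy t and every row pair e; the pair (t, e)
  -- is the column γ of the pattern.
  idx : Fin c → Fin U → Fin μ → Fin M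
  idx t u e = cast M≡ (combine u (flipIf (rev u) (combine t e)))

  idx-inj : ∀ {t t' u u' e e'} → idx t u e ≡ idx t' u' e' → t ≡ t' × u ≡ u' × e ≡ e'
  idx-inj {t} {t'} {u} {u'} {e} {e'} p with combine-injective u _ u' _ (cast-injective M≡ p)
  ... | refl , q with combine-injective t e t' e' (flipIf-injective (rev u) q)
  ... | r , r' = r , refl , r'

  open Domino m' n b U μ c UE≡nb 1 (trans (sym m≡μ2) (sym (+-identityʳ m))) b2≤m idx idx-inj σ

  toℕ-idx : ∀ {G'} (γ : Fin G') (e : G' ≡ G) u → toℕ (combine u (flipIf (rev u) γ)) ≡
            suc (toℕ γ + toℕ (opposite γ)) * toℕ u + pick (rev u) (toℕ γ) (toℕ (opposite γ))
  toℕ-idx {suc G'} γ e u = trans (toℕ-combine u (flipIf (rev u) γ))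
    (cong₂ (λ g z → suc g * toℕ u + z) (sym (+-opposite γ)) (flip (rev u)))
    where
    flip : ∀ r → toℕ (flipIf r γ) ≡ pick r (toℕ γ) (toℕ (opposite γ))
    flip true = refl
    flip false = refl

  S-sum : ∀ t e β → ∑ U (λ u → toℕ (V t u e β)) ≡ a * pred (M + M)
  S-sum t e β = *-cancelˡ-≡ _ _ 2 (+-cancelʳ-≡ U _ _ (trans
      (∑-side U σ (λ u → idx t u e) β (trans (∑-cong U λ u → cong (negative (σ u) *_) (w≡ u))
        (trans (balanced (toℕ γ) (toℕ (opposite γ))) (∑-cong U λ u → cong (positive (σ u) *_) (sym (w≡ u))))))
      (trans (cong (U *_) (sym (suc-pred-double (idx t Fin.zero e)))) (ring a (pred (M + M))))))
    where
    γ : Fin G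
    γ = combine t e
    w≡ : ∀ u → suc (2 * toℕ (idx t u e)) ≡ weight (toℕ γ) (toℕ (opposite γ)) u
    w≡ u = cong (λ z → suc (2 * z)) (trans (toℕ-cast M≡ _) (toℕ-idx γ refl u))
    ring : ∀ a p → a * 2 * suc p ≡ 2 * (a * p) + a * 2
    ring = solve-∀

  rowE-cast : ∀ e β → rowE e β ≡ cast (sym m≡μ2) (combine e β)
  rowE-cast e β = toℕ-injective (trans (toℕ-fromℕ< (m%n<n (2 * toℕ e + toℕ β) m))
    (trans (cong (_% m) eq) (m<n⇒m%n≡m (toℕ<n _))))
    where
    eq : 2 * toℕ e + toℕ β ≡ toℕ (cast (sym m≡μ2) (combine e β))
    eq = sym (trans (toℕ-cast (sym m≡μ2) (combine e β)) (toℕ-combine e β))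
  once : ∀ i → multiplicity i Fin.zero + multiplicity i (Fin.suc Fin.zero) ≡ 1
  once i = trans (sym (∑-distrib-+ μ _ _)) (trans (∑-cong μ λ e → cong₂ _+_ (cong (λ z → δ z i) (rowE-cast e Fin.zero))
      (trans (cong (λ z → δ z i) (rowE-cast e (Fin.suc Fin.zero))) (sym (+-identityʳ _))))
    (trans (sym (∑-combine μ 2 (λ P → δ (cast (sym m≡μ2) P) i))) (trans (∑-cast (sym m≡μ2) (λ P → δ P i))
      (∑-δ-injective (λ P → P) (λ e → e) i))))

  count : ∀ i → U * (multiplicity i Fin.zero + multiplicity i (Fin.suc Fin.zero)) ≡ U
  count i = trans (cong (U *_) (once i)) (*-identityʳ U)

  total : ∀ t i → multiplicity i Fin.zero * (a * pred (M + M)) + multiplicity i (Fin.suc Fin.zero) * (a * pred (M + M)) ≡ a * pred (M + M)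
  total t i = trans (sym (*-distribʳ-+ (a * pred (M + M)) (multiplicity i Fin.zero) (multiplicity i (Fin.suc Fin.zero))))
    (trans (cong (_* (a * pred (M + M))) (once i)) (+-identityʳ _))

-- An odd number of rows: Kotzig arrays

record Kotzig (a m : ℕ) : Set where
  field
    κ     : Fin a → Fin m → Fin m
    κ-inj : ∀ u {x y} → κ u x ≡ κ u y → x ≡ y
    K     : ℕ
    κ-sum : ∀ x → ∑ a (λ u → toℕ (κ u x)) ≡ K

kotzig-even : ∀ q m' → Kotzig (q * 2) (suc m')
kotzig-even q m' = record { κ = flips q ; κ-inj = inj q ; K = q * m' ; κ-sum = sums q }
  where
  flips : ∀ q → Fin (q * 2) → Fin (suc m') → Fin (suc m')
  flips (suc q) Fin.zero              = λ x → x
  flips (suc q) (Fin.suc Fin.zero)    = opposite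
  flips (suc q) (Fin.suc (Fin.suc u)) = flips q u
  inj : ∀ q u {x y} → flips q u x ≡ flips q u y → x ≡ y
  inj (suc q) Fin.zero              e = e
  inj (suc q) (Fin.suc Fin.zero)    e = opposite-injective e
  inj (suc q) (Fin.suc (Fin.suc u)) e = inj q u e
  sums : ∀ q x → ∑ (q * 2) (λ u → toℕ (flips q u x)) ≡ q * m'
  sums zero    x = refl
  sums (suc q) x = trans (sym (+-assoc (toℕ x) _ _)) (cong₂ _+_ (+-opposite x) (sums q x))

kotzig-odd : ∀ b h → Kotzig (width b) (suc (h + h))
kotzig-odd b h = record { κ = λ u → act ((true , 1#) · units b u) ; κ-inj = λ u → act-injective ((true , 1#) · units b u)
                        ; K = width b * h ; κ-sum = ∑-act b (true , 1#) }
  where open UnitAction h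

odd-rows : ∀ {n a b c} h → Kotzig a (suc (h + h)) → b * 2 ≤ suc (h + h) → suc (h + h) * a ≡ n * b →
           MRSExists (suc (h + h)) n (a * 2) (b * 2) c
odd-rows {n} {a} {b} {c} h kotzig b2≤m ma≡nb = MRS-domino S S-sum count total
  where
  open Kotzig kotzig
  m = suc (h + h)
  M = c * (a * m)

  M≡ : (c * a) * m ≡ M
  M≡ = *-assoc c a m

  idx : Fin c → Fin a → Fin m → Fin M
  idx t u e = cast M≡ (combine (combine t u) (κ u e))

  idx-inj : ∀ {t t' u u' e e'} → idx t u e ≡ idx t' u' e' → t ≡ t' × u ≡ u' × e ≡ e'
  idx-inj {t} {t'} {u} {u'} {e} {e'} p with combine-injective (combine t u) _ (combine t' u') _ (cast-injective M≡ p)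
  ... | q , r with combine-injective t u t' u' q
  ... | q' , refl = q' , refl , κ-inj u r

  open Domino (h + h) n b a m c (trans (*-comm a m) ma≡nb) 2 (*-comm m 2) b2≤m idx idx-inj (λ _ → true)

  -- Bundle sums of one side do not depend on e, because the permutations `κ u` have constant sum.
  -- They may depend on the copy t, but the two sides together do not, and each row has one bundle
  -- of each side.
  S : Fin c → Fin 2 → ℕ
  S t β = ∑ a (λ u → toℕ (V t u Fin.zero β))

  S-pair : ∀ t e → ∑ a (λ u → toℕ (V t u e Fin.zero)) + ∑ a (λ u → toℕ (V t u e (Fin.suc Fin.zero))) ≡ a * pred (M + M)
  S-pair t e = trans (sym (∑-distrib-+ a _ _)) (trans (∑-cong a (λ u → V-sum t u e)) (∑-const a _))

  S-zero : ∀ t e → ∑ a (λ u → toℕ (V t u e Fin.zero)) ≡ ∑ a (λ u → M + m * toℕ (combine t u)) + K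
  S-zero t e = trans (∑-cong a λ u → trans (toℕ-↑ʳ M (idx t u e)) (trans
      (cong (M +_) (trans (toℕ-cast M≡ _) (toℕ-combine (combine t u) (κ u e)))) (sym (+-assoc M _ _))))
    (trans (∑-distrib-+ a _ _) (cong (∑ a (λ u → M + m * toℕ (combine t u)) +_) (κ-sum e)))

  S-sum : ∀ t e β → ∑ a (λ u → toℕ (V t u e β)) ≡ S t β
  S-sum t e Fin.zero           = trans (S-zero t e) (sym (S-zero t Fin.zero))
  S-sum t e (Fin.suc Fin.zero) = +-cancelˡ-≡ (S t Fin.zero) _ _ (trans
    (cong (_+ ∑ a (λ u → toℕ (V t u e (Fin.suc Fin.zero)))) (sym (S-sum t e Fin.zero))) (trans (S-pair t e) (sym (S-pair t Fin.zero))))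

  -- h + 1 is the inverse of 2 modulo the odd number m; so e ↦ 2e + β is a bijection of the rows.
  half : ∀ x → (2 * x * suc h) % m ≡ x % m
  half x = trans (cong (_% m) (ring x h)) ([m+kn]%n≡m%n x x m)
    where
    ring : ∀ x h → 2 * x * suc h ≡ x + x * suc (h + h)
    ring = solve-∀

  rowE-inj : ∀ β {e e'} → rowE e β ≡ rowE e' β → e ≡ e'
  rowE-inj β {e} {e'} p = toℕ-injective (trans (sym (m<n⇒m%n≡m (toℕ<n e))) (trans (trans (sym (half (toℕ e)))
      (trans (%-distribˡ-* (2 * toℕ e) (suc h) m) (trans (cong (λ z → (z * (suc h % m)) % m) twice)
      (trans (sym (%-distribˡ-* (2 * toℕ e') (suc h) m)) (half (toℕ e')))))) (m<n⇒m%n≡m (toℕ<n e'))))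
    where
    twice : (2 * toℕ e) % m ≡ (2 * toℕ e') % m
    twice = mod-cancel (h + h) (toℕ β) {2 * toℕ e} {2 * toℕ e'} (trans (sym (toℕ-fromℕ< (m%n<n (2 * toℕ e + toℕ β) m)))
      (trans (cong toℕ p) (toℕ-fromℕ< (m%n<n (2 * toℕ e' + toℕ β) m))))

  once : ∀ i β → multiplicity i β ≡ 1
  once i β = ∑-δ-injective (λ e → rowE e β) (rowE-inj β) i

  count : ∀ i → a * (multiplicity i Fin.zero + multiplicity i (Fin.suc Fin.zero)) ≡ a * 2
  count i = cong (a *_) (cong₂ _+_ (once i Fin.zero) (once i (Fin.suc Fin.zero)))

  total : ∀ t i → multiplicity i Fin.zero * S t Fin.zero + multiplicity i (Fin.suc Fin.zero) * S t (Fin.suc Fin.zero) ≡ a * pred (M + M)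
  total t i = trans (cong₂ _+_ (cong (_* S t Fin.zero) (once i Fin.zero)) (cong (_* S t (Fin.suc Fin.zero)) (once i (Fin.suc Fin.zero))))
    (trans (cong₂ _+_ (+-identityʳ (S t Fin.zero)) (+-identityʳ (S t (Fin.suc Fin.zero)))) (S-pair t Fin.zero))

width≡ : ∀ b → width b ≡ 3 + (b + b)
width≡ zero    = refl
width≡ (suc b) = trans (cong (suc ∘ suc) (width≡ b)) (cong (4 +_) (sym (+-suc b b)))

even-sufficiency : ∀ {m n a b c} → 2 ≤ a → b * 2 ≤ m → 1 ≤ b → m * a ≡ n * b → MRSExists m n (a * 2) (b * 2) c
even-sufficiency {m} {n} {a} {b} {c} a≥2 b2≤m b≥1 ma≡nb = by-row-parity (parity m) (parity a) a≥2 b2≤m b≥1 ma≡nb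
  where
  double : ∀ p → p + p ≡ p * 2
  double p = trans (cong (p +_) (sym (+-identityʳ p))) (*-comm 2 p)

  kotzig : ∀ {a} → Parity a → 2 ≤ a → ∀ m' h → m' ≡ h + h → Kotzig a (suc m')
  kotzig (even q) _ m' h _ = subst (λ z → Kotzig z (suc m')) (sym (double q)) (kotzig-even q m')
  kotzig (odd (suc q)) _ m' h refl = subst (λ z → Kotzig z (suc m')) (trans (width≡ q) (cong (2 +_) (sym (+-suc q q)))) (kotzig-odd q h)
  kotzig (odd zero) (s≤s ())

  pattern-for : ∀ {a} → Parity a → 2 ≤ a → Pattern (a * 2)
  pattern-for (even q) _ = subst Pattern (ring q) (quadPattern q)
    where
    ring : ∀ q → q * 4 ≡ (q + q) * 2
    ring = solve-∀
  pattern-for (odd (suc q)) _ = subst Pattern (ring q) (hexPattern q)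
    where
    ring : ∀ q → 6 + q * 4 ≡ suc (suc q + suc q) * 2
    ring = solve-∀
  pattern-for (odd zero) (s≤s ())

  by-row-parity : ∀ {m a} → Parity m → Parity a → 2 ≤ a → b * 2 ≤ m → 1 ≤ b → m * a ≡ n * b → MRSExists m n (a * 2) (b * 2) c
  by-row-parity (odd h) pa a≥2 b2≤m b≥1 e = odd-rows h (kotzig pa a≥2 (h + h) h refl) b2≤m e
  by-row-parity {a = suc a'} (even (suc μ)) pa a≥2 b2≤m b≥1 e = even-rows (suc μ) (double (suc μ)) (pattern-for pa a≥2) b2≤m e
  by-row-parity (even zero) pa a≥2 b2≤m b≥1 e = ⊥-elim (<-irrefl refl (≤-trans (*-mono-≤ b≥1 (s≤s (z≤n {1}))) (≤-trans b2≤m z≤n)))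

-- Odd squares with g filled diagonals

module Circulant (h : ℕ) where
  open Odd h using (d; zig; zig-sum)
  open UnitAction h

  -- Labels f w on the cells of a broken diagonal that meets row or column w + a at w.
  at : ℕ → (Fin d → ℕ) → Fin d → ℕ
  at a f i = ∑ d (λ w → δ (rot a w) i * f w)

  at-rot : ∀ a f x → at a f (rot a x) ≡ f x
  at-rot a f x = ∑-fibre (rot a) (rot-injective a) f x

  value : Unit → Fin d → ℕ
  value z w = toℕ (act z w)

  at-pair : ∀ a i → at a (value (true , 1#)) i + at a (value (false , 1#)) i ≡ h + h
  at-pair a i with rot-surjective a i
  ... | x , refl = trans (cong₂ _+_ (at-rot a (value (true , 1#)) x) (at-rot a (value (false , 1#)) x)) (+-opposite x)

  -- A diagonal shifted by one row less meets the row of cell x in its cell x + 1; so the second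
  -- copy of ω supplies the term for ω².
  at-triple : ∀ a i → at (1 + a) (value (true , 1#)) i + (at (1 + a) (value (true , ω#)) i + at a (value (true , ω#)) i) ≡ h + h + h
  at-triple a i with rot-surjective (1 + a) i
  ... | x , refl = trans (cong₂ _+_ (at-rot (1 + a) (value (true , 1#)) x) (cong₂ _+_ (at-rot (1 + a) (value (true , ω#)) x)
      (trans (cong (at a (value (true , ω#))) (sym (rot-rot a 1 x))) (at-rot a (value (true , ω#)) (rot 1 x))))) (zig-sum x)

  at-affine : ∀ a A C f i → at a (λ w → A + C * f w) i ≡ A + C * at a f i
  at-affine a A C f i with rot-surjective a i
  ... | x , refl = trans (at-rot a (λ w → A + C * f w) x) (cong (λ z → A + C * z) (sym (at-rot a f x)))

  -- g broken diagonals; the τ-th has its w-th cell in row w + shift τ and lies offset τ columns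
  -- to the right of the main diagonal.
  record Diagonals (g : ℕ) : Set where
    field
      kind       : Fin g → Unit
      shift      : Fin g → ℕ
      offset     : Fin g → ℕ
      offset<g   : ∀ τ → offset τ < g
      offset-inj : ∀ {τ υ} → offset τ ≡ offset υ → τ ≡ υ
      row-sum    : ∀ i → ∑ g (λ τ → at (shift τ) (value (kind τ)) i) ≡ g * h
      col-sum    : ∀ j → ∑ g (λ τ → at (offset τ + shift τ) (value (kind τ)) j) ≡ g * h

  -- The ω² of the triple is a second ω displaced by one. The two ω diagonals exchange these roles
  -- between rows and columns.
  three : Diagonals 3
  three = record
    { kind   = λ { Fin.zero → true , 1# ; (Fin.suc Fin.zero) → true , ω# ; (Fin.suc (Fin.suc _)) → true , ω# }
    ; shift  = λ { Fin.zero → 1 ; (Fin.suc Fin.zero) → 1 ; (Fin.suc (Fin.suc _)) → 0 }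
    ; offset = λ { Fin.zero → 1 ; (Fin.suc Fin.zero) → 0 ; (Fin.suc (Fin.suc _)) → 2 }
    ; offset<g = λ { Fin.zero → s≤s (s≤s z≤n) ; (Fin.suc Fin.zero) → s≤s z≤n ; (Fin.suc (Fin.suc Fin.zero)) → s≤s (s≤s (s≤s z≤n)) }
    ; offset-inj = λ { {Fin.zero} {Fin.zero} _ → refl
                     ; {Fin.suc Fin.zero} {Fin.suc Fin.zero} _ → refl
                     ; {Fin.suc (Fin.suc Fin.zero)} {Fin.suc (Fin.suc Fin.zero)} _ → refl
                     ; {Fin.zero} {Fin.suc Fin.zero} () ; {Fin.zero} {Fin.suc (Fin.suc Fin.zero)} ()
                     ; {Fin.suc Fin.zero} {Fin.zero} () ; {Fin.suc Fin.zero} {Fin.suc (Fin.suc Fin.zero)} ()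
                     ; {Fin.suc (Fin.suc Fin.zero)} {Fin.zero} () ; {Fin.suc (Fin.suc Fin.zero)} {Fin.suc Fin.zero} () }
    ; row-sum = λ i → trans (ring₁ (at 1 (value (true , 1#)) i) (at 1 (value (true , ω#)) i) (at 0 (value (true , ω#)) i)) (trans (at-triple 0 i) (ring₃ h))
    ; col-sum = λ j → trans (ring₂ (at 2 (value (true , 1#)) j) (at 1 (value (true , ω#)) j) (at 2 (value (true , ω#)) j)) (trans (at-triple 1 j) (ring₃ h))
    }
    where
    ring₁ : ∀ a b c → a + (b + (c + 0)) ≡ a + (b + c)
    ring₁ = solve-∀
    ring₂ : ∀ a b c → a + (b + (c + 0)) ≡ a + (c + b)
    ring₂ = solve-∀
    ring₃ : ∀ h → h + h + h ≡ 3 * h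
    ring₃ = solve-∀

  -- Diagonals 1 and -1 cancel in rows if their shifts agree, in columns if offset + shift agree;
  -- both together would force equal offsets. So -1 cancels the second diagonal in the rows and the
  -- first in the columns, and the other 1 forms a triple with the two ω diagonals.
  five : Diagonals 5
  five = record
    { kind = kind ; shift = shift ; offset = offset
    ; offset<g = λ { 0F → s≤s z≤n ; 1F → s≤s (s≤s (s≤s (s≤s (s≤s z≤n)))) ; 2F → s≤s (s≤s (s≤s z≤n)) ; 3F → s≤s (s≤s z≤n) ; 4F → s≤s (s≤s (s≤s (s≤s z≤n))) }
    ; offset-inj = λ {τ} {υ} e → trans (sym (back-offset τ)) (trans (cong back e) (back-offset υ))
    ; row-sum = λ i → trans (ring₁ (at 2 (value (true , 1#)) i) (at 0 (value (true , 1#)) i) (at 0 (value (false , 1#)) i) (at 2 (value (true , ω#)) i) (at 1 (value (true , ω#)) i))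
                        (trans (cong₂ _+_ (at-triple 1 i) (at-pair 0 i)) (ring₃ h))
    ; col-sum = λ j → trans (ring₂ (at 2 (value (true , 1#)) j) (at 4 (value (true , 1#)) j) (at 2 (value (false , 1#)) j) (at 3 (value (true , ω#)) j) (at 4 (value (true , ω#)) j))
                        (trans (cong₂ _+_ (at-triple 3 j) (at-pair 2 j)) (ring₃ h))
    }
    where
    kind : Fin 5 → Unit
    kind 0F = true , 1#
    kind 1F = true , 1#
    kind 2F = false , 1#
    kind 3F = true , ω#
    kind 4F = true , ω#
    shift offset : Fin 5 → ℕ
    shift 0F = 2
    shift 1F = 0
    shift 2F = 0
    shift 3F = 2
    shift 4F = 1
    offset 0F = 0
    offset 1F = 4
    offset 2F = 2
    offset 3F = 1
    offset 4F = 3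
    back : ℕ → Fin 5
    back 0 = 0F
    back 1 = 3F
    back 2 = 2F
    back 3 = 4F
    back _ = 1F
    back-offset : ∀ τ → back (offset τ) ≡ τ
    back-offset 0F = refl
    back-offset 1F = refl
    back-offset 2F = refl
    back-offset 3F = refl
    back-offset 4F = refl
    ring₁ : ∀ a b c d e → a + (b + (c + (d + (e + 0)))) ≡ (a + (d + e)) + (b + c)
    ring₁ = solve-∀
    ring₂ : ∀ a b c d e → a + (b + (c + (d + (e + 0)))) ≡ (b + (e + d)) + (a + c)
    ring₂ = solve-∀
    ring₃ : ∀ h → (h + h + h) + (h + h) ≡ 5 * h
    ring₃ = solve-∀

  -- As two opposite diagonals cannot cancel both ways, four are linked in a cycle: the first
  -- cancels the second and the third the fourth in rows, the first cancels the third and the second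
  -- the fourth in columns.
  four-more : ∀ {g} → Diagonals g → Diagonals (4 + g)
  four-more {g} D = record
    { kind = kind' ; shift = shift' ; offset = offset' ; offset<g = offset'<
    ; offset-inj = λ {τ} {υ} → inj τ υ
    ; row-sum = λ i → trans (ring₁ (at 2 (value (true , 1#)) i) (at 2 (value (false , 1#)) i) (at 0 (value (false , 1#)) i) (at 0 (value (true , 1#)) i) _)
                        (trans (cong₂ _+_ (cong₂ _+_ (at-pair 2 i) (at-pair 0 i)) (row-sum i)) (ring₃ h (g * h)))
    ; col-sum = λ j → trans (cong₂ (λ x y → at (0 + g + 2) (value (true , 1#)) j + (at (1 + g + 2) (value (false , 1#)) j + (at x (value (false , 1#)) j + (at y (value (true , 1#)) j + ∑ g (λ τ → at (offset τ + shift τ) (value (kind τ)) j))))) (e₁ g) (e₂ g))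
                        (trans (ring₂ (at (0 + g + 2) (value (true , 1#)) j) (at (1 + g + 2) (value (false , 1#)) j) (at (0 + g + 2) (value (false , 1#)) j) (at (1 + g + 2) (value (true , 1#)) j) _)
                        (trans (cong₂ _+_ (cong₂ _+_ (at-pair (0 + g + 2) j) (at-pair (1 + g + 2) j)) (col-sum j)) (ring₃ h (g * h))))
    }
    where
    open Diagonals D
    kind' : Fin (4 + g) → Unit
    kind' 0F = true , 1#
    kind' 1F = false , 1#
    kind' 2F = false , 1#
    kind' 3F = true , 1#
    kind' (Fin.suc (Fin.suc (Fin.suc (Fin.suc τ)))) = kind τ
    shift' offset' : Fin (4 + g) → ℕ
    shift' 0F = 2
    shift' 1F = 2
    shift' 2F = 0
    shift' 3F = 0
    shift' (Fin.suc (Fin.suc (Fin.suc (Fin.suc τ)))) = shift τ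
    offset' 0F = g
    offset' 1F = 1 + g
    offset' 2F = 2 + g
    offset' 3F = 3 + g
    offset' (Fin.suc (Fin.suc (Fin.suc (Fin.suc τ)))) = offset τ
    offset'< : ∀ τ → offset' τ < 4 + g
    offset'< 0F = s≤s (m≤n+m g 3)
    offset'< 1F = s≤s (s≤s (m≤n+m g 2))
    offset'< 2F = s≤s (s≤s (s≤s (m≤n+m g 1)))
    offset'< 3F = ≤-refl
    offset'< (Fin.suc (Fin.suc (Fin.suc (Fin.suc τ)))) = ≤-trans (offset<g τ) (m≤n+m g 4)
    e₁ : ∀ g → 2 + g + 0 ≡ 0 + g + 2
    e₁ = solve-∀
    e₂ : ∀ g → 3 + g + 0 ≡ 1 + g + 2
    e₂ = solve-∀
    big≢ : ∀ k τ → k + g ≢ offset τ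
    big≢ k τ e = <⇒≱ (offset<g τ) (≤-trans (m≤n+m g k) (≤-reflexive e))
    offset-new : ∀ (i : Fin 4) → offset' (i ↑ˡ g) ≡ toℕ i + g
    offset-new 0F = refl
    offset-new 1F = refl
    offset-new 2F = refl
    offset-new 3F = refl
    split : ∀ τ → (∃ λ i → τ ≡ i ↑ˡ g) ⊎ (∃ λ υ → τ ≡ 4 ↑ʳ υ)
    split 0F = inj₁ (0F , refl)
    split 1F = inj₁ (1F , refl)
    split 2F = inj₁ (2F , refl)
    split 3F = inj₁ (3F , refl)
    split (Fin.suc (Fin.suc (Fin.suc (Fin.suc τ)))) = inj₂ (τ , refl)
    inj : ∀ τ υ → offset' τ ≡ offset' υ → τ ≡ υ
    inj τ υ e with split τ | split υ
    ... | inj₁ (i , refl) | inj₁ (j , refl) = cong (_↑ˡ g) (toℕ-injective (+-cancelʳ-≡ g (toℕ i) (toℕ j) (trans (sym (offset-new i)) (trans e (offset-new j)))))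
    ... | inj₁ (i , refl) | inj₂ (τ' , refl) = ⊥-elim (big≢ (toℕ i) τ' (trans (sym (offset-new i)) e))
    ... | inj₂ (τ' , refl) | inj₁ (j , refl) = ⊥-elim (big≢ (toℕ j) τ' (trans (sym (offset-new j)) (sym e)))
    ... | inj₂ (τ' , refl) | inj₂ (υ' , refl) = cong (4 ↑ʳ_) (offset-inj e)
    ring₁ : ∀ a b c d r → a + (b + (c + (d + r))) ≡ ((a + b) + (d + c)) + r
    ring₁ = solve-∀
    ring₂ : ∀ a b c d r → a + (b + (c + (d + r))) ≡ ((a + c) + (d + b)) + r
    ring₂ = solve-∀
    ring₃ : ∀ h r → ((h + h) + (h + h)) + r ≡ h + (h + (h + (h + r)))
    ring₃ = solve-∀

  diagonals : ∀ b → Diagonals (width b)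
  diagonals zero          = three
  diagonals (suc zero)    = five
  diagonals (suc (suc b)) = four-more (diagonals b)

odd-squares : ∀ b h η → width b ≤ suc (h + h) → MRSExists (suc (h + h)) (suc (h + h)) (width b) (width b) (suc (η + η))
odd-squares b h η g≤d = MRS-fromCells (*-comm g d) record
  { ρ = λ P → rot (shift (τ-of P)) (w-of P) ; κ = λ P → rot (offset (τ-of P) + shift (τ-of P)) (w-of P)
  ; cell-inj = λ {P} {Q} → cell-inj P Q
  ; label = λ t P → lab t (remQuot {g} d P)
  ; label-inj = λ {t} {u} {P} {Q} → label-inj t u P Q
  ; ρ-count = λ i → counts shift i
  ; κ-count = λ j → counts (λ τ → offset τ + shift τ) j
  ; x = total ; y = total
  ; ρ-sum = λ t i → sums shift row-sum t i
  ; κ-sum = λ t j → sums (λ τ → offset τ + shift τ) col-sum t j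
  }
  where
  open Circulant h
  open UnitAction h using (act; act-injective)
  module C = UnitAction η
  open Diagonals (diagonals b)
  g = width b
  d = suc (h + h)
  c = suc (η + η)

  τ-of : Fin (g * d) → Fin g
  τ-of P = proj₁ (remQuot {g} d P)
  w-of : Fin (g * d) → Fin d
  w-of P = proj₂ (remQuot {g} d P)

  N≡ : g * (d * c) ≡ c * (g * d)
  N≡ = ring g d c
    where
    ring : ∀ g d c → g * (d * c) ≡ c * (g * d)
    ring = solve-∀

  digit : Fin g → Fin c → Fin c
  digit τ = C.act ((true , 1#) · units b τ)

  -- Each line meets each diagonal once, so the digit τ has a constant sum; the middle digit is
  -- governed by `Diagonals`; the last is the copy number t moved by units of sum 0.
  lab : Fin c → Fin g × Fin d → Fin (c * (g * d))
  lab t (τ , w) = cast N≡ (combine τ (combine (act (kind τ) w) (digit τ t)))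

  cell-inj : ∀ P Q → rot (shift (τ-of P)) (w-of P) ≡ rot (shift (τ-of Q)) (w-of Q) →
             rot (offset (τ-of P) + shift (τ-of P)) (w-of P) ≡ rot (offset (τ-of Q) + shift (τ-of Q)) (w-of Q) → P ≡ Q
  cell-inj P Q e e' = remQuot-injective g d τ≡ (rot-injective (shift (τ-of P)) (trans e (cong (λ z → rot (shift z) (w-of Q)) (sym τ≡))))
    where
    via : ∀ P → rot (offset (τ-of P) + shift (τ-of P)) (w-of P) ≡ rot (offset (τ-of P)) (rot (shift (τ-of P)) (w-of P))
    via P = trans (cong (λ z → rot z (w-of P)) (+-comm (offset (τ-of P)) _)) (sym (rot-rot (offset (τ-of P)) (shift (τ-of P)) (w-of P)))
    τ≡ : τ-of P ≡ τ-of Q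
    -- Offsets are below g ≤ d, so they are determined by their residues modulo d.
    τ≡ = offset-inj (rot-injectiveˡ (rot (shift (τ-of P)) (w-of P)) (≤-trans (offset<g _) g≤d) (≤-trans (offset<g _) g≤d)
      (trans (sym (via P)) (trans e' (trans (via Q) (cong (rot (offset (τ-of Q))) (sym e))))))

  label-inj : ∀ t u P Q → lab t (remQuot {g} d P) ≡ lab u (remQuot {g} d Q) → t ≡ u × P ≡ Q
  label-inj t u P Q e with combine-injective (τ-of P) _ (τ-of Q) _ (cast-injective N≡ e)
  ... | p , q with combine-injective (act (kind (τ-of P)) (w-of P)) _ (act (kind (τ-of Q)) (w-of Q)) _ q
  ... | r , r' = C.act-injective ((true , 1#) · units b (τ-of P)) (trans r' (cong (λ z → digit z u) (sym p))) ,
                 remQuot-injective g d p (act-injective (kind (τ-of P)) (trans r (cong (λ z → act (kind z) (w-of Q)) (sym p))))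

  counts : ∀ (s : Fin g → ℕ) i → ∑ (g * d) (λ P → δ (rot (s (τ-of P)) (w-of P)) i) ≡ g
  counts s i = trans (∑-remQuot g d (λ τ w → δ (rot (s τ) w) i)) (trans (∑-cong g λ τ →
    ∑-δ-injective (rot (s τ)) (rot-injective (s τ)) i) (trans (∑-const g 1) (*-identityʳ g)))

  total : ℕ
  total = ∑ g (λ τ → (d * c) * toℕ τ) + g * η + c * (g * h)

  sums : ∀ (s : Fin g → ℕ) → (∀ i → ∑ g (λ τ → at (s τ) (value (kind τ)) i) ≡ g * h) → ∀ t i →
         ∑ (g * d) (λ P → δ (rot (s (τ-of P)) (w-of P)) i * toℕ (lab t (remQuot {g} d P))) ≡ total
  sums s zero-sum t i = trans (∑-remQuot g d (λ τ w → δ (rot (s τ) w) i * toℕ (lab t (τ , w))))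
    (trans (∑-cong g λ τ → trans (∑-cong d λ w → cong (δ (rot (s τ) w) i *_) (toℕ-lab τ w))
                                 (at-affine (s τ) (A τ) c (value (kind τ)) i))
    (trans (∑-distrib-+ g A (λ τ → c * at (s τ) (value (kind τ)) i)) (cong₂ _+_
      (trans (∑-distrib-+ g (λ τ → (d * c) * toℕ τ) (λ τ → toℕ (digit τ t))) (cong (∑ g (λ τ → (d * c) * toℕ τ) +_) (C.∑-act b (true , 1#) t)))
      (trans (∑-*ˡ g c _) (cong (c *_) (zero-sum i))))))
    where
    A : Fin g → ℕ
    A τ = (d * c) * toℕ τ + toℕ (digit τ t)
    toℕ-lab : ∀ τ w → toℕ (lab t (τ , w)) ≡ A τ + c * value (kind τ) w
    toℕ-lab τ w = trans (toℕ-cast N≡ _) (trans (toℕ-combine τ _) (trans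
      (cong ((d * c) * toℕ τ +_) (trans (toℕ-combine (act (kind τ) w) (digit τ t)) (+-comm (c * value (kind τ) w) _)))
      (sym (+-assoc ((d * c) * toℕ τ) _ _))))

-- Odd rectangles

open import Data.Integer as ℤ using (ℤ; +_; -_; 0ℤ)
import Data.Integer.Properties as ℤ
import Data.Integer.Tactic.RingSolver as ℤ-Ring

∑ᶻ : ∀ n → (Fin n → ℤ) → ℤ
∑ᶻ zero    f = 0ℤ
∑ᶻ (suc n) f = f 0F ℤ.+ ∑ᶻ n (f ∘ Fin.suc)

entries : ∀ k s → (Fin k → Fin s → ℤ) → List ℤ
entries zero    s f = []
entries (suc k) s f = tabulate (f 0F) ++ entries k s (f ∘ Fin.suc)

-- Entries are tracked only as a list up to permutation, which is all that gluing blocks requires;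
-- distinctness is recovered at the end by counting.
record ZeroSum (k s : ℕ) (L : List ℤ) : Set where
  field
    entry     : Fin k → Fin s → ℤ
    row-zero  : ∀ i → ∑ᶻ s (entry i) ≡ 0ℤ
    col-zero  : ∀ j → ∑ᶻ k (λ i → entry i j) ≡ 0ℤ
    entries-↭ : entries k s entry ↭ L

open ZeroSum

relabel : ∀ {k s L L'} → L ↭ L' → ZeroSum k s L → ZeroSum k s L'
relabel p A = record { entry = entry A ; row-zero = row-zero A ; col-zero = col-zero A ; entries-↭ = ↭-trans (entries-↭ A) p }

glue : ∀ {X : Set} m {n} → (Fin m → X) → (Fin n → X) → Fin (m + n) → X
glue zero    f g i           = g i
glue (suc m) f g Fin.zero    = f 0F
glue (suc m) f g (Fin.suc i) = glue m (f ∘ Fin.suc) g i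

∑ᶻ-glue : ∀ m n (f : Fin m → ℤ) (g : Fin n → ℤ) → ∑ᶻ (m + n) (glue m f g) ≡ ∑ᶻ m f ℤ.+ ∑ᶻ n g
∑ᶻ-glue zero    n f g = sym (ℤ.+-identityˡ _)
∑ᶻ-glue (suc m) n f g = trans (cong (ℤ._+_ (f 0F)) (∑ᶻ-glue m n (f ∘ Fin.suc) g)) (sym (ℤ.+-assoc (f 0F) _ _))

tabulate-glue : ∀ m n (f : Fin m → ℤ) (g : Fin n → ℤ) → tabulate (glue m f g) ≡ tabulate f ++ tabulate g
tabulate-glue zero    n f g = refl
tabulate-glue (suc m) n f g = cong (f 0F ∷_) (tabulate-glue m n (f ∘ Fin.suc) g)

glue-all : ∀ {X : Set} (P : X → Set) m {n} (f : Fin m → X) (g : Fin n → X) → (∀ i → P (f i)) → (∀ i → P (g i)) → ∀ i → P (glue m f g i)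
glue-all P zero    f g p q i           = q i
glue-all P (suc m) f g p q Fin.zero    = p 0F
glue-all P (suc m) f g p q (Fin.suc i) = glue-all P m (f ∘ Fin.suc) g (p ∘ Fin.suc) q i

++-interchange : ∀ {X : Set} (as bs cs ds : List X) → (as ++ bs) ++ (cs ++ ds) ↭ (as ++ cs) ++ (bs ++ ds)
++-interchange as bs cs ds = ↭-trans (↭-reflexive (++-assoc as bs (cs ++ ds))) (↭-trans (++⁺ˡ as
  (↭-trans (↭-reflexive (sym (++-assoc bs cs ds))) (↭-trans (++⁺ʳ ds (++-comm bs cs)) (↭-reflexive (++-assoc cs bs ds)))))
  (↭-reflexive (sym (++-assoc as cs (bs ++ ds)))))

beside : ∀ {k s s' L L'} → ZeroSum k s L → ZeroSum k s' L' → ZeroSum k (s + s') (L ++ L')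
beside {k} {s} {s'} A B = record
  { entry     = λ i → glue s (entry A i) (entry B i)
  ; row-zero  = λ i → trans (∑ᶻ-glue s s' (entry A i) (entry B i)) (cong₂ ℤ._+_ (row-zero A i) (row-zero B i))
  ; col-zero  = cols s (entry A) (entry B) (col-zero A) (col-zero B)
  ; entries-↭ = ↭-trans (flatten k (entry A) (entry B)) (++⁺ (entries-↭ A) (entries-↭ B))
  }
  where
  cols : ∀ s {s'} (f : Fin k → Fin s → ℤ) (g : Fin k → Fin s' → ℤ) → (∀ j → ∑ᶻ k (λ i → f i j) ≡ 0ℤ) → (∀ j → ∑ᶻ k (λ i → g i j) ≡ 0ℤ) →
         ∀ j → ∑ᶻ k (λ i → glue s (f i) (g i) j) ≡ 0ℤ
  cols zero    f g p q j           = q j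
  cols (suc s) f g p q Fin.zero    = p 0F
  cols (suc s) f g p q (Fin.suc j) = cols s (λ i → f i ∘ Fin.suc) g (p ∘ Fin.suc) q j
  flatten : ∀ k (f : Fin k → Fin s → ℤ) (g : Fin k → Fin s' → ℤ) →
            entries k (s + s') (λ i → glue s (f i) (g i)) ↭ entries k s f ++ entries k s' g
  flatten zero    f g = ↭-refl
  flatten (suc k) f g = ↭-trans (++⁺ (↭-reflexive (tabulate-glue s s' (f 0F) (g 0F))) (flatten k (f ∘ Fin.suc) (g ∘ Fin.suc)))
    (++-interchange (tabulate (f 0F)) (tabulate (g 0F)) _ _)

stack : ∀ {k k' s L L'} → ZeroSum k s L → ZeroSum k' s L' → ZeroSum (k + k') s (L ++ L')
stack {k} {k'} {s} A B = record
  { entry     = glue k (entry A) (entry B)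
  ; row-zero  = glue-all (λ r → ∑ᶻ s r ≡ 0ℤ) k (entry A) (entry B) (row-zero A) (row-zero B)
  ; col-zero  = λ j → trans (cols k (entry A) (entry B) j) (cong₂ ℤ._+_ (col-zero A j) (col-zero B j))
  ; entries-↭ = ↭-trans (↭-reflexive (flatten k (entry A) (entry B))) (++⁺ (entries-↭ A) (entries-↭ B))
  }
  where
  cols : ∀ k {k'} (f : Fin k → Fin s → ℤ) (g : Fin k' → Fin s → ℤ) j →
         ∑ᶻ (k + k') (λ i → glue k f g i j) ≡ ∑ᶻ k (λ i → f i j) ℤ.+ ∑ᶻ k' (λ i → g i j)
  cols zero    f g j = sym (ℤ.+-identityˡ _)
  cols (suc k) f g j = trans (cong (ℤ._+_ (f 0F j)) (cols k (f ∘ Fin.suc) g j)) (sym (ℤ.+-assoc (f 0F j) _ _))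
  flatten : ∀ k {k'} (f : Fin k → Fin s → ℤ) (g : Fin k' → Fin s → ℤ) →
            entries (k + k') s (glue k f g) ≡ entries k s f ++ entries k' s g
  flatten zero    f g = refl
  flatten (suc k) f g = trans (cong (tabulate (f 0F) ++_) (flatten k (f ∘ Fin.suc) g)) (sym (++-assoc (tabulate (f 0F)) _ _))

-- Permutations of label lists

extract : ∀ x (ys : List ℕ) → Maybe (∃ λ zs → ys ↭ x ∷ zs)
extract x [] = nothing
extract x (y ∷ ys) with x ≟ y
... | yes refl = just (ys , ↭-refl)
... | no _     = extract x ys >>= λ { (zs , p) → just (y ∷ zs , ↭-trans (prep y p) (swap y x ↭-refl)) }

permutation? : (xs ys : List ℕ) → Maybe (xs ↭ ys)
permutation? []       []       = just ↭-refl
permutation? []       (_ ∷ _)  = nothing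
permutation? (x ∷ xs) ys = extract x ys >>= λ { (zs , p) → permutation? xs zs >>= λ q → just (↭-trans (prep x q) (↭-sym p)) }

concatMap-↭ : ∀ {X Y : Set} (f : X → List Y) {xs ys} → xs ↭ ys → concatMap f xs ↭ concatMap f ys
concatMap-↭ f Perm.refl = ↭-refl
concatMap-↭ f (Perm.prep x p) = ++⁺ˡ (f x) (concatMap-↭ f p)
concatMap-↭ f (Perm.swap {xs} {ys} x y p) = ↭-trans (↭-reflexive (sym (++-assoc (f x) (f y) _)))
  (↭-trans (++⁺ (++-comm (f x) (f y)) (concatMap-↭ f p)) (↭-reflexive (++-assoc (f y) (f x) _)))
concatMap-↭ f (Perm.trans p q) = ↭-trans (concatMap-↭ f p) (concatMap-↭ f q)

pm : List ℕ → List ℤ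
pm []       = []
pm (x ∷ xs) = + x ∷ - (+ x) ∷ pm xs

pm-++ : ∀ xs ys → pm (xs ++ ys) ≡ pm xs ++ pm ys
pm-++ []       ys = refl
pm-++ (x ∷ xs) ys = cong (λ z → + x ∷ - (+ x) ∷ z) (pm-++ xs ys)

pm-↭ : ∀ {xs ys} → xs ↭ ys → pm xs ↭ pm ys
pm-↭ Perm.refl = ↭-refl
pm-↭ (Perm.prep x p) = prep _ (prep _ (pm-↭ p))
pm-↭ (Perm.swap x y p) = ↭-trans (++⁺ʳ _ (++-comm (+ x ∷ - (+ x) ∷ []) (+ y ∷ - (+ y) ∷ []))) (prep _ (prep _ (prep _ (prep _ (pm-↭ p)))))
pm-↭ (Perm.trans p q) = ↭-trans (pm-↭ p) (pm-↭ q)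

matrix : ∀ {k s} → Vec (Vec ℤ s) k → Fin k → Fin s → ℤ
matrix rows i j = Vec.lookup (Vec.lookup rows i) j

-- Entries of a block contain variables. Its list is therefore compared with the label list through
-- positions: `permutation?` settles the lists of numerals by evaluation, and `env` maps positions
-- back to entries.
env : List ℤ → ℕ → ℤ
env []       _       = 0ℤ
env (z ∷ zs) zero    = z
env (z ∷ zs) (suc i) = env zs i

-- Blocks on triples and on four consecutive labels

strip₃₂ : ∀ x u → ZeroSum 3 2 (pm (x ∷ u ∷ x + u ∷ []))
strip₃₂ x u = record
  { entry = matrix ((+ x ∷ - (+ x) ∷ []) ∷ (+ u ∷ - (+ u) ∷ []) ∷ (- (+ x ℤ.+ + u) ∷ + x ℤ.+ + u ∷ []) ∷ [])
  ; row-zero = λ { 0F → r (+ x) ; 1F → r (+ u) ; 2F → r' (+ x ℤ.+ + u) }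
  ; col-zero = λ { 0F → c (+ x) (+ u) ; 1F → c' (+ x) (+ u) }
  ; entries-↭ = prep _ (prep _ (prep _ (prep _ (swap _ _ ↭-refl))))
  }
  where
  r : ∀ x → x ℤ.+ (- x ℤ.+ 0ℤ) ≡ 0ℤ
  r = ℤ-Ring.solve-∀
  r' : ∀ x → - x ℤ.+ (x ℤ.+ 0ℤ) ≡ 0ℤ
  r' = ℤ-Ring.solve-∀
  c : ∀ x u → x ℤ.+ (u ℤ.+ (- (x ℤ.+ u) ℤ.+ 0ℤ)) ≡ 0ℤ
  c = ℤ-Ring.solve-∀
  c' : ∀ x u → - x ℤ.+ (- u ℤ.+ (x ℤ.+ u ℤ.+ 0ℤ)) ≡ 0ℤ
  c' = ℤ-Ring.solve-∀

x-x : ∀ x → x ℤ.+ (- x ℤ.+ 0ℤ) ≡ 0ℤ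
x-x = ℤ-Ring.solve-∀

-x+x : ∀ x → - x ℤ.+ (x ℤ.+ 0ℤ) ≡ 0ℤ
-x+x = ℤ-Ring.solve-∀

strip₂₃ : ∀ x u → ZeroSum 2 3 (pm (x ∷ u ∷ x + u ∷ []))
strip₂₃ x u = record
  { entry = matrix ((+ x ∷ + u ∷ - (+ x ℤ.+ + u) ∷ []) ∷ (- (+ x) ∷ - (+ u) ∷ + x ℤ.+ + u ∷ []) ∷ [])
  ; row-zero = λ { 0F → c (+ x) (+ u) ; 1F → c' (+ x) (+ u) }
  ; col-zero = λ { 0F → x-x (+ x) ; 1F → x-x (+ u) ; 2F → -x+x (+ x ℤ.+ + u) }
  ; entries-↭ = map⁺ (env (pm (x ∷ u ∷ x + u ∷ []))) (from-just (permutation? (0 ∷ 2 ∷ 5 ∷ 1 ∷ 3 ∷ 4 ∷ []) (0 ∷ 1 ∷ 2 ∷ 3 ∷ 4 ∷ 5 ∷ [])))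
  }
  where
  c : ∀ x u → x ℤ.+ (u ℤ.+ (- (x ℤ.+ u) ℤ.+ 0ℤ)) ≡ 0ℤ
  c = ℤ-Ring.solve-∀
  c' : ∀ x u → - x ℤ.+ (- u ℤ.+ (x ℤ.+ u ℤ.+ 0ℤ)) ≡ 0ℤ
  c' = ℤ-Ring.solve-∀

-- The third number exceeds x + w by one; the neighbours y and y + 1, with opposite signs, make up
-- for it.
strip₂₅ : ∀ x w y → ZeroSum 2 5 (pm (x ∷ w ∷ 1 + x + w ∷ y ∷ 1 + y ∷ []))
strip₂₅ x w y = record
  { entry = matrix ((+ x ∷ + w ∷ - (+ 1 ℤ.+ + x ℤ.+ + w) ∷ + 1 ℤ.+ + y ∷ - (+ y) ∷ [])
                  ∷ (- (+ x) ∷ - (+ w) ∷ + 1 ℤ.+ + x ℤ.+ + w ∷ - (+ 1 ℤ.+ + y) ∷ + y ∷ []) ∷ [])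
  ; row-zero = λ { 0F → c (+ x) (+ w) (+ y) ; 1F → c' (+ x) (+ w) (+ y) }
  ; col-zero = λ { 0F → x-x (+ x) ; 1F → x-x (+ w) ; 2F → -x+x (+ 1 ℤ.+ + x ℤ.+ + w) ; 3F → x-x (+ 1 ℤ.+ + y) ; 4F → -x+x (+ y) }
  ; entries-↭ = map⁺ (env (pm (x ∷ w ∷ 1 + x + w ∷ y ∷ 1 + y ∷ [])))
      (from-just (permutation? (0 ∷ 2 ∷ 5 ∷ 8 ∷ 7 ∷ 1 ∷ 3 ∷ 4 ∷ 9 ∷ 6 ∷ []) (0 ∷ 1 ∷ 2 ∷ 3 ∷ 4 ∷ 5 ∷ 6 ∷ 7 ∷ 8 ∷ 9 ∷ [])))
  }
  where
  c : ∀ x w y → x ℤ.+ (w ℤ.+ (- (+ 1 ℤ.+ x ℤ.+ w) ℤ.+ (+ 1 ℤ.+ y ℤ.+ (- y ℤ.+ 0ℤ)))) ≡ 0ℤ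
  c = ℤ-Ring.solve-∀
  c' : ∀ x w y → - x ℤ.+ (- w ℤ.+ (+ 1 ℤ.+ x ℤ.+ w ℤ.+ (- (+ 1 ℤ.+ y) ℤ.+ (y ℤ.+ 0ℤ)))) ≡ 0ℤ
  c' = ℤ-Ring.solve-∀

iv : ℕ → ℕ → List ℕ
iv y zero    = []
iv y (suc n) = y ∷ iv (suc y) n

tile₂₄ : ∀ y → ZeroSum 2 4 (pm (iv y 4))
tile₂₄ y = record
  { entry = matrix ((+ y ∷ - (+ 1 ℤ.+ + y) ∷ - (+ 2 ℤ.+ + y) ∷ + 3 ℤ.+ + y ∷ []) ∷ (- (+ y) ∷ + 1 ℤ.+ + y ∷ + 2 ℤ.+ + y ∷ - (+ 3 ℤ.+ + y) ∷ []) ∷ [])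
  ; row-zero = λ { 0F → c (+ y) ; 1F → c' (+ y) }
  ; col-zero = λ { 0F → x-x (+ y) ; 1F → -x+x (+ 1 ℤ.+ + y) ; 2F → -x+x (+ 2 ℤ.+ + y) ; 3F → x-x (+ 3 ℤ.+ + y) }
  ; entries-↭ = map⁺ (env (pm (iv y 4))) (from-just (permutation? (0 ∷ 3 ∷ 5 ∷ 6 ∷ 1 ∷ 2 ∷ 4 ∷ 7 ∷ []) (0 ∷ 1 ∷ 2 ∷ 3 ∷ 4 ∷ 5 ∷ 6 ∷ 7 ∷ [])))
  }
  where
  c : ∀ y → y ℤ.+ (- (+ 1 ℤ.+ y) ℤ.+ (- (+ 2 ℤ.+ y) ℤ.+ (+ 3 ℤ.+ y ℤ.+ 0ℤ))) ≡ 0ℤ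
  c = ℤ-Ring.solve-∀
  c' : ∀ y → - y ℤ.+ (+ 1 ℤ.+ y ℤ.+ (+ 2 ℤ.+ y ℤ.+ (- (+ 3 ℤ.+ y) ℤ.+ 0ℤ))) ≡ 0ℤ
  c' = ℤ-Ring.solve-∀

tile₄₂ : ∀ y → ZeroSum 4 2 (pm (iv y 4))
tile₄₂ y = record
  { entry = matrix ((+ y ∷ - (+ y) ∷ []) ∷ (- (+ 1 ℤ.+ + y) ∷ + 1 ℤ.+ + y ∷ []) ∷ (- (+ 2 ℤ.+ + y) ∷ + 2 ℤ.+ + y ∷ []) ∷ (+ 3 ℤ.+ + y ∷ - (+ 3 ℤ.+ + y) ∷ []) ∷ [])
  ; row-zero = λ { 0F → x-x (+ y) ; 1F → -x+x (+ 1 ℤ.+ + y) ; 2F → -x+x (+ 2 ℤ.+ + y) ; 3F → x-x (+ 3 ℤ.+ + y) }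
  ; col-zero = λ { 0F → c (+ y) ; 1F → c' (+ y) }
  ; entries-↭ = map⁺ (env (pm (iv y 4))) (from-just (permutation? (0 ∷ 1 ∷ 3 ∷ 2 ∷ 5 ∷ 4 ∷ 6 ∷ 7 ∷ []) (0 ∷ 1 ∷ 2 ∷ 3 ∷ 4 ∷ 5 ∷ 6 ∷ 7 ∷ [])))
  }
  where
  c : ∀ y → y ℤ.+ (- (+ 1 ℤ.+ y) ℤ.+ (- (+ 2 ℤ.+ y) ℤ.+ (+ 3 ℤ.+ y ℤ.+ 0ℤ))) ≡ 0ℤ
  c = ℤ-Ring.solve-∀
  c' : ∀ y → - y ℤ.+ (+ 1 ℤ.+ y ℤ.+ (+ 2 ℤ.+ y ℤ.+ (- (+ 3 ℤ.+ y) ℤ.+ 0ℤ))) ≡ 0ℤ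
  c' = ℤ-Ring.solve-∀

-- Built on the triples (1, Q+1, Q+2), (3, Q, Q+3), (2, G, G+2) and the midpoint G+1 of the last.
core : ∀ Q G → ZeroSum 3 7 (0ℤ ∷ pm (iv 1 3 ++ iv Q 4 ++ iv G 3))
core Q G = record
  { entry = matrix ((+ 1 ℤ.+ + G ∷ - (+ 2 ℤ.+ + G) ∷ - (+ 2) ∷ - (+ 2 ℤ.+ + Q) ∷ - (+ 1) ∷ + 3 ℤ.+ + Q ∷ + 3 ∷ [])
                  ∷ (0ℤ ∷ + G ∷ - (+ G) ∷ + 1 ℤ.+ + Q ∷ - (+ 1 ℤ.+ + Q) ∷ - (+ Q) ∷ + Q ∷ [])
                  ∷ (- (+ 1 ℤ.+ + G) ∷ + 2 ∷ + 2 ℤ.+ + G ∷ + 1 ∷ + 2 ℤ.+ + Q ∷ - (+ 3) ∷ - (+ 3 ℤ.+ + Q) ∷ []) ∷ [])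
  ; row-zero = λ { 0F → r₀ (+ Q) (+ G) ; 1F → r₁ (+ Q) (+ G) ; 2F → r₂ (+ Q) (+ G) }
  ; col-zero = λ { 0F → c₀ (+ G) ; 1F → c₁ (+ G) ; 2F → c₂ (+ G) ; 3F → c₃ (+ Q) ; 4F → c₄ (+ Q) ; 5F → c₅ (+ Q) ; 6F → c₆ (+ Q) }
  ; entries-↭ = map⁺ (env (0ℤ ∷ pm (iv 1 3 ++ iv Q 4 ++ iv G 3)))
      (from-just (permutation? (17 ∷ 20 ∷ 4 ∷ 12 ∷ 2 ∷ 13 ∷ 5 ∷ 0 ∷ 15 ∷ 16 ∷ 9 ∷ 10 ∷ 8 ∷ 7 ∷ 18 ∷ 3 ∷ 19 ∷ 1 ∷ 11 ∷ 6 ∷ 14 ∷ []) (iv 0 21)))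
  }
  where
  r₀ : ∀ Q G → + 1 ℤ.+ G ℤ.+ (- (+ 2 ℤ.+ G) ℤ.+ (- (+ 2) ℤ.+ (- (+ 2 ℤ.+ Q) ℤ.+ (- (+ 1) ℤ.+ (+ 3 ℤ.+ Q ℤ.+ (+ 3 ℤ.+ 0ℤ)))))) ≡ 0ℤ
  r₀ = ℤ-Ring.solve-∀
  r₁ : ∀ Q G → 0ℤ ℤ.+ (G ℤ.+ (- G ℤ.+ (+ 1 ℤ.+ Q ℤ.+ (- (+ 1 ℤ.+ Q) ℤ.+ (- Q ℤ.+ (Q ℤ.+ 0ℤ)))))) ≡ 0ℤ
  r₁ = ℤ-Ring.solve-∀
  r₂ : ∀ Q G → - (+ 1 ℤ.+ G) ℤ.+ (+ 2 ℤ.+ (+ 2 ℤ.+ G ℤ.+ (+ 1 ℤ.+ (+ 2 ℤ.+ Q ℤ.+ (- (+ 3) ℤ.+ (- (+ 3 ℤ.+ Q) ℤ.+ 0ℤ)))))) ≡ 0ℤ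
  r₂ = ℤ-Ring.solve-∀
  c₀ : ∀ G → + 1 ℤ.+ G ℤ.+ (0ℤ ℤ.+ (- (+ 1 ℤ.+ G) ℤ.+ 0ℤ)) ≡ 0ℤ
  c₀ = ℤ-Ring.solve-∀
  c₁ : ∀ G → - (+ 2 ℤ.+ G) ℤ.+ (G ℤ.+ (+ 2 ℤ.+ 0ℤ)) ≡ 0ℤ
  c₁ = ℤ-Ring.solve-∀
  c₂ : ∀ G → - (+ 2) ℤ.+ (- G ℤ.+ (+ 2 ℤ.+ G ℤ.+ 0ℤ)) ≡ 0ℤ
  c₂ = ℤ-Ring.solve-∀
  c₃ : ∀ Q → - (+ 2 ℤ.+ Q) ℤ.+ (+ 1 ℤ.+ Q ℤ.+ (+ 1 ℤ.+ 0ℤ)) ≡ 0ℤ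
  c₃ = ℤ-Ring.solve-∀
  c₄ : ∀ Q → - (+ 1) ℤ.+ (- (+ 1 ℤ.+ Q) ℤ.+ (+ 2 ℤ.+ Q ℤ.+ 0ℤ)) ≡ 0ℤ
  c₄ = ℤ-Ring.solve-∀
  c₅ : ∀ Q → + 3 ℤ.+ Q ℤ.+ (- Q ℤ.+ (- (+ 3) ℤ.+ 0ℤ)) ≡ 0ℤ
  c₅ = ℤ-Ring.solve-∀
  c₆ : ∀ Q → + 3 ℤ.+ (Q ℤ.+ (- (+ 3 ℤ.+ Q) ℤ.+ 0ℤ)) ≡ 0ℤ
  c₆ = ℤ-Ring.solve-∀

-- The general construction starts from a core with seven columns, and here neither side is that
-- long.
rectangle₃₅ : ZeroSum 3 5 (0ℤ ∷ pm (iv 1 7))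
rectangle₃₅ = record
  { entry = matrix ((- (+ 7) ∷ - (+ 6) ∷ + 3 ∷ + 4 ∷ + 6 ∷ []) ∷ (+ 0 ∷ + 1 ∷ + 2 ∷ - (+ 1) ∷ - (+ 2) ∷ [])
                  ∷ (+ 7 ∷ + 5 ∷ - (+ 5) ∷ - (+ 3) ∷ - (+ 4) ∷ []) ∷ [])
  ; row-zero = λ { 0F → refl ; 1F → refl ; 2F → refl }
  ; col-zero = λ { 0F → refl ; 1F → refl ; 2F → refl ; 3F → refl ; 4F → refl }
  ; entries-↭ = map⁺ (env (0ℤ ∷ pm (iv 1 7))) (from-just (permutation?
      (14 ∷ 12 ∷ 5 ∷ 7 ∷ 11 ∷ 0 ∷ 1 ∷ 3 ∷ 2 ∷ 4 ∷ 13 ∷ 9 ∷ 10 ∷ 6 ∷ 8 ∷ []) (iv 0 15)))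
  }

-- Rows assembled from blocks

iv-++ : ∀ y m n → iv y (m + n) ≡ iv y m ++ iv (m + y) n
iv-++ y zero    n = refl
iv-++ y (suc m) n = cong (y ∷_) (trans (iv-++ (suc y) m n) (cong (λ z → iv (suc y) m ++ iv z n) (+-suc m y)))

iv-∷ʳ : ∀ y n → iv y (suc n) ≡ iv y n ++ (n + y ∷ [])
iv-∷ʳ y n = trans (cong (iv y) (+-comm 1 n)) (iv-++ y n 1)

-- (x , u) stands for the triple x, u, x + u.
tri : ℕ × ℕ → List ℕ
tri (x , u) = x ∷ u ∷ x + u ∷ []

tris : List (ℕ × ℕ) → List ℕ
tris = concatMap tri

empty : ∀ {s} → ZeroSum 0 s []
empty = record { entry = λ () ; row-zero = λ () ; col-zero = λ _ → refl ; entries-↭ = ↭-refl }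

strips : ∀ η ts → length ts ≡ η → ZeroSum 3 (η * 2) (pm (tris ts))
strips zero    []             refl = record { entry = λ _ () ; row-zero = λ _ → refl ; col-zero = λ () ; entries-↭ = ↭-refl }
strips (suc η) ((x , u) ∷ ts) e    = beside (strip₃₂ x u) (strips η ts (suc-injective e))

tiles₂₄ : ∀ τ y → ZeroSum 2 (τ * 4) (pm (iv y (τ * 4)))
tiles₂₄ zero    y = record { entry = λ _ () ; row-zero = λ _ → refl ; col-zero = λ () ; entries-↭ = ↭-refl }
tiles₂₄ (suc τ) y = beside (tile₂₄ y) (tiles₂₄ τ (4 + y))

tiles₄₂ : ∀ τ y → ZeroSum 4 (τ * 2) (pm (iv y (τ * 4)))
tiles₄₂ zero    y = record { entry = λ _ () ; row-zero = λ _ → refl ; col-zero = λ () ; entries-↭ = ↭-refl }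
tiles₄₂ (suc τ) y = beside (tile₄₂ y) (tiles₄₂ τ (4 + y))

beside-pm : ∀ {k s s'} xs ys → ZeroSum k s (pm xs) → ZeroSum k s' (pm ys) → ZeroSum k (s + s') (pm (xs ++ ys))
beside-pm xs ys A B = relabel (↭-reflexive (sym (pm-++ xs ys))) (beside A B)

stack-pm : ∀ {k k' s} xs ys → ZeroSum k s (pm xs) → ZeroSum k' s (pm ys) → ZeroSum (k + k') s (pm (xs ++ ys))
stack-pm xs ys A B = relabel (↭-reflexive (sym (pm-++ xs ys))) (stack A B)

-- Each pair of rows has one triple in its first three columns and tiles in the others; consecutive
-- labels are used up pair by pair.
row-pairs : ∀ τ v ts y → length ts ≡ v → ZeroSum (v * 2) (3 + τ * 4) (pm (tris ts ++ iv y (v * (τ * 4))))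
row-pairs τ zero    []             y e = empty
row-pairs τ (suc v) ((x , u) ∷ ts) y e = relabel (pm-↭ (↭-trans
    (solve 4 (λ a b c d → ((a ⊕ b) ⊕ (c ⊕ d)) ⊜ ((a ⊕ c) ⊕ (b ⊕ d))) ↭-refl (tri (x , u)) now (tris ts) later)
    (++⁺ˡ (tri (x , u) ++ tris ts) (↭-reflexive (sym (iv-++ y (τ * 4) (v * (τ * 4))))))))
  (stack-pm (tri (x , u) ++ now) (tris ts ++ later) (beside-pm (tri (x , u)) now (strip₂₃ x u) (tiles₂₄ τ y))
            (row-pairs τ v ts (τ * 4 + y) (suc-injective e)))
  where
  now = iv y (τ * 4)
  later = iv (τ * 4 + y) (v * (τ * 4))

-- Tiles of height four need only an even width beyond the first three columns, whereas those of
-- height two need a multiple of 4.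
row-quads : ∀ τ κ ts y → length ts ≡ κ * 2 → ZeroSum (κ * 4) (3 + τ * 2) (pm (tris ts ++ iv y (κ * (τ * 4))))
row-quads τ zero    []                         y e = empty
row-quads τ (suc κ) ((x , u) ∷ (x' , u') ∷ ts) y e = relabel (pm-↭ (↭-trans
    (solve 5 (λ a a' b c d → (((a ⊕ a') ⊕ b) ⊕ (c ⊕ d)) ⊜ ((a ⊕ (a' ⊕ c)) ⊕ (b ⊕ d))) ↭-refl (tri (x , u)) (tri (x' , u')) now (tris ts) later)
    (++⁺ˡ (tri (x , u) ++ (tri (x' , u') ++ tris ts)) (↭-reflexive (sym (iv-++ y (τ * 4) (κ * (τ * 4))))))))
  (stack-pm ((tri (x , u) ++ tri (x' , u')) ++ now) (tris ts ++ later)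
    (beside-pm (tri (x , u) ++ tri (x' , u')) now (stack-pm (tri (x , u)) (tri (x' , u')) (strip₂₃ x u) (strip₂₃ x' u')) (tiles₄₂ τ y))
    (row-quads τ κ ts (τ * 4 + y) (suc-injective (suc-injective e))))
  where
  now = iv y (τ * 4)
  later = iv (τ * 4 + y) (κ * (τ * 4))

-- Nested pairs and their differences

-- p nested pairs around an interval of c numbers fill an interval of size c p numbers; the first
-- component of a triple is the difference of its pair.
size : ℕ → ℕ → ℕ
size c zero    = c
size c (suc p) = suc (suc (size c p))

nest : ℕ → ℕ → ℕ → List (ℕ × ℕ)
nest c zero    y = []
nest c (suc p) y = (suc (size c p) , y) ∷ nest c p (suc y)

gaps : ℕ → ℕ → List ℕ
gaps c zero    = []
gaps c (suc p) = suc (size c p) ∷ gaps c p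

length-nest : ∀ c p y → length (nest c p y) ≡ p
length-nest c zero    y = refl
length-nest c (suc p) y = cong suc (length-nest c p (suc y))

-- The third number x + u of a triple is the upper end of the pair whose lower end is u, so the
-- pairs close up around the centre to an interval and only the differences are left over.
nest-↭ : ∀ c p y → tris (nest c p y) ++ iv (p + y) c ↭ gaps c p ++ iv y (size c p)
nest-↭ c zero    y = ↭-refl
nest-↭ c (suc p) y = prep _ (↭-trans
  (prep y (↭-trans (↭-reflexive (cong (λ z → suc (size c p + y) ∷ tris (nest c p (suc y)) ++ iv z c) (sym (+-suc p y))))
                   (prep _ (nest-↭ c p (suc y)))))
  (↭-trans (solve 4 (λ a b c d → (a ⊕ (b ⊕ (c ⊕ d))) ⊜ (c ⊕ (a ⊕ (d ⊕ b)))) ↭-refl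
             (y ∷ []) (suc (size c p + y) ∷ []) (gaps c p) (iv (suc y) (size c p)))
           (++⁺ˡ (gaps c p) (prep y (↭-reflexive (trans (cong (λ z → iv (suc y) (size c p) ++ (z ∷ [])) (sym (+-suc (size c p) y)))
             (sym (iv-∷ʳ (suc y) (size c p)))))))))

size-* : ∀ c p → size c p ≡ p * 2 + c
size-* c zero    = refl
size-* c (suc p) = cong (suc ∘ suc) (size-* c p)

-- The differences 5, 7, ... around four numbers and 4, 6, ... around three interleave; equal
-- lengths, or one more pair around three, leave no hole.
gaps-even : ∀ p → gaps 4 p ++ gaps 3 p ↭ iv 4 (p * 2)
gaps-odd : ∀ p → gaps 4 p ++ gaps 3 (suc p) ↭ iv 4 (suc (p * 2))

gaps-odd p = ↭-trans (move-to-front (suc (size 3 p)) (gaps 4 p) (gaps 3 p)) (↭-trans (prep _ (gaps-even p))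
  (↭-trans (solve 2 (λ a b → (a ⊕ b) ⊜ (b ⊕ a)) ↭-refl (suc (size 3 p) ∷ []) (iv 4 (p * 2)))
    (↭-reflexive (trans (cong (λ z → iv 4 (p * 2) ++ (z ∷ [])) (trans (cong suc (size-* 3 p)) (sym (+-suc (p * 2) 3))))
      (sym (iv-∷ʳ 4 (p * 2)))))))
gaps-even zero    = ↭-refl
gaps-even (suc p) = ↭-trans (prep _ (gaps-odd p))
  (↭-trans (solve 2 (λ a b → (a ⊕ b) ⊜ (b ⊕ a)) ↭-refl (suc (size 4 p) ∷ []) (iv 4 (suc (p * 2))))
    (↭-reflexive (trans (cong (λ z → iv 4 (suc (p * 2)) ++ (z ∷ [])) (cong suc (size-* 4 p)))
      (sym (iv-∷ʳ 4 (suc (p * 2)))))))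

-- Zero-sum rectangles on -M, ..., M

MagicRectangle : ℕ → ℕ → Set
MagicRectangle k s = ∃ λ M → ZeroSum k s (0ℤ ∷ pm (iv 1 M))

coreLabels : ℕ → ℕ → List ℕ
coreLabels Q G = iv 1 3 ++ (iv Q 4 ++ iv G 3)

-- In increasing order: 1, 2, 3 for the core, the k differences from 4 on, the interval of the first
-- nest from y₁ on, and that of the second from y₂ on. The core also takes the centres of both
-- nests.
nested-labels : ∀ p q k → gaps 4 p ++ gaps 3 q ↭ iv 4 k → let y₁ = k + 4 ; y₂ = size 4 p + y₁ in
  coreLabels (p + y₁) (q + y₂) ++ (tris (nest 4 p y₁) ++ tris (nest 3 q y₂)) ↭ iv 1 (3 + (k + (size 4 p + size 3 q)))
nested-labels p q k g = ↭-trans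
  (solve 5 (λ a b c d e → ((a ⊕ (b ⊕ c)) ⊕ (d ⊕ e)) ⊜ (a ⊕ ((d ⊕ b) ⊕ (e ⊕ c)))) ↭-refl
     (iv 1 3) (iv (p + y₁) 4) (iv (q + y₂) 3) (tris (nest 4 p y₁)) (tris (nest 3 q y₂)))
  (++⁺ˡ (iv 1 3) (↭-trans (++⁺ (nest-↭ 4 p y₁) (nest-↭ 3 q y₂)) (↭-trans
     (solve 4 (λ a b c d → ((a ⊕ b) ⊕ (c ⊕ d)) ⊜ ((a ⊕ c) ⊕ (b ⊕ d))) ↭-refl (gaps 4 p) (iv y₁ (size 4 p)) (gaps 3 q) (iv y₂ (size 3 q)))
     (↭-trans (++⁺ʳ _ g) (↭-reflexive (sym (trans (iv-++ 4 k (size 4 p + size 3 q)) (cong (iv 4 k ++_) (iv-++ y₁ (size 4 p) (size 3 q))))))))))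
  where
  y₁ = k + 4
  y₂ = size 4 p + y₁

-- As nested-labels, except that the outermost triple x, y₂, x + y₂ around the midpoint is replaced
-- by x - 1, y₂, x + y₂.
shifted-labels : ∀ p → let y₁ = suc p * 2 + 4 ; y₂ = size 4 p + y₁ ; X = size 3 (suc p) in
  coreLabels (p + y₁) (suc (suc p) + y₂) ++ ((X ∷ y₂ ∷ 1 + X + y₂ ∷ []) ++ (tris (nest 4 p y₁) ++ tris (nest 3 (suc p) (suc y₂)))) ↭
  iv 1 (3 + (suc p * 2 + (size 4 p + size 3 (suc (suc p)))))
shifted-labels p = ↭-trans
  (solve 7 (λ a b c x y d e → ((a ⊕ (b ⊕ c)) ⊕ ((x ⊕ y) ⊕ (d ⊕ e))) ⊜ (a ⊕ ((d ⊕ b) ⊕ (x ⊕ ((y ⊕ e) ⊕ c))))) ↭-refl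
     (iv 1 3) (iv (p + y₁) 4) (iv (suc (suc p) + y₂) 3) (X ∷ []) (y₂ ∷ 1 + X + y₂ ∷ []) (tris (nest 4 p y₁)) (tris (nest 3 (suc p) (suc y₂))))
  (++⁺ˡ (iv 1 3) (↭-trans (++⁺ (nest-↭ 4 p y₁) (prep X (drop-∷ (nest-↭ 3 (suc (suc p)) y₂)))) (↭-trans
     (solve 5 (λ a b x c d → ((a ⊕ b) ⊕ (x ⊕ (c ⊕ d))) ⊜ ((x ⊕ (a ⊕ c)) ⊕ (b ⊕ d))) ↭-refl (gaps 4 p) (iv y₁ (size 4 p)) (X ∷ []) (gaps 3 (suc p)) (iv y₂ (size 3 (suc (suc p)))))
     (↭-trans (++⁺ʳ _ g) (↭-reflexive (sym (trans (iv-++ 4 (suc p * 2) (size 4 p + size 3 (suc (suc p))))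
       (cong (iv 4 (suc p * 2) ++_) (iv-++ y₁ (size 4 p) (size 3 (suc (suc p))))))))))))
  where
  y₁ = suc p * 2 + 4
  y₂ = size 4 p + y₁
  X  = size 3 (suc p)
  -- With p and p + 2 pairs the differences would be 4, ..., 2p + 4 and 2p + 6; lowering the last by
  -- one supplies the missing 2p + 5.
  X≡ : X ≡ suc (size 4 p)
  X≡ = cong suc (trans (cong suc (size-* 3 p)) (trans (sym (+-suc (p * 2) 3)) (sym (size-* 4 p))))
  g : (X ∷ []) ++ (gaps 4 p ++ gaps 3 (suc p)) ↭ iv 4 (suc p * 2)
  g = ↭-trans (↭-reflexive (cong (λ z → z ∷ (gaps 4 p ++ gaps 3 (suc p))) X≡)) (gaps-even (suc p))

split-list : ∀ {X : Set} a {b} (xs : List X) → length xs ≡ a + b → ∃₂ λ ys zs → xs ≡ ys ++ zs × length ys ≡ a × length zs ≡ b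
split-list zero    xs       e = [] , xs , refl , refl , e
split-list (suc a) (x ∷ xs) e with split-list a xs (suc-injective e)
... | ys , zs , refl , p , q = x ∷ ys , zs , refl , cong suc p , q

top-and-bottom : ∀ Q G η hs → length hs ≡ η → ∀ {k} ls M → ZeroSum k (7 + η * 2) (pm ls) →
  (coreLabels Q G ++ tris hs) ++ ls ↭ iv 1 M → MagicRectangle (3 + k) (7 + η * 2)
top-and-bottom Q G η hs e ls M B p = M , relabel
  (prep 0ℤ (↭-trans (↭-reflexive (sym (trans (pm-++ (coreLabels Q G ++ tris hs) ls) (cong (_++ pm ls) (pm-++ (coreLabels Q G) (tris hs)))))) (pm-↭ p)))
  (stack (beside (core Q G) (strips η hs e)) B)

-- Of the η + v triples, η go into strips beside the core and v into the rows below, which also take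
-- the next e labels.
rectangle : ∀ η v {k} e → (∀ ts y → length ts ≡ v → ZeroSum k (7 + η * 2) (pm (tris ts ++ iv y e))) →
            MagicRectangle (3 + k) (7 + η * 2)
rectangle η v e bottom = from-nests (two-nests (parity (η + v)))
  where
  two-nests : ∀ {N} → Parity N → Σ ℕ λ p → Σ ℕ λ q → Σ ℕ λ k → p + q ≡ N × gaps 4 p ++ gaps 3 q ↭ iv 4 k
  two-nests (even r) = r , r , r * 2 , refl , gaps-even r
  two-nests (odd r)  = r , suc r , suc (r * 2) , +-suc r r , gaps-odd r

  from-nests : (Σ ℕ λ p → Σ ℕ λ q → Σ ℕ λ k → p + q ≡ η + v × gaps 4 p ++ gaps 3 q ↭ iv 4 k) → _
  from-nests (p , q , k , p+q , g) with split-list η (nest 4 p (k + 4) ++ nest 3 q (size 4 p + (k + 4)))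
    (trans (length-++ (nest 4 p _)) (trans (cong₂ _+_ (length-nest 4 p _) (length-nest 3 q _)) p+q))
  ... | hs , ts , hs++ts , lh , lt = top-and-bottom Q G η hs lh (tris ts ++ iv (A + 1) e) (A + e) (bottom ts (A + 1) lt)
      (↭-trans (solve 4 (λ a b c d → ((a ⊕ b) ⊕ (c ⊕ d)) ⊜ ((a ⊕ (b ⊕ c)) ⊕ d)) ↭-refl (coreLabels Q G) (tris hs) (tris ts) (iv (A + 1) e))
      (↭-trans (++⁺ʳ _ (↭-trans (++⁺ˡ (coreLabels Q G) (↭-reflexive lists)) (nested-labels p q k g))) (↭-reflexive (sym (iv-++ 1 A e)))))
    where
    y₁ = k + 4
    y₂ = size 4 p + y₁
    Q = p + y₁
    G = q + y₂
    A = 3 + (k + (size 4 p + size 3 q))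
    lists : tris hs ++ tris ts ≡ tris (nest 4 p y₁) ++ tris (nest 3 q y₂)
    lists = trans (sym (concatMap-++ tri hs ts)) (trans (cong tris (sym hs++ts)) (concatMap-++ tri (nest 4 p y₁) (nest 3 q y₂)))

-- Here the width beyond the first three columns is 4(σ + 1), so the tiles of height two fill each
-- pair of lower rows.
rectangle-3mod4 : ∀ v σ → MagicRectangle (3 + v * 2) (7 + σ * 4)
rectangle-3mod4 v σ = subst (λ z → MagicRectangle (3 + v * 2) (7 + z)) (*-assoc σ 2 2)
  (rectangle (σ * 2) v (v * (suc σ * 4)) λ ts y e →
    subst (λ z → ZeroSum (v * 2) (7 + z) (pm (tris ts ++ iv y (v * (suc σ * 4))))) (sym (*-assoc σ 2 2)) (row-pairs (suc σ) v ts y e))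

rectangle-three : ∀ η → MagicRectangle 3 (7 + η * 2)
rectangle-three η = rectangle η 0 0 λ { [] y e → empty }

-- Consecutive labels off the first three rows and columns would have an odd sum, so pairs ±x could not
-- balance the rows there; hence one strip of five columns.
rectangle-1mod4 : ∀ κ σ → MagicRectangle (5 + κ * 4) (9 + σ * 4)
rectangle-1mod4 κ σ = subst (λ z → MagicRectangle (5 + κ * 4) (9 + z)) (*-assoc σ 2 2) rect
  where
  -- The 1 + 2σ strips beside the core and the two triples in each of the κ quadruples of rows make
  -- p + (p + 1) triples, besides the altered one.
  p = σ + κ
  y₁ = suc p * 2 + 4
  y₂ = size 4 p + y₁
  X = size 3 (suc p)
  Q = p + y₁
  G = suc (suc p) + y₂
  A = 3 + (suc p * 2 + (size 4 p + size 3 (suc (suc p))))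
  y = A + 1
  η = suc (σ * 2)
  τ = 3 + σ * 2
  e₁ = suc σ * 4
  e₂ = κ * (τ * 4)
  x-strip = X ∷ y₂ ∷ 1 + X + y₂ ∷ []

  lengths : length (nest 4 p y₁ ++ nest 3 (suc p) (suc y₂)) ≡ η + κ * 2
  lengths = trans (length-++ (nest 4 p y₁)) (trans (cong₂ _+_ (length-nest 4 p y₁) (length-nest 3 (suc p) (suc y₂))) (ring σ κ))
    where
    ring : ∀ σ κ → (σ + κ) + suc (σ + κ) ≡ suc (σ * 2) + κ * 2
    ring = solve-∀

  pair : ZeroSum 2 (9 + σ * 2 * 2) (pm ((x-strip ++ iv y 2) ++ iv (2 + y) e₁))
  pair = subst (λ z → ZeroSum 2 (9 + z) (pm ((x-strip ++ iv y 2) ++ iv (2 + y) e₁))) (sym (*-assoc σ 2 2))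
    (beside-pm (x-strip ++ iv y 2) (iv (2 + y) e₁) (strip₂₅ X y₂ y) (tiles₂₄ (suc σ) (2 + y)))

  rect : MagicRectangle (5 + κ * 4) (9 + σ * 2 * 2)
  rect with split-list η (nest 4 p y₁ ++ nest 3 (suc p) (suc y₂)) lengths
  ... | hs , ts , hs++ts , lh , lt = top-and-bottom Q G η hs lh _ (A + (2 + (e₁ + e₂)))
      (stack-pm ((x-strip ++ iv y 2) ++ iv (2 + y) e₁) (tris ts ++ iv (e₁ + (2 + y)) e₂) pair (row-quads τ κ ts (e₁ + (2 + y)) lt))
      (↭-trans (solve 7 (λ a b x i j c d → ((a ⊕ b) ⊕ (((x ⊕ i) ⊕ j) ⊕ (c ⊕ d))) ⊜ ((a ⊕ (x ⊕ (b ⊕ c))) ⊕ (i ⊕ (j ⊕ d)))) ↭-refl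
          (coreLabels Q G) (tris hs) x-strip (iv y 2) (iv (2 + y) e₁) (tris ts) (iv (e₁ + (2 + y)) e₂))
      (↭-trans (++⁺ (↭-trans (++⁺ˡ (coreLabels Q G) (++⁺ˡ x-strip (↭-reflexive lists))) (shifted-labels p))
                    (↭-reflexive (cong (iv y 2 ++_) (sym (iv-++ (2 + y) e₁ e₂)))))
               (↭-reflexive (sym (iv-++ 1 A (2 + (e₁ + e₂)))))))
    where
    lists : tris hs ++ tris ts ≡ tris (nest 4 p y₁) ++ tris (nest 3 (suc p) (suc y₂))
    lists = trans (sym (concatMap-++ tri hs ts)) (trans (cong tris (sym hs++ts)) (concatMap-++ tri (nest 4 p y₁) (nest 3 (suc p) (suc y₂))))

-- From one zero-sum rectangle to a set of copies

iv-∈⁺ : ∀ {v} y n → y ≤ v → v < n + y → v ∈ iv y n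
iv-∈⁺ y zero    p q = ⊥-elim (<-irrefl refl (<-≤-trans q p))
iv-∈⁺ {v} y (suc n) p q with m≤n⇒m<n∨m≡n p
... | inj₂ refl = here refl
... | inj₁ y<v  = there (iv-∈⁺ (suc y) n y<v (subst (v <_) (sym (+-suc n y)) q))

iv-< : ∀ y n → All (_< n + y) (iv y n)
iv-< y zero    = []
iv-< y (suc n) = s≤s (m≤n+m y n) ∷ subst (λ z → All (_< z) (iv (suc y) n)) (+-suc n y) (iv-< (suc y) n)

length-iv : ∀ y n → length (iv y n) ≡ n
length-iv y zero    = refl
length-iv y (suc n) = cong suc (length-iv (suc y) n)

length-pm : ∀ xs → length (pm xs) ≡ length xs * 2
length-pm []       = refl
length-pm (x ∷ xs) = cong (suc ∘ suc) (length-pm xs)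

length-entries : ∀ k s f → length (entries k s f) ≡ k * s
length-entries zero    s f = refl
length-entries (suc k) s f = trans (length-++ (tabulate (f 0F))) (cong₂ _+_ (length-tabulate (f 0F)) (length-entries k s (f ∘ Fin.suc)))

entries-∈⁺ : ∀ k s f i j → f i j ∈ entries k s f
entries-∈⁺ (suc k) s f Fin.zero    j = ∈-++⁺ˡ (∈-tabulate⁺ j)
entries-∈⁺ (suc k) s f (Fin.suc i) j = ∈-++⁺ʳ (tabulate (f 0F)) (entries-∈⁺ k s (f ∘ Fin.suc) i j)

entries-∈⁻ : ∀ k s f {z} → z ∈ entries k s f → ∃₂ λ i j → z ≡ f i j
entries-∈⁻ (suc k) s f z∈ with ∈-++⁻ (tabulate (f 0F)) z∈
... | inj₁ p = let (j , e) = ∈-tabulate⁻ p in 0F , j , e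
... | inj₂ p = let (i , j , e) = entries-∈⁻ k s (f ∘ Fin.suc) p in Fin.suc i , j , e

translate : ℕ → ℤ → ℕ
translate M z = ℤ.∣ z ℤ.+ + M ∣

cancel : ∀ x r → - x ℤ.+ (x ℤ.+ r) ≡ r
cancel = ℤ-Ring.solve-∀

-- Induction peels off the outermost pair ±j, which lands on the two ends of the interval; the lower
-- end r is left variable because it then moves up.
translate-↭ : ∀ j r → map (translate (j + r)) (pm (iv 1 j)) ++ (j + r ∷ []) ↭ iv r (suc (j + j))
translate-↭ zero    r = ↭-refl
translate-↭ (suc j) r = ↭-trans (↭-reflexive (cong (λ z → map (translate (suc j + r)) z ++ (suc j + r ∷ []))
      (trans (cong pm (iv-∷ʳ 1 j)) (pm-++ (iv 1 j) (j + 1 ∷ [])))))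
  (↭-trans (↭-reflexive (cong (_++ (suc j + r ∷ [])) (map-++ (translate (suc j + r)) (pm (iv 1 j)) (pm (j + 1 ∷ [])))))
  (↭-trans (solve 4 (λ a b c d → ((a ⊕ (b ⊕ c)) ⊕ d) ⊜ (c ⊕ ((a ⊕ d) ⊕ b))) ↭-refl
     (map (translate (suc j + r)) (pm (iv 1 j))) (j + 1 + (suc j + r) ∷ []) (translate (suc j + r) (- (+ (j + 1))) ∷ []) (suc j + r ∷ []))
  (↭-trans (↭-reflexive (cong₂ (λ a b → a ∷ (map (translate b) (pm (iv 1 j)) ++ (b ∷ [])) ++ (j + 1 + b ∷ [])) low (sym (+-suc j r))))
  (prep r (↭-trans (++⁺ʳ _ (translate-↭ j (suc r))) (↭-reflexive (trans
     (cong (λ z → iv (suc r) (suc (j + j)) ++ (z ∷ [])) (high j r))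
     (trans (sym (iv-∷ʳ (suc r) (suc (j + j)))) (cong (λ z → iv (suc r) (suc z)) (sym (+-suc j j)))))))))))
  where
  low : translate (suc j + r) (- (+ (j + 1))) ≡ r
  low = trans (cong (λ z → ℤ.∣ - (+ z) ℤ.+ + (suc j + r) ∣) (+-comm j 1)) (cong ℤ.∣_∣ (cancel (+ suc j) (+ r)))
  high : ∀ j r → j + 1 + (j + suc r) ≡ suc (j + j) + suc r
  high = solve-∀

translate-all : ∀ M → All (λ z → + translate M z ≡ z ℤ.+ + M) (0ℤ ∷ pm (iv 1 M))
translate-all M = refl ∷ go (iv 1 M) (All.map (λ {x} p → ≤-pred (subst (x <_) (+-comm M 1) p)) (iv-< 1 M))
  where
  go : ∀ xs → All (_≤ M) xs → All (λ z → + translate M z ≡ z ℤ.+ + M) (pm xs)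
  go []       []       = []
  go (x ∷ xs) (p ∷ ps) with m≤n⇒∃[o]m+o≡n p
  ... | o , refl = refl ∷ trans (cong (λ z → + ℤ.∣ z ∣) (cancel (+ x) (+ o))) (sym (cancel (+ x) (+ o))) ∷ go xs ps

∑ᶻ-shift : ∀ s (f : Fin s → ℤ) (a : Fin s → ℕ) M → (∀ j → + a j ≡ f j ℤ.+ + M) → + ∑ s a ≡ ∑ᶻ s f ℤ.+ + (s * M)
∑ᶻ-shift zero    f a M e = refl
∑ᶻ-shift (suc s) f a M e = trans (cong₂ ℤ._+_ (e 0F) (∑ᶻ-shift s (f ∘ Fin.suc) (a ∘ Fin.suc) M (e ∘ Fin.suc)))
  (interchange (f 0F) (+ M) (∑ᶻ s (f ∘ Fin.suc)) (+ (s * M)))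
  where
  interchange : ∀ a b c d → (a ℤ.+ b) ℤ.+ (c ℤ.+ d) ≡ (a ℤ.+ c) ℤ.+ (b ℤ.+ d)
  interchange = ℤ-Ring.solve-∀

module FromZeroSum {k s M : ℕ} (A : ZeroSum k s (0ℤ ∷ pm (iv 1 M))) where
  ks≡ : suc (M + M) ≡ k * s
  ks≡ = trans (cong suc (trans (double M) (trans (cong (_* 2) (sym (length-iv 1 M))) (sym (length-pm (iv 1 M))))))
              (trans (sym (↭-length (entries-↭ A))) (length-entries k s (entry A)))
    where
    double : ∀ M → M + M ≡ M * 2
    double = solve-∀

  labels-↭ : map (translate M) (entries k s (entry A)) ↭ iv 0 (k * s)
  labels-↭ = ↭-trans (map⁺ (translate M) (entries-↭ A)) (↭-trans
    (solve 2 (λ a b → (a ⊕ b) ⊜ (b ⊕ a)) ↭-refl (M ∷ []) (map (translate M) (pm (iv 1 M))))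
    (subst₂ (λ a b → map (translate a) (pm (iv 1 M)) ++ (a ∷ []) ↭ iv 0 b) (+-identityʳ M) ks≡ (translate-↭ M 0)))

  label< : ∀ i j → translate M (entry A i j) < k * s
  label< i j = subst (translate M (entry A i j) <_) (+-identityʳ (k * s))
    (All.lookup (iv-< 0 (k * s)) (∈-resp-↭ labels-↭ (∈-map⁺ (translate M) (entries-∈⁺ k s (entry A) i j))))

  r : Fin k → Fin s → Fin (k * s)
  r i j = fromℕ< (label< i j)

  r-shift : ∀ i j → + toℕ (r i j) ≡ entry A i j ℤ.+ + M
  r-shift i j = trans (cong +_ (toℕ-fromℕ< (label< i j)))
    (All.lookup (translate-all M) (∈-resp-↭ (entries-↭ A) (entries-∈⁺ k s (entry A) i j)))

  r-row : ∀ i → ∑ s (λ j → toℕ (r i j)) ≡ s * M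
  r-row i = ℤ.+-injective (trans (∑ᶻ-shift s (entry A i) _ M (r-shift i)) (trans (cong (ℤ._+ + (s * M)) (row-zero A i)) (ℤ.+-identityˡ _)))

  r-col : ∀ j → ∑ k (λ i → toℕ (r i j)) ≡ k * M
  r-col j = ℤ.+-injective (trans (∑ᶻ-shift k (λ i → entry A i j) _ M (λ i → r-shift i j)) (trans (cong (ℤ._+ + (k * M)) (col-zero A j)) (ℤ.+-identityˡ _)))

  r′ : Fin (k * s) → Fin (k * s)
  r′ P = r (proj₁ (remQuot {k} s P)) (proj₂ (remQuot {k} s P))

  -- The permutation of lists shows that every label occurs; since there are as many cells as
  -- labels, none occurs twice.
  r′-surj : ∀ v → ∃ λ P → r′ P ≡ v
  r′-surj v with ∈-map⁻ (translate M) (∈-resp-↭ (↭-sym labels-↭) (iv-∈⁺ 0 (k * s) z≤n (subst (toℕ v <_) (sym (+-identityʳ (k * s))) (toℕ<n v))))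
  ... | z , z∈ , e with entries-∈⁻ k s (entry A) z∈
  ... | i , j , refl = combine i j , toℕ-injective (trans
      (cong (λ z → toℕ (r (proj₁ z) (proj₂ z))) (remQuot-combine i j)) (trans (toℕ-fromℕ< (label< i j)) (sym e)))

surj⇒inj : ∀ {n} (f : Fin n → Fin n) → (∀ y → ∃ λ x → f x ≡ y) → ∀ {x y} → f x ≡ f y → x ≡ y
surj⇒inj f surj {x} {y} e with inj⇒surj g g-inj x | inj⇒surj g g-inj y
  where
  g = λ v → proj₁ (surj v)
  g-inj : ∀ {a b} → g a ≡ g b → a ≡ b
  g-inj {a} {b} p = trans (sym (proj₂ (surj a))) (trans (cong f p) (proj₂ (surj b)))
... | a , refl | b , refl = cong (λ v → proj₁ (surj v)) (trans (sym (proj₂ (surj a))) (trans e (proj₂ (surj b))))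

rectangle-copies : ∀ bk bs η → MagicRectangle (width bk) (width bs) →
                   MRSExists (width bk) (width bs) (width bs) (width bk) (suc (η + η))
rectangle-copies bk bs η (M , A) = MRS-fromCells (*-comm k s) record
  { ρ = i-of ; κ = j-of ; cell-inj = λ {P} {Q} → remQuot-injective k s {P} {Q}
  ; label = label ; label-inj = λ {t} {u} {P} {Q} → label-inj t u P Q
  ; ρ-count = λ i → trans (∑-remQuot k s (λ i' _ → δ i' i)) (trans (∑-cong k λ i' → trans (∑-const s (δ i' i)) (*-comm s _))
      (trans (∑-*ʳ k s (λ i' → δ i' i)) (trans (cong (_* s) (∑-δ-injective (λ x → x) (λ e → e) i)) (+-identityʳ s))))
  ; κ-count = λ j → trans (∑-remQuot k s (λ _ j' → δ j' j)) (trans (∑-cong k λ _ → ∑-δ-injective (λ x → x) (λ e → e) j)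
      (trans (∑-const k 1) (*-identityʳ k)))
  ; x = c * (s * M) + s * η ; y = c * (k * M) + k * η
  ; ρ-sum = ρ-sum ; κ-sum = κ-sum
  }
  where
  open FromZeroSum A
  open UnitAction η using (act; act-injective; ∑-act)
  k = width bk
  s = width bs
  c = suc (η + η)
  L = k * s

  i-of : Fin L → Fin k
  i-of P = proj₁ (remQuot {k} s P)
  j-of : Fin L → Fin s
  j-of P = proj₂ (remQuot {k} s P)

  unit : Fin k → Fin s → Unit
  unit i j = units bk i · units bs j

  lab : Fin c → Fin k → Fin s → Fin (L * c)
  lab t i j = combine (r i j) (act (unit i j) t)

  label : Fin c → Fin L → Fin (c * L)
  label t P = cast (*-comm L c) (lab t (i-of P) (j-of P))

  label-inj : ∀ t u P Q → label t P ≡ label u Q → t ≡ u × P ≡ Q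
  label-inj t u P Q e = act-injective (unit (i-of P) (j-of P)) (trans (proj₂ digits) (cong (λ z → act (unit (i-of z) (j-of z)) u) (sym P≡Q))) , P≡Q
    where
    digits : r′ P ≡ r′ Q × act (unit (i-of P) (j-of P)) t ≡ act (unit (i-of Q) (j-of Q)) u
    digits = combine-injective (r′ P) (act (unit (i-of P) (j-of P)) t) (r′ Q) (act (unit (i-of Q) (j-of Q)) u) (cast-injective (*-comm L c) e)
    P≡Q : P ≡ Q
    P≡Q = surj⇒inj r′ r′-surj (proj₁ digits)

  toℕ-label : ∀ t i j → toℕ (lab t i j) ≡ c * toℕ (r i j) + toℕ (act (unit i j) t)
  toℕ-label t i j = toℕ-combine (r i j) (act (unit i j) t)

  row : ∀ t i → ∑ s (λ j → toℕ (lab t i j)) ≡ c * (s * M) + s * η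
  row t i = trans (∑-cong s (toℕ-label t i)) (trans (∑-distrib-+ s (λ j → c * toℕ (r i j)) (λ j → toℕ (act (unit i j) t)))
    (cong₂ _+_ (trans (∑-*ˡ s c (λ j → toℕ (r i j))) (cong (c *_) (r-row i))) (∑-act bs (units bk i) t)))

  col : ∀ t j → ∑ k (λ i → toℕ (lab t i j)) ≡ c * (k * M) + k * η
  col t j = trans (∑-cong k (λ i → toℕ-label t i j)) (trans (∑-distrib-+ k (λ i → c * toℕ (r i j)) (λ i → toℕ (act (unit i j) t)))
    (cong₂ _+_ (trans (∑-*ˡ k c (λ i → toℕ (r i j))) (cong (c *_) (r-col j)))
      (trans (∑-cong k (λ i → cong (λ z → toℕ (act z t)) (·-comm (units bk i) (units bs j)))) (∑-act bk (units bs j) t))))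

  ρ-sum : ∀ t i → ∑ L (λ P → δ (i-of P) i * toℕ (label t P)) ≡ c * (s * M) + s * η
  ρ-sum t i = trans (∑-cong L λ P → cong (δ (i-of P) i *_) (toℕ-cast (*-comm L c) (lab t (i-of P) (j-of P))))
    (trans (∑-remQuot k s (λ i' j → δ i' i * toℕ (lab t i' j))) (trans
      (∑-cong k λ i' → trans (∑-*ˡ s (δ i' i) (λ j → toℕ (lab t i' j))) (cong₂ _*_ (δ-cong sym sym) (row t i')))
      (∑-δ k i (λ _ → c * (s * M) + s * η))))

  κ-sum : ∀ t j → ∑ L (λ P → δ (j-of P) j * toℕ (label t P)) ≡ c * (k * M) + k * η
  κ-sum t j = trans (∑-cong L λ P → cong (δ (j-of P) j *_) (toℕ-cast (*-comm L c) (lab t (i-of P) (j-of P))))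
    (trans (∑-remQuot k s (λ i j' → δ j' j * toℕ (lab t i j'))) (trans
      (∑-cong k λ i → trans (∑-cong s λ j' → cong (_* toℕ (lab t i j')) (δ-cong sym sym)) (∑-δ s j (λ j' → toℕ (lab t i j'))))
      (col t j)))

-- The theorem

-- `width b` is 3 modulo 4 for even b and 1 for odd b. A side that is 3 modulo 4 and at least 7 is
-- made the number of columns, if necessary by exchanging the sides. What remains is height 3, or
-- both sides 1 modulo 4 with the longer one at least 9.
odd-rectangle : ∀ bk bs → bk < bs → MagicRectangle (width bk) (width bs) ⊎ MagicRectangle (width bs) (width bk)
odd-rectangle bk bs bk<bs = by-residues (parity bk) (parity bs) bk<bs
  where
  as : ∀ {a a' b b'} → a ≡ a' → b ≡ b' → MagicRectangle a' b' → MagicRectangle a b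
  as refl refl r = r
  any : ∀ b → width b ≡ 3 + b * 2
  any b = trans (width≡ b) (cong (λ z → 3 + z) (ring b))
    where
    ring : ∀ b → b + b ≡ b * 2
    ring = solve-∀
  3mod4 : ∀ σ → width (suc σ + suc σ) ≡ 7 + σ * 4
  3mod4 σ = trans (width≡ (suc σ + suc σ)) (ring σ)
    where
    ring : ∀ σ → 3 + ((suc σ + suc σ) + (suc σ + suc σ)) ≡ 7 + σ * 4
    ring = solve-∀
  1mod4 : ∀ κ → width (suc (κ + κ)) ≡ 5 + κ * 4
  1mod4 κ = trans (width≡ (suc (κ + κ))) (ring κ)
    where
    ring : ∀ κ → 3 + (suc (κ + κ) + suc (κ + κ)) ≡ 5 + κ * 4
    ring = solve-∀
  nine : ∀ σ → 5 + suc σ * 4 ≡ 7 + suc (σ * 2) * 2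
  nine = solve-∀
  by-residues : ∀ {bk bs} → Parity bk → Parity bs → bk < bs →
                MagicRectangle (width bk) (width bs) ⊎ MagicRectangle (width bs) (width bk)
  by-residues {bk} _ (even (suc σ)) _  = inj₁ (as (any bk) (3mod4 σ) (rectangle-3mod4 bk σ))
  by-residues {bs = bs} (even (suc κ)) (odd _) _ = inj₂ (as (any bs) (3mod4 κ) (rectangle-3mod4 bs κ))
  by-residues (even zero) (odd zero) _ = inj₁ (7 , rectangle₃₅)
  by-residues (even zero) (odd (suc σ)) _ = inj₁ (as refl (trans (1mod4 (suc σ)) (nine σ)) (rectangle-three (suc (σ * 2))))
  by-residues (odd κ) (odd (suc σ)) _ = inj₁ (as (1mod4 κ) (1mod4 (suc σ)) (rectangle-1mod4 κ σ))
  by-residues (odd κ) (odd zero) (s≤s ())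
  by-residues _ (even zero) ()

full-rectangles : ∀ bk bs η → bk ≢ bs → MRSExists (width bk) (width bs) (width bs) (width bk) (suc (η + η))
full-rectangles bk bs η ne with <-cmp bk bs
... | tri< lt _ _ = either (odd-rectangle bk bs lt)
  where
  either : MagicRectangle (width bk) (width bs) ⊎ MagicRectangle (width bs) (width bk) → _
  either (inj₁ r) = rectangle-copies bk bs η r
  either (inj₂ r) = MRS-transpose (*-comm (width bs) (width bk)) (rectangle-copies bs bk η r)
... | tri≈ _ e _ = ⊥-elim (ne e)
... | tri> _ _ gt = either (odd-rectangle bs bk gt)
  where
  either : MagicRectangle (width bs) (width bk) ⊎ MagicRectangle (width bk) (width bs) → _
  either (inj₁ r) = MRS-transpose (*-comm (width bs) (width bk)) (rectangle-copies bs bk η r)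
  either (inj₂ r) = rectangle-copies bk bs η r

-- Reduction to squares and full rectangles

IsOdd : ℕ → Set
IsOdd n = ∃ λ h → n ≡ suc (h + h)

odd-form : ∀ n → ¬ (2 ∣ n) → IsOdd n
odd-form n ¬2∣n with parity n
... | even p = ⊥-elim (¬2∣n (divides p (ring p)))
  where
  ring : ∀ p → p + p ≡ p * 2
  ring = solve-∀
... | odd h = h , refl

odd-width : ∀ {n} → IsOdd n → n ≢ 1 → ∃ λ b → n ≡ width b
odd-width (zero , e) ne = ⊥-elim (ne e)
odd-width (suc b , refl) _ = b , sym (trans (width≡ b) (cong (λ z → 2 + z) (sym (+-suc b b))))

odd-* : ∀ {a b} → IsOdd a → IsOdd b → IsOdd (a * b)
odd-* (h , refl) (k , refl) = h + k + (h * k + h * k) , ring h k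
  where
  ring : ∀ h k → suc (h + h) * suc (k + k) ≡ suc ((h + k + (h * k + h * k)) + (h + k + (h * k + h * k)))
  ring = solve-∀

-- Cancelling g in m s = n k leaves m s₁ = n k₁; as k₁ is coprime to s₁, it divides m, and d is the
-- quotient.
decompose : ∀ {m n s k} → 2 ≤ s → 2 ≤ k → m * s ≡ n * k →
  ∃ λ g → ∃ λ d → ∃ λ s₁ → ∃ λ k₁ → s ≡ s₁ * g × k ≡ k₁ * g × m ≡ k₁ * d × n ≡ s₁ * d × Coprime k₁ s₁
decompose {m} {n} {s} {k} s≥2 k≥2 ms≡nk with gcd[m,n]∣m s k | gcd[m,n]∣n s k
... | divides s₁ s≡ | divides k₁ k≡ = from-divisor (coprime-divisor {n = s₁} cop (divides n (trans (*-comm s₁ m) m*s₁≡n*k₁)))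
  where
  g = gcd s k
  instance
    s≢0 : NonZero s
    s≢0 = >-nonZero (≤-trans (s≤s z≤n) s≥2)
    k≢0 : NonZero (k₁ * g)
    k≢0 = >-nonZero (subst (1 ≤_) k≡ (≤-trans (s≤s z≤n) k≥2))
    g≢0 : NonZero g
    g≢0 = m*n≢0⇒n≢0 k₁
    k₁≢0 : NonZero k₁
    k₁≢0 = m*n≢0⇒m≢0 k₁ {g}
  cop : Coprime k₁ s₁
  cop {j} (p , q) = ∣1⇒≡1 (*-cancelʳ-∣ g (subst (j * g ∣_) (sym (*-identityˡ g))
    (gcd-greatest (subst (j * g ∣_) (sym s≡) (*-monoˡ-∣ g q)) (subst (j * g ∣_) (sym k≡) (*-monoˡ-∣ g p)))))
  m*s₁≡n*k₁ : m * s₁ ≡ n * k₁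
  m*s₁≡n*k₁ = *-cancelʳ-≡ _ _ g (trans (*-assoc m s₁ g) (trans (cong (m *_) (sym s≡)) (trans ms≡nk (trans (cong (n *_) k≡) (sym (*-assoc n k₁ g))))))
  from-divisor : k₁ ∣ m → _
  from-divisor (divides d m≡) = g , d , s₁ , k₁ , s≡ , k≡ , trans m≡ (*-comm d k₁) ,
    *-cancelʳ-≡ n (s₁ * d) k₁ (trans (sym m*s₁≡n*k₁) (trans (cong (_* s₁) m≡) (ring d k₁ s₁))) , λ {j} → cop {j}
    where
    ring : ∀ d k₁ s₁ → d * k₁ * s₁ ≡ s₁ * d * k₁
    ring = solve-∀

odd-sufficiency : ∀ {m n s k c} → 2 ≤ s → s ≤ n → 2 ≤ k → m * s ≡ n * k → ¬ (2 ∣ n * k * c) → MRSExists m n s k c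
odd-sufficiency {m} {n} {s} {k} {c} s≥2 s≤n k≥2 ms≡nk ¬2∣N with decompose {m} {n} {s} {k} s≥2 k≥2 ms≡nk
... | g , d , s₁ , k₁ , refl , refl , refl , refl , cop = by-gcd (odd-form g (λ e → ¬2∣k (∣n⇒∣m*n k₁ e)))
  where
  ¬2∣k : ¬ (2 ∣ k₁ * g)
  ¬2∣k e = ¬2∣N (∣m⇒∣m*n c (∣n⇒∣m*n (s₁ * d) e))
  ¬2∣n : ¬ (2 ∣ s₁ * d)
  ¬2∣n e = ¬2∣N (∣m⇒∣m*n c (∣m⇒∣m*n (k₁ * g) e))
  odd-c : IsOdd c
  odd-c = odd-form c (λ e → ¬2∣N (∣n⇒∣m*n (s₁ * d * (k₁ * g)) e))
  odd-d : IsOdd d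
  odd-d = odd-form d (λ e → ¬2∣n (∣n⇒∣m*n s₁ e))
  odd-s₁ : IsOdd s₁
  odd-s₁ = odd-form s₁ (λ e → ¬2∣n (∣m⇒∣m*n d e))
  odd-k₁ : IsOdd k₁
  odd-k₁ = odd-form k₁ (λ e → ¬2∣k (∣m⇒∣m*n g e))

  g≤d : g ≤ d
  g≤d = *-cancelˡ-≤ s₁ {{>-nonZero (positive₁ odd-s₁)}} s≤n
    where
    positive₁ : ∀ {n} → IsOdd n → 1 ≤ n
    positive₁ (_ , refl) = s≤s z≤n

  from-squares : ∀ {g d C} → (∃ λ b → g ≡ width b) → IsOdd d → IsOdd C → g ≤ d → MRSExists d d g g C
  from-squares (b , refl) (h , refl) (η , refl) le = odd-squares b h η le

  from-full : ∀ {s₁ k₁ C} → (∃ λ b → s₁ ≡ width b) → (∃ λ b → k₁ ≡ width b) → s₁ ≢ k₁ → IsOdd C → MRSExists k₁ s₁ s₁ k₁ C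
  from-full (bs , refl) (bk , refl) ne (η , refl) = full-rectangles bk bs η (λ e → ne (cong width (sym e)))

  by-gcd : IsOdd g → MRSExists (k₁ * d) (s₁ * d) (s₁ * g) (k₁ * g) c
  by-gcd odd-g with g ≟ 1
  -- All squares of all c arrays come from one set of c k₁ s₁ squares, so that their labels fit
  -- together.
  ... | no g≢1 = MRS-tile k₁ s₁ {c = c} (from-squares (odd-width odd-g g≢1) odd-d (odd-* odd-c (odd-* odd-k₁ odd-s₁)) g≤d)
  ... | yes refl = subst₂ (λ a b → MRSExists a b (s₁ * 1) (k₁ * 1) c) (*-comm d k₁) (*-comm d s₁)
        (subst₂ (λ a b → MRSExists (d * k₁) (d * s₁) a b c) (sym (*-identityʳ s₁)) (sym (*-identityʳ k₁))
          (MRS-diagonal d (from-full (odd-width odd-s₁ s₁≢1) (odd-width odd-k₁ k₁≢1) s₁≢k₁ (odd-* odd-d odd-c))))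
    where
    ≢1 : ∀ {a} → 2 ≤ a * 1 → a ≢ 1
    ≢1 (s≤s ()) refl
    s₁≢1 : s₁ ≢ 1
    s₁≢1 = ≢1 s≥2
    k₁≢1 : k₁ ≢ 1
    k₁≢1 = ≢1 k≥2
    s₁≢k₁ : s₁ ≢ k₁
    s₁≢k₁ refl = s₁≢1 (cop (∣-refl , ∣-refl))

even-case : ∀ {m n s k c} → 2 ≤ s → s ≤ n → 2 ≤ k → k ≤ m → m * s ≡ n * k → 2 ∣ s → 2 ∣ k → s * k > 4 → MRSExists m n s k c
even-case {m} {n} {c = c} s≥2 s≤n k≥2 k≤m ms≡nk (divides a refl) (divides b refl) sk>4 = by-size a b s≥2 s≤n k≥2 k≤m ms≡nk sk>4
  where
  halve : ∀ m a n b → m * (a * 2) ≡ n * (b * 2) → m * a ≡ n * b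
  halve m a n b e = *-cancelʳ-≡ _ _ 2 (trans (*-assoc m a 2) (trans e (sym (*-assoc n b 2))))
  by-size : ∀ a b → 2 ≤ a * 2 → a * 2 ≤ n → 2 ≤ b * 2 → b * 2 ≤ m → m * (a * 2) ≡ n * (b * 2) → a * 2 * (b * 2) > 4 →
            MRSExists m n (a * 2) (b * 2) c
  by-size zero          b             () _ _ _ _ _
  by-size (suc a)       zero          _ _ () _ _ _
  by-size (suc (suc a)) (suc b)       p q r t e _ = even-sufficiency (s≤s (s≤s z≤n)) t (s≤s z≤n) (halve m (suc (suc a)) n (suc b) e)
  by-size (suc zero)    (suc (suc b)) p q r t e _ = MRS-transpose (sym e) (even-sufficiency (s≤s (s≤s z≤n)) q (s≤s z≤n) (halve n (suc (suc b)) m 1 (sym e)))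
  by-size (suc zero)    (suc zero)    p q r t e (s≤s (s≤s (s≤s (s≤s ()))))

theorem1p8 : (m n s k c : ℕ) → 1 ≤ m → 1 ≤ n → 1 ≤ s → 1 ≤ k → 1 ≤ c →
    2 ≤ s → s ≤ n → 2 ≤ k → k ≤ m → m * s ≡ n * k →
    (MRSExists m n s k c ⇔ ((¬ (2 ∣ n * k * c)) ⊎ (2 ∣ s × 2 ∣ k × s * k > 4)))
theorem1p8 m n s k c m≥1 n≥1 _ _ c≥1 s≥2 s≤n k≥2 k≤m ms≡nk = mk⇔ (necessity m≥1 n≥1 c≥1 s≥2 k≥2 ms≡nk) sufficiency
  where
  sufficiency : (¬ (2 ∣ n * k * c)) ⊎ (2 ∣ s × 2 ∣ k × s * k > 4) → MRSExists m n s k c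
  sufficiency (inj₁ ¬2∣N) = odd-sufficiency s≥2 s≤n k≥2 ms≡nk ¬2∣N
  sufficiency (inj₂ (2∣s , 2∣k , sk>4)) = even-case s≥2 s≤n k≥2 k≤m ms≡nk 2∣s 2∣k sk>4
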